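{- For $n\ge 0$ let $p(n)=t$ if $n$ is even and $p(n)=1$ if $n$ is odd, and define $$\mathbf F(n)=(b+y)^n+\sum_{i=0}^n\binom{n}{i}p(i)\,w^{n-i}z^i\in\mathbb{Z}[b,w,y,z,t],\qquad S(u)=\sum_{k\ge1}\mathbf F(k)\frac{\xi_k u^k}{k!}.$$ Apply the linear functional $\langle\cdot\rangle_{bw}$ coefficientwise in $u$ to $\exp S(u)$. Then $$\langle \exp S(u)\rangle_{bw}=\sum_{\mathbf n}u^{|\mathbf n|}\sum_{G\in G(\mathbf n)}\frac{W_G(t)\prod_k\xi_k^{n_k}}{|\operatorname{Aut}G|},$$ and $$\mathscr B(u):=\sum_{\mathbf n}u^{|\mathbf n|}\sum_{G\in G_c(\mathbf n)}\frac{W_G(t)\prod_k\xi_k^{n_k}}{|\operatorname{Aut}G|}=\log\langle\exp S(u)\rangle_{bw}.$$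
   Context: Graphs are finite and may have loops and parallel edges. A coloring is a map $c\colon V(G)\to\{0,1\}$ ($0$ white, $1$ black). A vertex $v$ is even-white if $c(v)=0$ and the total number of edges joining $v$ to black vertices (counted with multiplicity; loops at $v$ are not counted) is even. $W_G(t)=\sum_c t^{\#\{\text{even-white vertices}\}}$, and $W_\emptyset=1$. The degree of a vertex counts a loop twice. A profile is a sequence $\mathbf n=(n_1,n_2,\dots)$ of nonnegative integers, finitely many nonzero, with $|\mathbf n|=\sum_k k n_k$; $G(\mathbf n)$ is the finite set of isomorphism classes of graphs with exactly $n_k$ vertices of degree $k$ for each $k$ (for $\mathbf n=0$ this is the empty graph), and $G_c(\mathbf n)$ its subset of connected graphs. $\operatorname{Aut}G$ is the full automorphism group, including permutations of vertices, permutations of parallel edges, and flips and permutations of loops. $\xi_1,\xi_2,\dots,u$ are indeterminates. The $\mathbb{Q}[t,\xi_1,\xi_2,\dots]$-linear functional $\langle\cdot\rangle_{bw}$ on polynomials in $b,w,y,z$ is defined on monomials by $\langle b^nw^my^kz^l\rangle_{bw}=\langle b^n\rangle_{bw}\langle w^m\rangle_{bw}\langle y^kz^l\rangle_{bw}$, where $\langle b^n\rangle_{bw}=\langle w^n\rangle_{bw}=n!/(2^{n/2}(n/2)!)$ if $n$ is even and $0$ if $n$ is odd, and $\langle y^kz^l\rangle_{bw}=k!$ if $k=l$ and $0$ otherwise. -}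

module Defs where

open import Data.Nat as ℕ using (ℕ; zero; suc; _∸_; _!; _^_; _≡ᵇ_)
open import Data.Nat.Combinatorics using (_C_)
open import Data.Integer as ℤ using (ℤ; +_)
open import Data.Rational as ℚ using (ℚ; 0ℚ; 1ℚ; _/_)
open import Data.Bool using (Bool; true; false; if_then_else_; _∧_; not)
open import Data.Fin as Fin using (Fin; zero; suc)
open import Data.Fin.Base using (toℕ)
open import Data.List as List using (List; []; _∷_; _++_; map; concatMap; length; lookup; drop)
open import Data.List.Membership.Propositional using (_∈_)
open import Data.Product using (_×_; _,_; proj₁; proj₂; Σ; ∃; ∃-syntax)
open import Data.Product using () renaming (map to pmap)
open import Data.Sum using (_⊎_)
open import Relation.Nullary.Decidable using (⌊_⌋)
open import Relation.Binary.PropositionalEquality using (_≡_)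
open import Function using (_∘_; id)

-- 1/n as a rational, with the (never used) convention inv 0 = 0.
inv : ℕ → ℚ
inv zero    = 0ℚ
inv (suc n) = (+ 1) / suc n

fromℕ : ℕ → ℚ
fromℕ n = (+ n) / 1

sumTo : ℕ → (ℕ → ℚ) → ℚ
sumTo zero    f = f 0
sumTo (suc n) f = sumTo n f ℚ.+ f (suc n)

evenᵇ : ℕ → Bool
evenᵇ zero          = true
evenᵇ (suc zero)    = false
evenᵇ (suc (suc n)) = evenᵇ n

-- Polynomials over ℚ in the variables x₀, x₁, x₂, … (finitely many
-- occurring).  A monomial is its exponent list (trailing zeros
-- irrelevant); a polynomial is an unnormalised formal sum of terms.
-- Only coefficient extraction is ever used to compare polynomials.
--
-- Variable convention:  x₀ = t, x₁ = b, x₂ = w, x₃ = y, x₄ = z,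
--                       x_{4+k} = ξ_k  (k ≥ 1).

Mono : Set
Mono = List ℕ

hd : Mono → ℕ
hd []      = 0
hd (e ∷ _) = e

tl : Mono → Mono
tl []       = []
tl (_ ∷ es) = es

addMono : Mono → Mono → Mono
addMono []       m        = m
addMono (e ∷ es) []       = e ∷ es
addMono (e ∷ es) (f ∷ fs) = (e ℕ.+ f) ∷ addMono es fs

allZero : Mono → Bool
allZero []       = true
allZero (e ∷ es) = (e ≡ᵇ 0) ∧ allZero es

monoEq : Mono → Mono → Bool
monoEq []       m        = allZero m
monoEq (e ∷ es) []       = allZero (e ∷ es)
monoEq (e ∷ es) (f ∷ fs) = (e ≡ᵇ f) ∧ monoEq es fs

Poly : Set
Poly = List (ℚ × Mono)

coeff : Mono → Poly → ℚ
coeff m []             = 0ℚ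
coeff m ((c , m′) ∷ p) = (if monoEq m m′ then c else 0ℚ) ℚ.+ coeff m p

infixl 6 _⊕_
infixl 7 _⊗_

_⊕_ : Poly → Poly → Poly
_⊕_ = _++_

_⊗_ : Poly → Poly → Poly
p ⊗ q = concatMap (λ { (a , m) → map (λ { (b , m′) → (a ℚ.* b , addMono m m′) }) q }) p

scale : ℚ → Poly → Poly
scale c = map (λ { (a , m) → (c ℚ.* a , m) })

constP : ℚ → Poly
constP c = (c , []) ∷ []

oneP : Poly
oneP = constP 1ℚ

zeroP : Poly
zeroP = []

var : ℕ → Poly
var i = (1ℚ , List.replicate i 0 ++ (1 ∷ [])) ∷ []

powP : Poly → ℕ → Poly
powP p zero    = oneP
powP p (suc n) = p ⊗ powP p n

sumP : ℕ → (ℕ → Poly) → Poly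
sumP zero    f = f 0
sumP (suc n) f = sumP n f ⊕ f (suc n)

tV bV wV yV zV : Poly
tV = var 0
bV = var 1
wV = var 2
yV = var 3
zV = var 4

ξV : ℕ → Poly
ξV k = var (4 ℕ.+ k)

pp : ℕ → Poly
pp i = if evenᵇ i then tV else oneP

F : ℕ → Poly
F n = powP (bV ⊕ yV) n
    ⊕ sumP n (λ i → scale (fromℕ (n C i)) (pp i ⊗ powP wV (n ∸ i) ⊗ powP zV i))

-- Formal power series in u with polynomial coefficients:
-- a series is the function N ↦ (coefficient of u^N).

Series : Set
Series = ℕ → Poly

S : Series
S zero    = zeroP
S (suc k) = scale (inv (suc k !)) (F (suc k) ⊗ ξV (suc k))

oneS : Series
oneS zero    = oneP
oneS (suc _) = zeroP

mulS : Series → Series → Series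
mulS f g N = sumP N (λ i → f i ⊗ g (N ∸ i))

powS : Series → ℕ → Series
powS f zero    = oneS
powS f (suc j) = mulS f (powS f j)

-- exp f = Σ_{j≥0} f^j / j!, for f with zero constant term
-- (then f^j has no u^N term for j > N, so the sum is finite).
expS : Series → Series
expS f N = sumP N (λ j → scale (inv (j !)) (powS f j N))

-- log A = Σ_{j≥1} (-1)^{j+1} (A - 1)^j / j, for A with constant term 1
-- (then (A-1)^j has no u^N term for j > N).
minusOne : Series → Series
minusOne A zero    = A zero ⊕ scale (ℚ.- 1ℚ) oneP
minusOne A (suc N) = A (suc N)

signQ : ℕ → ℚ
signQ j = if evenᵇ j then ℚ.- 1ℚ else 1ℚ

logS : Series → Series
logS A zero    = zeroP
logS A (suc N) =
  sumP N (λ i → scale (signQ (suc i) ℚ.* inv (suc i)) (powS (minusOne A) (suc i) (suc N)))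

gaussMoment : ℕ → ℚ
gaussMoment n =
  if evenᵇ n then fromℕ (n !) ℚ.* inv (2 ^ (n ℕ./ 2) ℕ.* ((n ℕ./ 2) !)) else 0ℚ

yzMoment : ℕ → ℕ → ℚ
yzMoment k l = if k ≡ᵇ l then fromℕ (k !) else 0ℚ

bwTerm : ℚ × Mono → ℚ × Mono
bwTerm (c , m) =
  let et = hd m
      eb = hd (tl m)
      ew = hd (tl (tl m))
      ey = hd (tl (tl (tl m)))
      ez = hd (tl (tl (tl (tl m))))
      rest = drop 5 m
  in (c ℚ.* gaussMoment eb ℚ.* gaussMoment ew ℚ.* yzMoment ey ez
     , et ∷ 0 ∷ 0 ∷ 0 ∷ 0 ∷ rest)

bw : Poly → Poly
bw = map bwTerm

bwS : Series → Series
bwS A N = bw (A N)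

-- Finite multigraphs with loops and parallel edges.
-- Vertices Fin nv, edges Fin ne; each edge is given by its two ends
-- (an arbitrary orientation; only the unordered pair matters below).

record Graph : Set where
  field
    nv   : ℕ
    ne   : ℕ
    ends : Fin ne → Fin nv × Fin nv
open Graph public

_=ᶠ_ : ∀ {n} → Fin n → Fin n → Bool
x =ᶠ y = ⌊ x Fin.≟ y ⌋

b2n : Bool → ℕ
b2n true  = 1
b2n false = 0

sumFin : ∀ n → (Fin n → ℕ) → ℕ
sumFin zero    f = 0
sumFin (suc n) f = f zero ℕ.+ sumFin n (f ∘ suc)

allFinᵇ : ∀ n → (Fin n → Bool) → Bool
allFinᵇ zero    f = true
allFinᵇ (suc n) f = f zero ∧ allFinᵇ n (f ∘ suc)

-- degree (a loop counts twice)
degree : (G : Graph) → Fin (nv G) → ℕ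
degree G x = sumFin (ne G) (λ e → b2n (proj₁ (ends G e) =ᶠ x) ℕ.+ b2n (proj₂ (ends G e) =ᶠ x))

-- profiles: n = (n₁, n₂, …) as a list, n_k at position k-1, padded by 0
Profile : Set
Profile = List ℕ

nth0 : Profile → ℕ → ℕ
nth0 []       _       = 0
nth0 (a ∷ _)  zero    = a
nth0 (_ ∷ as) (suc k) = nth0 as k

weight : Profile → ℕ
weight = go 1
  where
  go : ℕ → Profile → ℕ
  go k []       = 0
  go k (a ∷ as) = k ℕ.* a ℕ.+ go (suc k) as

HasProfile : Profile → Graph → Set
HasProfile n G =
  ((x : Fin (nv G)) → degree G x ≡ 0 → Data.Empty.⊥) ×
  ((k : ℕ) → sumFin (nv G) (λ x → b2n (degree G x ≡ᵇ suc k)) ≡ nth0 n k)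
  where import Data.Empty

swap : ∀ {A : Set} → A × A → A × A
swap (a , b) = (b , a)

record Iso (G H : Graph) : Set where
  field
    σ  : Fin (nv G) → Fin (nv H)
    σ⁻ : Fin (nv H) → Fin (nv G)
    σσ⁻ : ∀ x → σ (σ⁻ x) ≡ x
    σ⁻σ : ∀ x → σ⁻ (σ x) ≡ x
    τ  : Fin (ne G) → Fin (ne H)
    τ⁻ : Fin (ne H) → Fin (ne G)
    ττ⁻ : ∀ e → τ (τ⁻ e) ≡ e
    τ⁻τ : ∀ e → τ⁻ (τ e) ≡ e
    incid : ∀ e → ends H (τ e) ≡ pmap σ σ (ends G e)
                ⊎ ends H (τ e) ≡ swap (pmap σ σ (ends G e))

-- reachability and connectedness (the empty graph is not connected)
data Reach (G : Graph) : Fin (nv G) → Fin (nv G) → Set where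
  here  : ∀ {x} → Reach G x x
  fwd   : ∀ {y} e → Reach G (proj₂ (ends G e)) y → Reach G (proj₁ (ends G e)) y
  bwd   : ∀ {y} e → Reach G (proj₁ (ends G e)) y → Reach G (proj₂ (ends G e)) y

Connected : Graph → Set
Connected G = Fin (nv G) × ((x y : Fin (nv G)) → Reach G x y)

consF : ∀ {n k} → Fin k → (Fin n → Fin k) → Fin (suc n) → Fin k
consF i f zero    = i
consF i f (suc x) = f x

allFuns : ∀ n k → List (Fin n → Fin k)
allFuns zero    k = (λ ()) ∷ []
allFuns (suc n) k = concatMap (λ f → map (λ i → consF i f) (List.allFin k)) (allFuns n k)

countL : ∀ {A : Set} → (A → Bool) → List A → ℕ
countL P []       = 0
countL P (a ∷ as) = b2n (P a) ℕ.+ countL P as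

injᵇ : ∀ {n k} → (Fin n → Fin k) → Bool
injᵇ {n} f = allFinᵇ n (λ x → allFinᵇ n (λ y → not (f x =ᶠ f y) Data.Bool.∨ (x =ᶠ y)))
  where import Data.Bool

pairEq : ∀ {n} → Fin n × Fin n → Fin n × Fin n → Bool
pairEq (a , b) (c , d) = (a =ᶠ c) ∧ (b =ᶠ d)

-- |Aut G|: triples (σ, τ, ε) with σ a vertex permutation, τ an edge
-- permutation, ε(e) ∈ Fin 2 saying whether edge e is flipped, such that
-- ends(τ e) = (flip^{ε e}) (σ × σ)(ends e).  Non-loop edges admit exactly
-- one ε(e); loops admit both (loop flips).
sumL : ∀ {A : Set} → (A → ℕ) → List A → ℕ
sumL f []       = 0
sumL f (a ∷ as) = f a ℕ.+ sumL f as

flipIf : ∀ {A : Set} → Fin 2 → A × A → A × A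
flipIf zero    p = p
flipIf (suc _) p = swap p

autCount : Graph → ℕ
autCount G =
  sumL (λ σ → if injᵇ σ then
    sumL (λ τ → if injᵇ τ then
      countL (λ ε → allFinᵇ (ne G) (λ e →
                 pairEq (ends G (τ e)) (flipIf (ε e) (pmap σ σ (ends G e)))))
             (allFuns (ne G) 2)
      else 0) (allFuns (ne G) (ne G))
    else 0) (allFuns (nv G) (nv G))

-- W_G(t): coefficient of t^j = number of colourings c : V → Fin 2
-- (1 = black) with exactly j even-white vertices.

isBlack : Fin 2 → Bool
isBlack zero    = false
isBlack (suc _) = true

blackNbrs : (G : Graph) → (Fin (nv G) → Fin 2) → Fin (nv G) → ℕ
blackNbrs G c x = sumFin (ne G) (λ e →
  let a = proj₁ (ends G e) ; b = proj₂ (ends G e) in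
  if a =ᶠ b then 0
  else b2n ((a =ᶠ x) ∧ isBlack (c b)) ℕ.+ b2n ((b =ᶠ x) ∧ isBlack (c a)))

evenWhite : (G : Graph) → (Fin (nv G) → Fin 2) → Fin (nv G) → Bool
evenWhite G c x = not (isBlack (c x)) ∧ evenᵇ (blackNbrs G c x)

Wcoeff : Graph → ℕ → ℕ
Wcoeff G j = countL (λ c → sumFin (nv G) (λ x → b2n (evenWhite G c x)) ≡ᵇ j)
                    (allFuns (nv G) 2)

IsReps : (Graph → Set) → Profile → List Graph → Set
IsReps P n L =
  ((G : Graph) → G ∈ L → HasProfile n G × P G) ×
  ((G : Graph) → HasProfile n G → P G → ∃[ H ] (H ∈ L × Iso G H)) ×
  ((i j : Fin (length L)) → Iso (lookup L i) (lookup L j) → i ≡ j)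

Trivial : Graph → Set
Trivial _ = Data.Unit.⊤
  where import Data.Unit

-- Coefficient of the monomial m (in t, b, w, y, z, ξ₁, ξ₂, …) in the
-- coefficient of u^N of  Σ_n u^{|n|} Σ_{G ∈ reps n} W_G(t) Π ξ_k^{n_k} / |Aut G|.
rhsCoeff : (Profile → List Graph) → ℕ → Mono → ℚ
rhsCoeff reps N m =
  let j    = hd m
      bwyz = hd (tl m) ℕ.+ hd (tl (tl m)) ℕ.+ hd (tl (tl (tl m))) ℕ.+ hd (tl (tl (tl (tl m))))
      n    = drop 5 m
  in if (bwyz ≡ᵇ 0) ∧ (weight n ≡ᵇ N)
     then List.foldr (λ G acc → fromℕ (Wcoeff G j) ℚ.* inv (autCount G) ℚ.+ acc) 0ℚ (reps n)
     else 0ℚ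

{-# OPTIONS --safe #-}

-- Colour the V vertices and give every half-edge one of four kinds, b or w if it leads to
-- a vertex of the same colour (black or white) and y or z if it leads to the other colour.
-- Then S^V expands as a sum over colourings and exponent vectors α of monomials divided by
-- α!, and the moments of ⟨·⟩ satisfy ⟨x p⟩ = ⟨∂p/∂x*⟩, where b* = b, w* = w, y* = z, z* = y.
-- Iterating this E times pairs the half-edges into edges and yields the sum over all maps
-- Fin E → Fin V × Fin V, divided by E! 2^E.  Orbit counting turns the sum over labelled
-- graphs, divided by V! E! 2^E, into the sum over isomorphism classes with weights
-- 1/|Aut G|.  For the logarithm, split off the component containing the first edge: with A
-- and B the series of all and of connected graphs this gives u A′ = (u B′) A, whence
-- B = log A.
module Submission where

open import Level using (0ℓ)
open import Defs
open import Algebra.Bundles using (CommutativeSemiring; CommutativeRing)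
open import Data.Bool as Bool using (Bool; true; false; if_then_else_; _∧_; _∨_; not)
import Data.Bool.Properties as Boolₚ
open import Data.Empty using (⊥; ⊥-elim)
open import Data.Fin as Fin using (Fin; zero; suc)
import Data.Fin.Properties as Finₚ
open import Data.List as List using (List; []; _∷_; _++_; concatMap; allFin)
import Data.List.Properties as Listₚ
open import Data.Nat as ℕ using (ℕ; zero; suc; _∸_; _!; _^_; _≡ᵇ_; _≤_; _<_; z≤n; s≤s)
import Data.Nat.Properties as ℕₚ
open import Data.Product using (_×_; _,_; proj₁; proj₂; ∃; ∃-syntax)
import Data.Product.Properties as ×ₚ
open import Data.Sum using (_⊎_; inj₁; inj₂)
open import Data.Vec as Vec using (Vec; []; _∷_; lookup)
import Data.Vec.Properties as Vecₚ
open import Function using (_∘_; id)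
open import Relation.Binary using (DecidableEquality)
open import Relation.Binary.PropositionalEquality using (_≡_; _≢_; refl; sym; trans; cong; cong₂; subst; module ≡-Reasoning)
open import Relation.Nullary using (¬_; Dec; yes; no; does; contradiction)
open import Relation.Nullary.Decidable using (isYes≗does; map′; _×-dec_; dec-true; dec-false)
open import Data.Rational as ℚ using (ℚ; 0ℚ; 1ℚ)
import Data.Rational.Properties as ℚₚ
open import Data.Rational.Unnormalised as ℚᵘ using (mkℚᵘ; *≡*)
import Data.Rational.Unnormalised.Properties as ℚᵘₚ
open import Data.Integer as ℤ using (ℤ)
import Data.Integer.Properties as ℤₚ
open import Function.Bundles using (Equivalence)
import Relation.Binary.Reasoning.Setoid
import Data.Nat.DivMod as DivMod
import Data.Nat.Divisibility as Div
open import Data.Nat.Properties using (_!≢0)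
import Algebra.Solver.Ring.NaturalCoefficients.Default
open import Data.Nat.Solver using (module +-*-Solver)
open +-*-Solver using (con) renaming (solve to solveℕ; _:*_ to _:*′_; _:+_ to _:+′_; _:=_ to _:=′_)
open import Data.Nat.Combinatorics using (_C_; nCk≡n!/k![n-k]!; k![n∸k]!∣n!)
import Relation.Binary.Definitions as Tri
open import Data.Unit using (tt)
open import Data.List.Membership.Propositional.Properties using (∈-lookup)
open import Data.List.Relation.Unary.Any using (index)
open import Data.List.Relation.Unary.Any.Properties using (lookup-index)

-- At a white vertex the exponent of z counts the half-edges leading to black vertices, and a loop
-- always joins equal colours. Hence the factor p(i) equals t exactly at the even-white vertices,
-- and loops drop out by themselves. The colours of two vertices leave exactly one pair of kinds
-- that can be joined, so every edge fits every colouring and the sum over colourings carries no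
-- constraint. Two choices shape the counting. Edges are labelled and oriented, like the vertices,
-- so that loops and parallel edges are treated uniformly; all symmetry sits in the factor V! E! 2^E
-- and returns as |Aut G|, flips included. And the component split off is that of an edge rather
-- than of a vertex, because u records only edges: u d/du multiplies by 2E. This works because S has
-- no constant term: a vertex of degree 0 has weight 0, so every component that counts contains an
-- edge, and V is at most 2E, which keeps the sums over V finite.

-- Finite sums and products in a commutative semiring

module FinSum (R : CommutativeSemiring 0ℓ 0ℓ) where
  open CommutativeSemiring R hiding (zero) renaming (refl to ≈-refl; sym to ≈-sym; trans to ≈-trans; reflexive to ≈-reflexive)
  open import Relation.Binary.Reasoning.Setoid setoid
  open import Algebra.Properties.CommutativeSemigroup +-commutativeSemigroup using (interchange)

  ∑ : {A : Set} → List A → (A → Carrier) → Carrier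
  ∑ []       f = 0#
  ∑ (a ∷ as) f = f a + ∑ as f

  ∑-cong : ∀ {A : Set} (as : List A) {f g : A → Carrier} → (∀ a → f a ≈ g a) → ∑ as f ≈ ∑ as g
  ∑-cong []       e = ≈-refl
  ∑-cong (a ∷ as) e = +-cong (e a) (∑-cong as e)

  ∑-0 : ∀ {A : Set} (as : List A) → ∑ as (λ _ → 0#) ≈ 0#
  ∑-0 []       = ≈-refl
  ∑-0 (a ∷ as) = ≈-trans (+-identityˡ _) (∑-0 as)

  ∑-zero : ∀ {A : Set} (as : List A) {f : A → Carrier} → (∀ a → f a ≈ 0#) → ∑ as f ≈ 0#
  ∑-zero as e = ≈-trans (∑-cong as e) (∑-0 as)

  ∑-+ : ∀ {A : Set} (as : List A) (f g : A → Carrier) → ∑ as (λ a → f a + g a) ≈ ∑ as f + ∑ as g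
  ∑-+ []       f g = ≈-sym (+-identityˡ 0#)
  ∑-+ (a ∷ as) f g = ≈-trans (+-congˡ (∑-+ as f g)) (interchange _ _ _ _)

  ∑-*ˡ : ∀ {A : Set} (as : List A) c (f : A → Carrier) → ∑ as (λ a → c * f a) ≈ c * ∑ as f
  ∑-*ˡ []       c f = ≈-sym (zeroʳ c)
  ∑-*ˡ (a ∷ as) c f = ≈-trans (+-congˡ (∑-*ˡ as c f)) (≈-sym (distribˡ c _ _))

  ∑-*ʳ : ∀ {A : Set} (as : List A) c (f : A → Carrier) → ∑ as (λ a → f a * c) ≈ ∑ as f * c
  ∑-*ʳ as c f = ≈-trans (∑-cong as λ a → *-comm _ _) (≈-trans (∑-*ˡ as c f) (*-comm _ _))

  ∑-++ : ∀ {A : Set} (as bs : List A) (f : A → Carrier) → ∑ (as ++ bs) f ≈ ∑ as f + ∑ bs f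
  ∑-++ []       bs f = ≈-sym (+-identityˡ _)
  ∑-++ (a ∷ as) bs f = ≈-trans (+-congˡ (∑-++ as bs f)) (≈-sym (+-assoc _ _ _))

  ∑-map : ∀ {A B : Set} (h : A → B) (as : List A) (f : B → Carrier) → ∑ (List.map h as) f ≈ ∑ as (f ∘ h)
  ∑-map h []       f = ≈-refl
  ∑-map h (a ∷ as) f = +-congˡ (∑-map h as f)

  ∑-concatMap : ∀ {A B : Set} (h : A → List B) (as : List A) (f : B → Carrier) →
                ∑ (concatMap h as) f ≈ ∑ as (λ a → ∑ (h a) f)
  ∑-concatMap h []       f = ≈-refl
  ∑-concatMap h (a ∷ as) f = ≈-trans (∑-++ (h a) (concatMap h as) f) (+-congˡ (∑-concatMap h as f))

  ∑-swap : ∀ {A B : Set} (as : List A) (bs : List B) (f : A → B → Carrier) →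
           ∑ as (λ a → ∑ bs (f a)) ≈ ∑ bs (λ b → ∑ as (λ a → f a b))
  ∑-swap []       bs f = ≈-sym (∑-0 bs)
  ∑-swap (a ∷ as) bs f = ≈-trans (+-congˡ (∑-swap as bs f)) (≈-sym (∑-+ bs (f a) (λ b → ∑ as (λ a → f a b))))

  ∑-tabulate : ∀ {A : Set} n (h : Fin n → A) (f : A → Carrier) → ∑ (List.tabulate h) f ≈ ∑ (allFin n) (f ∘ h)
  ∑-tabulate n h f = ≈-trans (≈-reflexive (cong (λ l → ∑ l f) (sym (Listₚ.map-tabulate id h)))) (∑-map h (allFin n) f)

  ∑-allFin-suc : ∀ n (f : Fin (suc n) → Carrier) → ∑ (allFin (suc n)) f ≈ f zero + ∑ (allFin n) (f ∘ suc)
  ∑-allFin-suc n f = +-congˡ (∑-tabulate n suc f)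

  ∏ : ∀ n → (Fin n → Carrier) → Carrier
  ∏ zero    f = 1#
  ∏ (suc n) f = f zero * ∏ n (f ∘ suc)

  ∏-cong : ∀ n {f g : Fin n → Carrier} → (∀ a → f a ≈ g a) → ∏ n f ≈ ∏ n g
  ∏-cong zero    e = ≈-refl
  ∏-cong (suc n) e = *-cong (e zero) (∏-cong n (e ∘ suc))

  δ : Bool → Carrier
  δ true  = 1#
  δ false = 0#

  cast : ℕ → Carrier
  cast zero    = 0#
  cast (suc n) = 1# + cast n

  cast-1 : cast 1 ≈ 1#
  cast-1 = +-identityʳ 1#

  cast-+ : ∀ m n → cast (m ℕ.+ n) ≈ cast m + cast n
  cast-+ zero    n = ≈-sym (+-identityˡ _)
  cast-+ (suc m) n = ≈-trans (+-congˡ (cast-+ m n)) (≈-sym (+-assoc _ _ _))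

  cast-* : ∀ m n → cast (m ℕ.* n) ≈ cast m * cast n
  cast-* zero    n = ≈-sym (zeroˡ _)
  cast-* (suc m) n = begin
    cast (n ℕ.+ m ℕ.* n)         ≈⟨ cast-+ n (m ℕ.* n) ⟩
    cast n + cast (m ℕ.* n)      ≈⟨ +-cong (≈-sym (*-identityˡ _)) (cast-* m n) ⟩
    1# * cast n + cast m * cast n ≈⟨ distribʳ _ _ _ ⟨
    (1# + cast m) * cast n ∎

  cast-b2n : ∀ p → cast (b2n p) ≈ δ p
  cast-b2n true  = cast-1
  cast-b2n false = ≈-refl

  cast-countL : ∀ {A : Set} (P : A → Bool) as → cast (countL P as) ≈ ∑ as (δ ∘ P)
  cast-countL P []       = ≈-refl
  cast-countL P (a ∷ as) = ≈-trans (cast-+ (b2n (P a)) _) (+-cong (cast-b2n (P a)) (cast-countL P as))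

-- Types with a complete enumeration free of repetitions

module ∑ℕ = FinSum ℕₚ.+-*-commutativeSemiring

-- Counting one for every element says at once that the list is complete and that nothing is
-- repeated. Sums over such lists are invariant under bijections, which replaces any reasoning about
-- rearranged lists.
record Enum (A : Set) : Set where
  field
    elems : List A
    _≟_   : DecidableEquality A
    once  : ∀ b → countL (λ a → does (a ≟ b)) elems ≡ 1

countL-∑ : ∀ {A : Set} (P : A → Bool) as → countL P as ≡ ∑ℕ.∑ as (b2n ∘ P)
countL-∑ P []       = refl
countL-∑ P (a ∷ as) = cong (b2n (P a) ℕ.+_) (countL-∑ P as)

b2n-∧ : ∀ p q → b2n (p ∧ q) ≡ b2n p ℕ.* b2n q
b2n-∧ true  q = sym (ℕₚ.+-identityʳ _)
b2n-∧ false q = refl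

finEnum : ∀ n → Enum (Fin n)
finEnum n = record { elems = allFin n ; _≟_ = Fin._≟_ ; once = λ b → trans (countL-∑ _ (allFin n)) (go n b) }
  where
  go : ∀ n (b : Fin n) → ∑ℕ.∑ (allFin n) (λ a → b2n (does (a Fin.≟ b))) ≡ 1
  go (suc n) zero    = trans (∑ℕ.∑-allFin-suc n (λ a → b2n (does (a Fin.≟ zero)))) (cong suc (∑ℕ.∑-zero (allFin n) λ _ → refl))
  go (suc n) (suc b) = trans (∑ℕ.∑-allFin-suc n (λ a → b2n (does (a Fin.≟ suc b)))) (trans (∑ℕ.∑-cong (allFin n) λ _ → refl) (go n b))

boolEnum : Enum Bool
boolEnum = record { elems = false ∷ true ∷ [] ; _≟_ = Bool._≟_ ; once = λ { false → refl ; true → refl } }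

module _ {A B : Set} (EA : Enum A) (EB : Enum B) where
  private
    module A = Enum EA
    module B = Enum EB

  ×Enum : Enum (A × B)
  ×Enum = record
    { elems = pairs
    ; _≟_   = _≟_
    ; once  = λ ab → trans (countL-∑ _ pairs) (go ab) }
    where
    open ≡-Reasoning
    pairs = concatMap (λ a → List.map (a ,_) B.elems) A.elems
    _≟_ : DecidableEquality (A × B)
    (a , b) ≟ (a′ , b′) = map′ (λ { (refl , refl) → refl }) ×ₚ.,-injective (a A.≟ a′ ×-dec b B.≟ b′)
    go : ∀ ab → ∑ℕ.∑ pairs (λ x → b2n (does (x ≟ ab))) ≡ 1
    go (a′ , b′) = begin
      ∑ℕ.∑ pairs f
        ≡⟨ ∑ℕ.∑-concatMap (λ a → List.map (a ,_) B.elems) A.elems f ⟩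
      ∑ℕ.∑ A.elems (λ a → ∑ℕ.∑ (List.map (a ,_) B.elems) f)
        ≡⟨ ∑ℕ.∑-cong A.elems (λ a → trans (∑ℕ.∑-map (a ,_) B.elems f)
             (trans (∑ℕ.∑-cong B.elems λ b → b2n-∧ (does (a A.≟ a′)) (does (b B.≟ b′)))
             (trans (∑ℕ.∑-*ˡ B.elems (b2n (does (a A.≟ a′))) _)
             (trans (cong (b2n (does (a A.≟ a′)) ℕ.*_) (trans (sym (countL-∑ _ B.elems)) (B.once b′))) (ℕₚ.*-identityʳ _))))) ⟩
      ∑ℕ.∑ A.elems (λ a → b2n (does (a A.≟ a′)))
        ≡⟨ trans (sym (countL-∑ _ A.elems)) (A.once a′) ⟩
      1 ∎
      where f = λ x → b2n (does (x ≟ (a′ , b′)))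

vecs : ∀ {A : Set} → List A → ∀ n → List (Vec A n)
vecs as zero    = [] ∷ []
vecs as (suc n) = concatMap (λ a → List.map (a ∷_) (vecs as n)) as

vecEnum : ∀ {A : Set} → Enum A → ∀ n → Enum (Vec A n)
vecEnum {A} EA n = record { elems = vecs A.elems n ; _≟_ = Vecₚ.≡-dec A._≟_ ; once = λ v → trans (countL-∑ _ (vecs A.elems n)) (go n v) }
  where
  module A = Enum EA
  go : ∀ n (v : Vec A n) → ∑ℕ.∑ (vecs A.elems n) (λ u → b2n (does (Vecₚ.≡-dec A._≟_ u v))) ≡ 1
  go zero    []      = refl
  go (suc n) (b ∷ v) = trans (∑ℕ.∑-concatMap (λ a → List.map (a ∷_) (vecs A.elems n)) A.elems f) (trans (∑ℕ.∑-cong A.elems λ a →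
      trans (∑ℕ.∑-map (a ∷_) (vecs A.elems n) f)
     (trans (∑ℕ.∑-cong (vecs A.elems n) λ u → b2n-∧ (does (a A.≟ b)) (does (Vecₚ.≡-dec A._≟_ u v)))
     (trans (∑ℕ.∑-*ˡ (vecs A.elems n) (b2n (does (a A.≟ b))) _)
     (trans (cong (b2n (does (a A.≟ b)) ℕ.*_) (go n v)) (ℕₚ.*-identityʳ _)))))
    (trans (sym (countL-∑ _ A.elems)) (A.once b)))
    where f = λ u → b2n (does (Vecₚ.≡-dec A._≟_ u (b ∷ v)))

does-⇔ : ∀ {P Q : Set} (p : Dec P) (q : Dec Q) → (P → Q) → (Q → P) → does p ≡ does q
does-⇔ (yes p) q f g = sym (dec-true q (f p))
does-⇔ (no ¬p) q f g = sym (dec-false q (¬p ∘ g))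

bool-⇔ : ∀ p q → (p ≡ true → q ≡ true) → (q ≡ true → p ≡ true) → p ≡ q
bool-⇔ true  q     f g = sym (f refl)
bool-⇔ false true  f g = g refl
bool-⇔ false false f g = refl

≡-true : ∀ {A : Set} {x y : A} (d : Dec (x ≡ y)) → does d ≡ true → x ≡ y
≡-true (yes e) _ = e

module EnumSum (R : CommutativeSemiring 0ℓ 0ℓ) where
  open CommutativeSemiring R hiding (zero) renaming (refl to ≈-refl; sym to ≈-sym; trans to ≈-trans; reflexive to ≈-reflexive)
  open import Relation.Binary.Reasoning.Setoid setoid
  open FinSum R

  ∑-vecs-suc : ∀ {A : Set} (as : List A) n (f : Vec A (suc n) → Carrier) →
               ∑ (vecs as (suc n)) f ≈ ∑ as (λ a → ∑ (vecs as n) (λ v → f (a ∷ v)))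
  ∑-vecs-suc as n f = ≈-trans (∑-concatMap _ as f) (∑-cong as λ a → ∑-map (a ∷_) (vecs as n) f)

  module _ {A : Set} (EA : Enum A) where
    open Enum EA

    ∑-δ≡1 : ∀ b → ∑ elems (λ a → δ (does (a ≟ b))) ≈ 1#
    ∑-δ≡1 b = ≈-trans (≈-sym (cast-countL _ elems)) (≈-trans (≈-reflexive (cong cast (once b))) cast-1)

    ∑-δ : ∀ b (f : A → Carrier) → ∑ elems (λ a → δ (does (a ≟ b)) * f a) ≈ f b
    ∑-δ b f = begin
      ∑ elems (λ a → δ (does (a ≟ b)) * f a) ≈⟨ ∑-cong elems (λ a → at a (a ≟ b)) ⟩
      ∑ elems (λ a → δ (does (a ≟ b)) * f b) ≈⟨ ∑-*ʳ elems (f b) _ ⟩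
      ∑ elems (λ a → δ (does (a ≟ b))) * f b ≈⟨ *-congʳ (∑-δ≡1 b) ⟩
      1# * f b                               ≈⟨ *-identityˡ _ ⟩
      f b ∎
      where
      at : ∀ a (d : Dec (a ≡ b)) → δ (does d) * f a ≈ δ (does d) * f b
      at a (yes e) = *-congˡ (≈-reflexive (cong f e))
      at a (no _)  = ≈-trans (zeroˡ _) (≈-sym (zeroˡ _))

    ∑-unique : ∀ b (P : A → Bool) → P b ≡ true → (∀ a → P a ≡ true → a ≡ b) → ∑ elems (δ ∘ P) ≈ 1#
    ∑-unique b P Pb u = ≈-trans (∑-cong elems λ a → ≈-reflexive (cong δ (bool-⇔ (P a) (does (a ≟ b))
      (λ p → dec-true (a ≟ b) (u a p)) (λ q → trans (cong P (≡-true (a ≟ b) q)) Pb)))) (∑-δ≡1 b)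

  -- Each `f (σ a)` is expanded against the delta at `σ a`; after the two sums are exchanged, the
  -- inner one counts the preimages of `b`, and `σ⁻ b` is the only one.
  ∑-reindex : ∀ {A B : Set} (EA : Enum A) (EB : Enum B) (σ : A → B) (σ⁻ : B → A) →
              (∀ b → σ (σ⁻ b) ≡ b) → (∀ a → σ⁻ (σ a) ≡ a) → (f : B → Carrier) →
              ∑ (Enum.elems EA) (f ∘ σ) ≈ ∑ (Enum.elems EB) f
  ∑-reindex EA EB σ σ⁻ σσ⁻ σ⁻σ f = begin
    ∑ A.elems (f ∘ σ)
      ≈⟨ ∑-cong A.elems (λ a → ≈-sym (∑-δ EB (σ a) f)) ⟩
    ∑ A.elems (λ a → ∑ B.elems (λ b → δ (does (b B.≟ σ a)) * f b))
      ≈⟨ ∑-swap A.elems B.elems _ ⟩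
    ∑ B.elems (λ b → ∑ A.elems (λ a → δ (does (b B.≟ σ a)) * f b))
      ≈⟨ ∑-cong B.elems (λ b → ≈-trans (∑-*ʳ A.elems (f b) _) (≈-trans (*-congʳ (one b)) (*-identityˡ _))) ⟩
    ∑ B.elems f ∎
    where
    module A = Enum EA
    module B = Enum EB
    one : ∀ b → ∑ A.elems (λ a → δ (does (b B.≟ σ a))) ≈ 1#
    one b = ∑-unique EA (σ⁻ b) _ (dec-true (b B.≟ _) (sym (σσ⁻ b)))
      (λ a p → trans (sym (σ⁻σ a)) (cong σ⁻ (sym (≡-true (b B.≟ σ a) p))))

module Qᵣ = CommutativeRing ℚₚ.+-*-commutativeRing
module ∑ℚ = FinSum Qᵣ.commutativeSemiring
open Algebra.Solver.Ring.NaturalCoefficients.Default Qᵣ.commutativeSemiring using () renaming (solve to solveᵠ; _:*_ to _:*″_; _:=_ to _:=″_)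
open ∑ℚ using () renaming (∑ to ∑ᵠ; cast to castᵠ; δ to δᵠ)

-- Rational numbers

fromℕ≡cast : ∀ n → fromℕ n ≡ castᵠ n
fromℕ≡cast zero    = refl
fromℕ≡cast (suc n) = trans step (cong (1ℚ ℚ.+_) (fromℕ≡cast n))
  where
  step : fromℕ (suc n) ≡ 1ℚ ℚ.+ fromℕ n
  step = ℚₚ.toℚᵘ-injective (begin
    ℚ.toℚᵘ (fromℕ (suc n))             ≈⟨ ℚₚ.toℚᵘ-fromℚᵘ (mkℚᵘ (ℤ.+ suc n) 0) ⟩
    mkℚᵘ (ℤ.+ suc n) 0                 ≈⟨ *≡* (cong (ℤ._* ℤ.1ℤ) (cong (λ x → ℤ.1ℤ ℤ.+ x) (sym (ℤₚ.*-identityʳ (ℤ.+ n))))) ⟩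
    mkℚᵘ (ℤ.+ 1) 0 ℚᵘ.+ mkℚᵘ (ℤ.+ n) 0 ≈⟨ ℚᵘₚ.+-congʳ (mkℚᵘ (ℤ.+ 1) 0) (ℚᵘₚ.≃-sym (ℚₚ.toℚᵘ-fromℚᵘ (mkℚᵘ (ℤ.+ n) 0))) ⟩
    ℚ.toℚᵘ 1ℚ ℚᵘ.+ ℚ.toℚᵘ (fromℕ n)    ≈⟨ ℚᵘₚ.≃-sym (ℚₚ.toℚᵘ-homo-+ 1ℚ (fromℕ n)) ⟩
    ℚ.toℚᵘ (1ℚ ℚ.+ fromℕ n) ∎)
    where open import Relation.Binary.Reasoning.Setoid ℚᵘₚ.≃-setoid

inv-cast : ∀ n → inv (suc n) ℚ.* castᵠ (suc n) ≡ 1ℚ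
inv-cast n = trans (cong (inv (suc n) ℚ.*_) (sym (fromℕ≡cast (suc n)))) (ℚₚ.toℚᵘ-injective (begin
  ℚ.toℚᵘ (inv (suc n) ℚ.* fromℕ (suc n))            ≈⟨ ℚₚ.toℚᵘ-homo-* (inv (suc n)) (fromℕ (suc n)) ⟩
  ℚ.toℚᵘ (inv (suc n)) ℚᵘ.* ℚ.toℚᵘ (fromℕ (suc n))  ≈⟨ ℚᵘₚ.*-cong (ℚₚ.toℚᵘ-fromℚᵘ (mkℚᵘ (ℤ.+ 1) n)) (ℚₚ.toℚᵘ-fromℚᵘ (mkℚᵘ (ℤ.+ suc n) 0)) ⟩
  mkℚᵘ (ℤ.+ 1) n ℚᵘ.* mkℚᵘ (ℤ.+ suc n) 0            ≈⟨ *≡* (cong (ℤ.+_ ∘ suc) (trans (ℕₚ.*-identityʳ (n ℕ.+ 0)) (trans (ℕₚ.+-identityʳ n) (sym (trans (ℕₚ.+-identityʳ (n ℕ.* 1)) (ℕₚ.*-identityʳ n)))))) ⟩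
  ℚ.toℚᵘ 1ℚ ∎))
  where open import Relation.Binary.Reasoning.Setoid ℚᵘₚ.≃-setoid

castᵠ-+ : ∀ m n → castᵠ (m ℕ.+ n) ≡ castᵠ m ℚ.+ castᵠ n
castᵠ-+ = ∑ℚ.cast-+

castᵠ-* : ∀ m n → castᵠ (m ℕ.* n) ≡ castᵠ m ℚ.* castᵠ n
castᵠ-* = ∑ℚ.cast-*

inv-nonZero : ∀ n → .{{ℕ.NonZero n}} → inv n ℚ.* castᵠ n ≡ 1ℚ
inv-nonZero (suc n) = inv-cast n

invertible-unique : ∀ {p q} r → p ℚ.* r ≡ 1ℚ → q ℚ.* r ≡ 1ℚ → p ≡ q
invertible-unique {p} {q} r pr qr = begin
  p              ≡⟨ sym (ℚₚ.*-identityˡ p) ⟩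
  1ℚ ℚ.* p       ≡⟨ cong (ℚ._* p) (sym qr) ⟩
  (q ℚ.* r) ℚ.* p ≡⟨ ℚₚ.*-assoc q r p ⟩
  q ℚ.* (r ℚ.* p) ≡⟨ cong (q ℚ.*_) (trans (ℚₚ.*-comm r p) pr) ⟩
  q ℚ.* 1ℚ       ≡⟨ ℚₚ.*-identityʳ q ⟩
  q ∎
  where open ≡-Reasoning

inv-* : ∀ m n → .{{ℕ.NonZero m}} → .{{ℕ.NonZero n}} → inv (m ℕ.* n) ≡ inv m ℚ.* inv n
inv-* m n = invertible-unique (castᵠ (m ℕ.* n)) (inv-nonZero (m ℕ.* n) {{ℕₚ.m*n≢0 m n}}) (begin
  inv m ℚ.* inv n ℚ.* castᵠ (m ℕ.* n)              ≡⟨ cong (inv m ℚ.* inv n ℚ.*_) (castᵠ-* m n) ⟩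
  inv m ℚ.* inv n ℚ.* (castᵠ m ℚ.* castᵠ n)        ≡⟨ interchange (inv m) (inv n) (castᵠ m) (castᵠ n) ⟩
  inv m ℚ.* castᵠ m ℚ.* (inv n ℚ.* castᵠ n)        ≡⟨ cong₂ ℚ._*_ (inv-nonZero m) (inv-nonZero n) ⟩
  1ℚ ∎)
  where
  open ≡-Reasoning
  open import Algebra.Properties.CommutativeSemigroup Qᵣ.*-commutativeSemigroup using (interchange)

-- Polynomials up to equality of all coefficients form a commutative ring.
-- A polynomial is tested against all functions φ on monomials that ignore
-- trailing zeros; this makes products easy, as they become iterated sums.

Respects : (Mono → ℚ) → Set
Respects φ = ∀ m m′ → (∀ i → nth0 m i ≡ nth0 m′ i) → φ m ≡ φ m′

eval : Poly → (Mono → ℚ) → ℚ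
eval p φ = ∑ᵠ p (λ cm → proj₁ cm ℚ.* φ (proj₂ cm))

infix 4 _≈_
record _≈_ (p q : Poly) : Set where
  constructor mk≈
  field at : ∀ φ → Respects φ → eval p φ ≡ eval q φ
open _≈_

nth0-addMono : ∀ m m′ i → nth0 (addMono m m′) i ≡ nth0 m i ℕ.+ nth0 m′ i
nth0-addMono []      m′      i       = refl
nth0-addMono (e ∷ m) []      i       = sym (ℕₚ.+-identityʳ _)
nth0-addMono (e ∷ m) (f ∷ n) zero    = refl
nth0-addMono (e ∷ m) (f ∷ n) (suc i) = nth0-addMono m n i

shift-respects : ∀ {φ} → Respects φ → ∀ m → Respects (φ ∘ addMono m)
shift-respects r m m₁ m₂ e = r _ _ λ i →
  trans (nth0-addMono m m₁ i) (trans (cong (nth0 m i ℕ.+_) (e i)) (sym (nth0-addMono m m₂ i)))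

eval-cong : ∀ p {φ ψ} → (∀ m → φ m ≡ ψ m) → eval p φ ≡ eval p ψ
eval-cong p e = ∑ℚ.∑-cong p λ cm → cong (proj₁ cm ℚ.*_) (e (proj₂ cm))

eval-⊕ : ∀ p q φ → eval (p ⊕ q) φ ≡ eval p φ ℚ.+ eval q φ
eval-⊕ p q φ = ∑ℚ.∑-++ p q _

eval-⊗ : ∀ p q φ → eval (p ⊗ q) φ ≡ eval p (λ m → eval q (λ m′ → φ (addMono m m′)))
eval-⊗ p q φ = trans (∑ℚ.∑-concatMap _ p _) (∑ℚ.∑-cong p λ am → trans (∑ℚ.∑-map _ q _)
  (trans (∑ℚ.∑-cong q λ bm → ℚₚ.*-assoc (proj₁ am) (proj₁ bm) _) (∑ℚ.∑-*ˡ q (proj₁ am) _)))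

eval-scale : ∀ c p φ → eval (scale c p) φ ≡ c ℚ.* eval p φ
eval-scale c p φ = trans (∑ℚ.∑-map _ p _)
  (trans (∑ℚ.∑-cong p λ bm → ℚₚ.*-assoc c (proj₁ bm) _) (∑ℚ.∑-*ˡ p c _))

eval-const : ∀ c φ → eval (constP c) φ ≡ c ℚ.* φ []
eval-const c φ = ℚₚ.+-identityʳ _

eval-const-⊗ : ∀ c p φ → eval (constP c ⊗ p) φ ≡ c ℚ.* eval p φ
eval-const-⊗ c p φ = trans (eval-⊗ (constP c) p φ) (eval-const c (λ m → eval p (φ ∘ addMono m)))

eval-swap : ∀ p q (ψ : Mono → Mono → ℚ) → eval p (λ m → eval q (ψ m)) ≡ eval q (λ m′ → eval p (λ m → ψ m m′))
eval-swap p q ψ = begin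
  ∑ᵠ p (λ am → proj₁ am ℚ.* ∑ᵠ q (λ bm → proj₁ bm ℚ.* ψ (proj₂ am) (proj₂ bm)))
    ≡⟨ ∑ℚ.∑-cong p (λ am → sym (∑ℚ.∑-*ˡ q (proj₁ am) _)) ⟩
  ∑ᵠ p (λ am → ∑ᵠ q (λ bm → proj₁ am ℚ.* (proj₁ bm ℚ.* ψ (proj₂ am) (proj₂ bm))))
    ≡⟨ ∑ℚ.∑-swap p q _ ⟩
  ∑ᵠ q (λ bm → ∑ᵠ p (λ am → proj₁ am ℚ.* (proj₁ bm ℚ.* ψ (proj₂ am) (proj₂ bm))))
    ≡⟨ ∑ℚ.∑-cong q (λ bm → trans (∑ℚ.∑-cong p λ am → x∙yz≈y∙xz (proj₁ am) (proj₁ bm) _) (∑ℚ.∑-*ˡ p (proj₁ bm) _)) ⟩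
  ∑ᵠ q (λ bm → proj₁ bm ℚ.* ∑ᵠ p (λ am → proj₁ am ℚ.* ψ (proj₂ am) (proj₂ bm))) ∎
  where
  open ≡-Reasoning
  open import Algebra.Properties.CommutativeSemigroup Qᵣ.*-commutativeSemigroup using (x∙yz≈y∙xz)

eval-respects : ∀ q {φ} → Respects φ → Respects (λ m → eval q (λ m′ → φ (addMono m m′)))
eval-respects q r m₁ m₂ e = eval-cong q λ m′ → r _ _ λ i →
  trans (nth0-addMono m₁ m′ i) (trans (cong (ℕ._+ nth0 m′ i) (e i)) (sym (nth0-addMono m₂ m′ i)))

addMono-comm : ∀ m m′ i → nth0 (addMono m m′) i ≡ nth0 (addMono m′ m) i
addMono-comm m m′ i = trans (nth0-addMono m m′ i) (trans (ℕₚ.+-comm (nth0 m i) _) (sym (nth0-addMono m′ m i)))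

addMono-assoc : ∀ m m′ m″ i → nth0 (addMono (addMono m m′) m″) i ≡ nth0 (addMono m (addMono m′ m″)) i
addMono-assoc m m′ m″ i = trans (nth0-addMono (addMono m m′) m″ i) (trans (cong (ℕ._+ nth0 m″ i) (nth0-addMono m m′ i))
  (trans (ℕₚ.+-assoc (nth0 m i) _ _) (sym (trans (nth0-addMono m (addMono m′ m″) i) (cong (nth0 m i ℕ.+_) (nth0-addMono m′ m″ i))))))

⊗-cong : ∀ {p p′ q q′} → p ≈ p′ → q ≈ q′ → p ⊗ q ≈ p′ ⊗ q′
⊗-cong {p} {p′} {q} {q′} e f .at φ r = begin
  eval (p ⊗ q) φ                                     ≡⟨ eval-⊗ p q φ ⟩
  eval p (λ m → eval q (λ m′ → φ (addMono m m′)))    ≡⟨ eval-cong p (λ m → f .at _ (shift-respects r m)) ⟩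
  eval p (λ m → eval q′ (λ m′ → φ (addMono m m′)))   ≡⟨ e .at _ (eval-respects q′ r) ⟩
  eval p′ (λ m → eval q′ (λ m′ → φ (addMono m m′)))  ≡⟨ sym (eval-⊗ p′ q′ φ) ⟩
  eval (p′ ⊗ q′) φ ∎
  where open ≡-Reasoning

⊗-comm : ∀ p q → p ⊗ q ≈ q ⊗ p
⊗-comm p q .at φ r = begin
  eval (p ⊗ q) φ                                    ≡⟨ eval-⊗ p q φ ⟩
  eval p (λ m → eval q (λ m′ → φ (addMono m m′)))   ≡⟨ eval-swap p q _ ⟩
  eval q (λ m′ → eval p (λ m → φ (addMono m m′)))   ≡⟨ eval-cong q (λ m′ → eval-cong p λ m → r _ _ (addMono-comm m m′)) ⟩
  eval q (λ m′ → eval p (λ m → φ (addMono m′ m)))   ≡⟨ sym (eval-⊗ q p φ) ⟩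
  eval (q ⊗ p) φ ∎
  where open ≡-Reasoning

⊗-assoc : ∀ p q s → (p ⊗ q) ⊗ s ≈ p ⊗ (q ⊗ s)
⊗-assoc p q s .at φ r = begin
  eval ((p ⊗ q) ⊗ s) φ
    ≡⟨ trans (eval-⊗ (p ⊗ q) s φ) (eval-⊗ p q _) ⟩
  eval p (λ m → eval q (λ m′ → eval s (λ m″ → φ (addMono (addMono m m′) m″))))
    ≡⟨ eval-cong p (λ m → eval-cong q λ m′ → eval-cong s λ m″ → r _ _ (addMono-assoc m m′ m″)) ⟩
  eval p (λ m → eval q (λ m′ → eval s (λ m″ → φ (addMono m (addMono m′ m″)))))
    ≡⟨ sym (trans (eval-⊗ p (q ⊗ s) φ) (eval-cong p λ m → eval-⊗ q s _)) ⟩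
  eval (p ⊗ (q ⊗ s)) φ ∎
  where open ≡-Reasoning

⊗-identityˡ : ∀ p → oneP ⊗ p ≈ p
⊗-identityˡ p .at φ r = trans (eval-const-⊗ 1ℚ p φ) (ℚₚ.*-identityˡ _)

⊗-distribʳ : ∀ p q s → (q ⊕ s) ⊗ p ≈ (q ⊗ p) ⊕ (s ⊗ p)
⊗-distribʳ p q s .at φ r = trans (eval-⊗ (q ⊕ s) p φ) (trans (eval-⊕ q s _)
  (sym (trans (eval-⊕ (q ⊗ p) (s ⊗ p) φ) (cong₂ ℚ._+_ (eval-⊗ q p φ) (eval-⊗ s p φ)))))

⊕-cong : ∀ {p p′ q q′} → p ≈ p′ → q ≈ q′ → p ⊕ q ≈ p′ ⊕ q′
⊕-cong {p} {p′} {q} {q′} e f .at φ r =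
  trans (eval-⊕ p q φ) (trans (cong₂ ℚ._+_ (e .at φ r) (f .at φ r)) (sym (eval-⊕ p′ q′ φ)))

⊕-comm : ∀ p q → p ⊕ q ≈ q ⊕ p
⊕-comm p q .at φ r = trans (eval-⊕ p q φ) (trans (ℚₚ.+-comm (eval p φ) (eval q φ)) (sym (eval-⊕ q p φ)))

≈-refl : ∀ {p} → p ≈ p
≈-refl .at φ r = refl

≈-sym : ∀ {p q} → p ≈ q → q ≈ p
≈-sym e .at φ r = sym (e .at φ r)

≈-trans : ∀ {p q s} → p ≈ q → q ≈ s → p ≈ s
≈-trans e f .at φ r = trans (e .at φ r) (f .at φ r)

≈-reflexive : ∀ {p q} → p ≡ q → p ≈ q
≈-reflexive refl = ≈-refl

neg : Poly → Poly
neg = scale (ℚ.- 1ℚ)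

⊕-inverseˡ : ∀ p → neg p ⊕ p ≈ zeroP
⊕-inverseˡ p .at φ r = trans (eval-⊕ (neg p) p φ) (trans (cong₂ ℚ._+_ (eval-scale (ℚ.- 1ℚ) p φ) (sym (ℚₚ.*-identityˡ _)))
  (trans (sym (ℚₚ.*-distribʳ-+ (eval p φ) (ℚ.- 1ℚ) 1ℚ)) (ℚₚ.*-zeroˡ (eval p φ))))

polyRing : CommutativeRing 0ℓ 0ℓ
polyRing = record
  { Carrier = Poly ; _≈_ = _≈_ ; _+_ = _⊕_ ; _*_ = _⊗_ ; -_ = neg ; 0# = zeroP ; 1# = oneP
  ; isCommutativeRing = record
    { isRing = record
      { +-isAbelianGroup = record
        { isGroup = record
          { isMonoid = record
            { isSemigroup = record
              { isMagma = record
                { isEquivalence = record { refl = ≈-refl ; sym = ≈-sym ; trans = ≈-trans }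
                ; ∙-cong = ⊕-cong }
              ; assoc = λ p q s → ≈-reflexive (Listₚ.++-assoc p q s) }
            ; identity = (λ p → ≈-refl) , (λ p → ≈-reflexive (Listₚ.++-identityʳ p)) }
          ; inverse = ⊕-inverseˡ , (λ p → ≈-trans (⊕-comm p (neg p)) (⊕-inverseˡ p))
          ; ⁻¹-cong = λ {p} {q} e → mk≈ λ φ r → trans (eval-scale (ℚ.- 1ℚ) p φ) (trans (cong ((ℚ.- 1ℚ) ℚ.*_) (e .at φ r)) (sym (eval-scale (ℚ.- 1ℚ) q φ))) }
        ; comm = ⊕-comm }
      ; *-cong = ⊗-cong
      ; *-assoc = ⊗-assoc
      ; *-identity = ⊗-identityˡ , (λ p → ≈-trans (⊗-comm p oneP) (⊗-identityˡ p))
      ; distrib = (λ p q s → ≈-trans (⊗-comm p (q ⊕ s)) (≈-trans (⊗-distribʳ p q s) (⊕-cong (⊗-comm q p) (⊗-comm s p)))) , ⊗-distribʳ }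
    ; *-comm = ⊗-comm } }

module P = CommutativeRing polyRing
module ∑ₚ = FinSum P.commutativeSemiring
module ∑E = EnumSum P.commutativeSemiring
open ∑ₚ using (∑; ∑-cong; ∑-zero; ∑-swap; ∑-*ˡ; ∑-*ʳ; ∏; ∏-cong; δ)
module ≈-Reasoning = Relation.Binary.Reasoning.Setoid P.setoid

-- Scalars are sealed: beyond this block they are atoms governed by the laws proved here, not
-- explicit fractions to be normalised.
opaque
  ι : ℚ → Poly
  ι = constP

  num : ℕ → Poly
  num n = constP (castᵠ n)

  ι≡constP : ∀ c → ι c ≡ constP c
  ι≡constP c = refl

  num≡ι : ∀ n → num n ≡ ι (castᵠ n)
  num≡ι n = refl

  ι-+ : ∀ a b → ι (a ℚ.+ b) ≈ ι a ⊕ ι b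
  ι-+ a b .at φ r = trans (eval-const (a ℚ.+ b) φ) (trans (ℚₚ.*-distribʳ-+ (φ []) a b)
    (sym (trans (eval-⊕ (constP a) (constP b) φ) (cong₂ ℚ._+_ (eval-const a φ) (eval-const b φ)))))

  ι-* : ∀ a b → ι (a ℚ.* b) ≈ ι a ⊗ ι b
  ι-* a b .at φ r = refl

  ι-0 : ι 0ℚ ≈ zeroP
  ι-0 .at φ r = trans (eval-const 0ℚ φ) (ℚₚ.*-zeroˡ (φ []))

  ι-1 : ι 1ℚ ≈ oneP
  ι-1 = ≈-refl

  scale≈ : ∀ c p → scale c p ≈ ι c ⊗ p
  scale≈ c p .at φ r = trans (eval-scale c p φ) (sym (eval-const-⊗ c p φ))

  eval-ι-⊗ : ∀ c p φ → eval (ι c ⊗ p) φ ≡ c ℚ.* eval p φ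
  eval-ι-⊗ = eval-const-⊗

  num-0 : num 0 ≈ zeroP
  num-0 = ι-0

  num-1 : num 1 ≈ oneP
  num-1 = ≈-reflexive (cong constP ∑ℚ.cast-1)

  num-suc : ∀ n → num (suc n) ≈ oneP ⊕ num n
  num-suc n = ι-+ 1ℚ (castᵠ n)

  num-+ : ∀ m n → num (m ℕ.+ n) ≈ num m ⊕ num n
  num-+ m n = ≈-trans (≈-reflexive (cong constP (castᵠ-+ m n))) (ι-+ (castᵠ m) (castᵠ n))

  num-* : ∀ m n → num (m ℕ.* n) ≈ num m ⊗ num n
  num-* m n = ≈-reflexive (cong constP (castᵠ-* m n))

  ι-inv-num : ∀ n → .{{ℕ.NonZero n}} → ι (inv n) ⊗ num n ≈ oneP
  ι-inv-num n = ≈-reflexive (cong constP (inv-nonZero n))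

-- Coefficients

indicator : Mono → Mono → ℚ
indicator m m′ = δᵠ (monoEq m m′)

coeff≡eval : ∀ m p → coeff m p ≡ eval p (indicator m)
coeff≡eval m []             = refl
coeff≡eval m ((c , m′) ∷ p) = cong₂ ℚ._+_ (lem (monoEq m m′)) (coeff≡eval m p)
  where
  lem : ∀ b → (if b then c else 0ℚ) ≡ c ℚ.* δᵠ b
  lem true  = sym (ℚₚ.*-identityʳ c)
  lem false = sym (ℚₚ.*-zeroʳ c)

≡ᵇ-refl : ∀ n → (n ≡ᵇ n) ≡ true
≡ᵇ-refl n = Boolₚ.T-≡ .Equivalence.to (ℕₚ.≡⇒≡ᵇ n n refl)

≡ᵇ-true : ∀ m n → (m ≡ᵇ n) ≡ true → m ≡ n
≡ᵇ-true m n e = ℕₚ.≡ᵇ⇒≡ m n (Boolₚ.T-≡ .Equivalence.from e)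

∧-true : ∀ p q → p ∧ q ≡ true → p ≡ true × q ≡ true
∧-true true true _ = refl , refl

∧-intro : ∀ {p q} → p ≡ true → q ≡ true → p ∧ q ≡ true
∧-intro refl refl = refl

allZero-sound : ∀ m → allZero m ≡ true → ∀ i → nth0 m i ≡ 0
allZero-sound []      e i       = refl
allZero-sound (x ∷ m) e zero    = ≡ᵇ-true x 0 (proj₁ (∧-true _ _ e))
allZero-sound (x ∷ m) e (suc i) = allZero-sound m (proj₂ (∧-true (x ≡ᵇ 0) _ e)) i

allZero-complete : ∀ m → (∀ i → nth0 m i ≡ 0) → allZero m ≡ true
allZero-complete []      e = refl
allZero-complete (x ∷ m) e = ∧-intro (cong (_≡ᵇ 0) (e zero)) (allZero-complete m (e ∘ suc))

monoEq-sound : ∀ m m′ → monoEq m m′ ≡ true → ∀ i → nth0 m i ≡ nth0 m′ i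
monoEq-sound []      m′      e i       = sym (allZero-sound m′ e i)
monoEq-sound (x ∷ m) []      e i       = allZero-sound (x ∷ m) e i
monoEq-sound (x ∷ m) (y ∷ n) e zero    = ≡ᵇ-true x y (proj₁ (∧-true _ _ e))
monoEq-sound (x ∷ m) (y ∷ n) e (suc i) = monoEq-sound m n (proj₂ (∧-true (x ≡ᵇ y) _ e)) i

monoEq-complete : ∀ m m′ → (∀ i → nth0 m i ≡ nth0 m′ i) → monoEq m m′ ≡ true
monoEq-complete []      m′      e = allZero-complete m′ (sym ∘ e)
monoEq-complete (x ∷ m) []      e = allZero-complete (x ∷ m) e
monoEq-complete (x ∷ m) (y ∷ n) e = ∧-intro (trans (cong (_≡ᵇ y) (e zero)) (≡ᵇ-refl y)) (monoEq-complete m n (e ∘ suc))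

indicator-respects : ∀ m → Respects (indicator m)
indicator-respects m m₁ m₂ e = cong δᵠ (bool-⇔ _ _
  (λ t → monoEq-complete m m₂ λ i → trans (monoEq-sound m m₁ t i) (e i))
  (λ t → monoEq-complete m m₁ λ i → trans (monoEq-sound m m₂ t i) (sym (e i))))

coeff-cong : ∀ m {p q} → p ≈ q → coeff m p ≡ coeff m q
coeff-cong m {p} {q} e = trans (coeff≡eval m p) (trans (e .at _ (indicator-respects m)) (sym (coeff≡eval m q)))

coeff-⊕ : ∀ m p q → coeff m (p ⊕ q) ≡ coeff m p ℚ.+ coeff m q
coeff-⊕ m p q = trans (coeff≡eval m (p ⊕ q)) (trans (eval-⊕ p q _) (sym (cong₂ ℚ._+_ (coeff≡eval m p) (coeff≡eval m q))))

coeff-ι-⊗ : ∀ m c p → coeff m (ι c ⊗ p) ≡ c ℚ.* coeff m p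
coeff-ι-⊗ m c p = trans (coeff≡eval m (ι c ⊗ p)) (trans (eval-ι-⊗ c p (indicator m)) (cong (c ℚ.*_) (sym (coeff≡eval m p))))

coeff-∑ : ∀ {A : Set} m (as : List A) f → coeff m (∑ as f) ≡ ∑ᵠ as (coeff m ∘ f)
coeff-∑ m []       f = refl
coeff-∑ m (a ∷ as) f = trans (coeff-⊕ m (f a) _) (cong (coeff m (f a) ℚ.+_) (coeff-∑ m as f))

-- The functional ⟨·⟩

bwWeight : Mono → ℚ
bwWeight m = gaussMoment (nth0 m 1) ℚ.* gaussMoment (nth0 m 2) ℚ.* yzMoment (nth0 m 3) (nth0 m 4)

bwRest : Mono → Mono
bwRest m = nth0 m 0 ∷ 0 ∷ 0 ∷ 0 ∷ 0 ∷ List.drop 5 m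

hd≡nth0 : ∀ m → hd m ≡ nth0 m 0
hd≡nth0 []      = refl
hd≡nth0 (x ∷ m) = refl

nth0-tl : ∀ m i → nth0 (tl m) i ≡ nth0 m (suc i)
nth0-tl []      i = refl
nth0-tl (x ∷ m) i = refl

nth0-drop : ∀ k m i → nth0 (List.drop k m) i ≡ nth0 m (k ℕ.+ i)
nth0-drop zero    m       i = refl
nth0-drop (suc k) []      i = refl
nth0-drop (suc k) (x ∷ m) i = nth0-drop k m i

bwTerm≡ : ∀ c m → bwTerm (c , m) ≡ (c ℚ.* bwWeight m , bwRest m)
bwTerm≡ c m = cong₂ _,_
  (trans (cong₂ (λ x y → c ℚ.* gaussMoment x ℚ.* gaussMoment y ℚ.* yzMoment (hd (tl (tl (tl m)))) (hd (tl (tl (tl (tl m)))))) e₁ e₂)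
  (trans (cong₂ (λ x y → c ℚ.* gaussMoment (nth0 m 1) ℚ.* gaussMoment (nth0 m 2) ℚ.* yzMoment x y) e₃ e₄)
  (trans (cong (ℚ._* yz) (ℚₚ.*-assoc c _ _)) (ℚₚ.*-assoc c _ yz))))
  (cong (λ x → x ∷ 0 ∷ 0 ∷ 0 ∷ 0 ∷ List.drop 5 m) (hd≡nth0 m))
  where
  yz = yzMoment (nth0 m 3) (nth0 m 4)
  e₁ = trans (hd≡nth0 (tl m)) (nth0-tl m 0)
  e₂ = trans (hd≡nth0 (tl (tl m))) (trans (nth0-tl (tl m) 0) (nth0-tl m 1))
  e₃ = trans (hd≡nth0 (tl (tl (tl m)))) (trans (nth0-tl (tl (tl m)) 0) (trans (nth0-tl (tl m) 1) (nth0-tl m 2)))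
  e₄ = trans (hd≡nth0 (tl (tl (tl (tl m))))) (trans (nth0-tl (tl (tl (tl m))) 0)
         (trans (nth0-tl (tl (tl m)) 1) (trans (nth0-tl (tl m) 2) (nth0-tl m 3))))

-- ⟨·⟩ acts on test functions by transposition. Compatibility of `bw` with `_≈_` thus reduces to the
-- transposed test function again ignoring trailing zeros.
eval-bw : ∀ p φ → eval (bw p) φ ≡ eval p (λ m → bwWeight m ℚ.* φ (bwRest m))
eval-bw p φ = trans (∑ℚ.∑-map bwTerm p _) (∑ℚ.∑-cong p λ { (c , m) →
  trans (cong (λ t → proj₁ t ℚ.* φ (proj₂ t)) (bwTerm≡ c m)) (ℚₚ.*-assoc c _ _) })

bwWeight-cong : ∀ m m′ → (∀ i → nth0 m i ≡ nth0 m′ i) → bwWeight m ≡ bwWeight m′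
bwWeight-cong m m′ e = cong₂ ℚ._*_ (cong₂ (λ a b → gaussMoment a ℚ.* gaussMoment b) (e 1) (e 2)) (cong₂ yzMoment (e 3) (e 4))

bwRest-cong : ∀ m m′ → (∀ i → nth0 m i ≡ nth0 m′ i) → ∀ i → nth0 (bwRest m) i ≡ nth0 (bwRest m′) i
bwRest-cong m m′ e 0 = e 0
bwRest-cong m m′ e 1 = refl
bwRest-cong m m′ e 2 = refl
bwRest-cong m m′ e 3 = refl
bwRest-cong m m′ e 4 = refl
bwRest-cong m m′ e (suc (suc (suc (suc (suc i))))) = trans (nth0-drop 5 m i) (trans (e (5 ℕ.+ i)) (sym (nth0-drop 5 m′ i)))

bwφ-respects : ∀ {φ} → Respects φ → Respects (λ m → bwWeight m ℚ.* φ (bwRest m))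
bwφ-respects r m m′ e = cong₂ ℚ._*_ (bwWeight-cong m m′ e) (r _ _ (bwRest-cong m m′ e))

bw-cong : ∀ {p q} → p ≈ q → bw p ≈ bw q
bw-cong {p} {q} e .at φ r = trans (eval-bw p φ) (trans (e .at _ (bwφ-respects r)) (sym (eval-bw q φ)))

bw-⊕ : ∀ p q → bw (p ⊕ q) ≈ bw p ⊕ bw q
bw-⊕ p q = ≈-reflexive (Listₚ.map-++ bwTerm p q)

bw-ι-⊗ : ∀ c p → bw (ι c ⊗ p) ≈ ι c ⊗ bw p
bw-ι-⊗ c p .at φ r = trans (eval-bw (ι c ⊗ p) φ) (trans (eval-ι-⊗ c p _)
  (sym (trans (eval-ι-⊗ c (bw p) φ) (cong (c ℚ.*_) (eval-bw p φ)))))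

bw-∑ : ∀ {A : Set} (as : List A) f → bw (∑ as f) ≈ ∑ as (bw ∘ f)
bw-∑ []       f = ≈-refl
bw-∑ (a ∷ as) f = ≈-trans (bw-⊕ (f a) _) (⊕-cong ≈-refl (bw-∑ as f))

open import Algebra.Solver.Ring.NaturalCoefficients.Default P.commutativeSemiring using (solve; _:+_; _:*_; _:=_)

-- Convolution sums

-- Sum over i + j = n that hands over both indices and recurses on n. No truncated subtraction
-- occurs, which makes commutativity and associativity of the Cauchy product short inductions.
conv : ℕ → (ℕ → ℕ → Poly) → Poly
conv zero    f = f 0 0
conv (suc n) f = f 0 (suc n) ⊕ conv n (λ i j → f (suc i) j)

conv-cong⁺ : ∀ n {f g : ℕ → ℕ → Poly} → (∀ i j → i ℕ.+ j ≡ n → f i j ≈ g i j) → conv n f ≈ conv n g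
conv-cong⁺ zero    e = e 0 0 refl
conv-cong⁺ (suc n) e = ⊕-cong (e 0 (suc n) refl) (conv-cong⁺ n λ i j p → e (suc i) j (cong suc p))

conv-cong : ∀ n {f g : ℕ → ℕ → Poly} → (∀ i j → f i j ≈ g i j) → conv n f ≈ conv n g
conv-cong n e = conv-cong⁺ n λ i j _ → e i j

conv-⊕ : ∀ n (f g : ℕ → ℕ → Poly) → conv n (λ i j → f i j ⊕ g i j) ≈ conv n f ⊕ conv n g
conv-⊕ zero    f g = ≈-refl
conv-⊕ (suc n) f g = ≈-trans (⊕-cong ≈-refl (conv-⊕ n (f ∘ suc) (g ∘ suc)))
  (interchange (f 0 (suc n)) (g 0 (suc n)) _ _)
  where open import Algebra.Properties.CommutativeSemigroup P.+-commutativeSemigroup using (interchange)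

conv-⊗ˡ : ∀ n c (f : ℕ → ℕ → Poly) → conv n (λ i j → c ⊗ f i j) ≈ c ⊗ conv n f
conv-⊗ˡ zero    c f = ≈-refl
conv-⊗ˡ (suc n) c f = ≈-trans (⊕-cong ≈-refl (conv-⊗ˡ n c (f ∘ suc))) (≈-sym (P.distribˡ c _ _))

conv-⊗ʳ : ∀ n c (f : ℕ → ℕ → Poly) → conv n (λ i j → f i j ⊗ c) ≈ conv n f ⊗ c
conv-⊗ʳ n c f = ≈-trans (conv-cong n λ i j → ⊗-comm (f i j) c) (≈-trans (conv-⊗ˡ n c f) (⊗-comm c _))

conv-0 : ∀ n → conv n (λ _ _ → zeroP) ≈ zeroP
conv-0 zero    = ≈-refl
conv-0 (suc n) = conv-0 n

conv-∑ : ∀ {A : Set} n (as : List A) (f : A → ℕ → ℕ → Poly) →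
         conv n (λ i j → ∑ as (λ a → f a i j)) ≈ ∑ as (λ a → conv n (f a))
conv-∑ n []       f = conv-0 n
conv-∑ n (a ∷ as) f = ≈-trans (conv-⊕ n (f a) _) (⊕-cong ≈-refl (conv-∑ n as f))

conv-last : ∀ n (f : ℕ → ℕ → Poly) → conv (suc n) f ≈ conv n (λ i j → f i (suc j)) ⊕ f (suc n) 0
conv-last zero    f = ≈-refl
conv-last (suc n) f = ≈-trans (⊕-cong {f 0 (suc (suc n))} ≈-refl (conv-last n (f ∘ suc))) (≈-sym (P.+-assoc (f 0 (suc (suc n))) _ _))

conv-comm : ∀ n (f : ℕ → ℕ → Poly) → conv n f ≈ conv n (λ i j → f j i)
conv-comm zero    f = ≈-refl
conv-comm (suc n) f = ≈-trans (conv-last n f) (≈-trans (⊕-comm _ (f (suc n) 0)) (⊕-cong ≈-refl (conv-comm n _)))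

conv-assoc : ∀ n (F : ℕ → ℕ → ℕ → Poly) →
             conv n (λ i j → conv i (λ a b → F a b j)) ≈ conv n (λ a k → conv k (λ b j → F a b j))
conv-assoc zero    F = ≈-refl
conv-assoc (suc n) F = begin
  F 0 0 (suc n) ⊕ conv n (λ i j → F 0 (suc i) j ⊕ conv i (λ a b → F (suc a) b j))
    ≈⟨ ⊕-cong ≈-refl (conv-⊕ n _ _) ⟩
  F 0 0 (suc n) ⊕ (conv n (λ i j → F 0 (suc i) j) ⊕ conv n (λ i j → conv i (λ a b → F (suc a) b j)))
    ≈⟨ P.+-congˡ {F 0 0 (suc n)} (P.+-congˡ {conv n (λ i j → F 0 (suc i) j)} (conv-assoc n (F ∘ suc))) ⟩
  F 0 0 (suc n) ⊕ (conv n (λ i j → F 0 (suc i) j) ⊕ conv n (λ a k → conv k (F (suc a))))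
    ≈⟨ P.+-assoc (F 0 0 (suc n)) _ _ ⟨
  conv (suc n) (F 0) ⊕ conv n (λ a k → conv k (F (suc a))) ∎
  where open ≈-Reasoning

sumP-cons : ∀ n (f : ℕ → Poly) → sumP (suc n) f ≈ f 0 ⊕ sumP n (f ∘ suc)
sumP-cons zero    f = ≈-refl
sumP-cons (suc n) f = ≈-trans (⊕-cong (sumP-cons n f) ≈-refl) (P.+-assoc (f 0) _ _)

sumP-conv : ∀ n (f : ℕ → ℕ → Poly) → sumP n (λ i → f i (n ∸ i)) ≈ conv n f
sumP-conv zero    f = ≈-refl
sumP-conv (suc n) f = ≈-trans (sumP-cons n _) (⊕-cong ≈-refl (sumP-conv n (f ∘ suc)))

sumP-cong⁺ : ∀ n {f g : ℕ → Poly} → (∀ i → i ≤ n → f i ≈ g i) → sumP n f ≈ sumP n g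
sumP-cong⁺ zero    e = e 0 z≤n
sumP-cong⁺ (suc n) e = ⊕-cong (sumP-cong⁺ n λ i p → e i (ℕₚ.m≤n⇒m≤1+n p)) (e (suc n) ℕₚ.≤-refl)

sumP-cong : ∀ n {f g : ℕ → Poly} → (∀ i → f i ≈ g i) → sumP n f ≈ sumP n g
sumP-cong n e = sumP-cong⁺ n λ i _ → e i

sumP-⊗ˡ : ∀ n c (f : ℕ → Poly) → sumP n (λ i → c ⊗ f i) ≈ c ⊗ sumP n f
sumP-⊗ˡ zero    c f = ≈-refl
sumP-⊗ˡ (suc n) c f = ≈-trans (⊕-cong (sumP-⊗ˡ n c f) ≈-refl) (≈-sym (P.distribˡ c _ _))

sumP-⊗ʳ : ∀ n c (f : ℕ → Poly) → sumP n (λ i → f i ⊗ c) ≈ sumP n f ⊗ c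
sumP-⊗ʳ n c f = ≈-trans (sumP-cong n λ i → ⊗-comm (f i) c) (≈-trans (sumP-⊗ˡ n c f) (⊗-comm c _))

sumP-0 : ∀ n {f : ℕ → Poly} → (∀ i → i ≤ n → f i ≈ zeroP) → sumP n f ≈ zeroP
sumP-0 zero    e = e 0 z≤n
sumP-0 (suc n) e = ⊕-cong (sumP-0 n λ i p → e i (ℕₚ.m≤n⇒m≤1+n p)) (e (suc n) ℕₚ.≤-refl)

-- Positive integers are invertible over the rationals. Formulas with factorials are proved below by
-- multiplying with `num (suc n)` and applying a recursion in n.
cancel-num : ∀ n {p q} → num (suc n) ⊗ p ≈ num (suc n) ⊗ q → p ≈ q
cancel-num n {p} {q} e = ≈-trans (≈-sym (lem p)) (≈-trans (⊗-cong {ι (inv (suc n))} ≈-refl e) (lem q))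
  where
  lem : ∀ p → ι (inv (suc n)) ⊗ (num (suc n) ⊗ p) ≈ p
  lem p = ≈-trans (≈-sym (⊗-assoc (ι (inv (suc n))) (num (suc n)) p))
    (≈-trans (⊗-cong (ι-inv-num (suc n)) ≈-refl) (⊗-identityˡ p))

-- Power series

infix 4 _≗_
_≗_ : Series → Series → Set
f ≗ g = ∀ n → f n ≈ g n

infixl 7 _⋆_
_⋆_ : Series → Series → Series
(f ⋆ g) n = conv n (λ i j → f i ⊗ g j)

mulS≗⋆ : ∀ f g → mulS f g ≗ f ⋆ g
mulS≗⋆ f g n = sumP-conv n _

⋆-cong : ∀ {f f′ g g′} → f ≗ f′ → g ≗ g′ → f ⋆ g ≗ f′ ⋆ g′
⋆-cong e e′ n = conv-cong n λ i j → ⊗-cong (e i) (e′ j)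

⋆-comm : ∀ f g → f ⋆ g ≗ g ⋆ f
⋆-comm f g n = ≈-trans (conv-comm n _) (conv-cong n λ i j → ⊗-comm (f j) (g i))

⋆-assoc : ∀ f g h → (f ⋆ g) ⋆ h ≗ f ⋆ (g ⋆ h)
⋆-assoc f g h n = begin
  conv n (λ i j → conv i (λ a b → f a ⊗ g b) ⊗ h j)     ≈⟨ conv-cong n (λ i j → conv-⊗ʳ i (h j) _) ⟨
  conv n (λ i j → conv i (λ a b → f a ⊗ g b ⊗ h j))     ≈⟨ conv-assoc n _ ⟩
  conv n (λ a k → conv k (λ b j → f a ⊗ g b ⊗ h j))     ≈⟨ conv-cong n (λ a k → ≈-trans (conv-cong k λ b j → ⊗-assoc (f a) (g b) (h j)) (conv-⊗ˡ k (f a) _)) ⟩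
  conv n (λ a k → f a ⊗ conv k (λ b j → g b ⊗ h j)) ∎
  where open ≈-Reasoning

⋆-identityˡ : ∀ f → oneS ⋆ f ≗ f
⋆-identityˡ f zero    = ⊗-identityˡ (f 0)
⋆-identityˡ f (suc n) = ≈-trans (⊕-cong (⊗-identityˡ (f (suc n))) (conv-0 n)) (P.+-identityʳ _)

⋆-distribʳ : ∀ h f g → (λ n → f n ⊕ g n) ⋆ h ≗ (λ n → (f ⋆ h) n ⊕ (g ⋆ h) n)
⋆-distribʳ h f g n = ≈-trans (conv-cong n λ i j → P.distribʳ (h j) (f i) (g i)) (conv-⊕ n _ _)

seriesRing : CommutativeRing 0ℓ 0ℓ
seriesRing = record
  { Carrier = Series ; _≈_ = _≗_ ; _+_ = λ f g n → f n ⊕ g n ; _*_ = _⋆_ ; -_ = λ f n → neg (f n)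
  ; 0# = λ _ → zeroP ; 1# = oneS
  ; isCommutativeRing = record
    { isRing = record
      { +-isAbelianGroup = record
        { isGroup = record
          { isMonoid = record
            { isSemigroup = record
              { isMagma = record
                { isEquivalence = record { refl = λ n → ≈-refl ; sym = λ e n → ≈-sym (e n) ; trans = λ e e′ n → ≈-trans (e n) (e′ n) }
                ; ∙-cong = λ e e′ n → ⊕-cong (e n) (e′ n) }
              ; assoc = λ f g h n → P.+-assoc (f n) (g n) (h n) }
            ; identity = (λ f n → ≈-refl) , (λ f n → P.+-identityʳ (f n)) }
          ; inverse = (λ f n → P.-‿inverseˡ (f n)) , (λ f n → P.-‿inverseʳ (f n))
          ; ⁻¹-cong = λ e n → P.-‿cong (e n) }
        ; comm = λ f g n → ⊕-comm (f n) (g n) }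
      ; *-cong = λ {f} {f′} {g} {g′} → ⋆-cong {f} {f′} {g} {g′}
      ; *-assoc = ⋆-assoc
      ; *-identity = ⋆-identityˡ , (λ f n → ≈-trans (⋆-comm f oneS n) (⋆-identityˡ f n))
      ; distrib = (λ h f g n → ≈-trans (⋆-comm h (λ n → f n ⊕ g n) n) (≈-trans (⋆-distribʳ h f g n) (⊕-cong (⋆-comm f h n) (⋆-comm g h n)))) , ⋆-distribʳ }
    ; *-comm = ⋆-comm } }

module Sᵣ = CommutativeRing seriesRing

infixl 6 _+ˢ_
_+ˢ_ : Series → Series → Series
_+ˢ_ = Sᵣ._+_

-- The operator u d/du. It preserves the degree, so the coefficients of u A′ and (u B′) A are
-- compared without an index shift.
D : Series → Series
D f n = num n ⊗ f n

D-⋆ : ∀ f g → D (f ⋆ g) ≗ (D f ⋆ g) +ˢ (f ⋆ D g)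
D-⋆ f g n = begin
  num n ⊗ conv n (λ i j → f i ⊗ g j)
    ≈⟨ conv-⊗ˡ n (num n) _ ⟨
  conv n (λ i j → num n ⊗ (f i ⊗ g j))
    ≈⟨ conv-cong⁺ n (λ i j e → ≈-trans (⊗-cong (≈-trans (≈-reflexive (cong num (sym e))) (num-+ i j)) ≈-refl) (leib (num i) (num j) (f i) (g j))) ⟩
  conv n (λ i j → num i ⊗ f i ⊗ g j ⊕ f i ⊗ (num j ⊗ g j))
    ≈⟨ conv-⊕ n _ _ ⟩
  (D f ⋆ g) n ⊕ (f ⋆ D g) n ∎
  where
  open ≈-Reasoning
  leib : ∀ a b x y → (a ⊕ b) ⊗ (x ⊗ y) ≈ a ⊗ x ⊗ y ⊕ x ⊗ (b ⊗ y)
  leib = solve 4 (λ a b x y → (a :+ b) :* (x :* y) := a :* x :* y :+ x :* (b :* y)) ≈-refl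

powS-suc : ∀ f j → powS f (suc j) ≗ f ⋆ powS f j
powS-suc f j = mulS≗⋆ f (powS f j)

-- Divisibility by u^k. At a fixed coefficient it disposes of the last power of A - 1 that the
-- telescoping sum leaves behind.
Order : ℕ → Series → Set
Order k f = ∀ n → n < k → f n ≈ zeroP

order-⋆ : ∀ {k l} f g → Order k f → Order l g → Order (k ℕ.+ l) (f ⋆ g)
order-⋆ {k} {l} f g of og n n<k+l = ≈-trans (conv-cong⁺ n {g = λ _ _ → zeroP} term) (conv-0 n)
  where
  term : ∀ i j → i ℕ.+ j ≡ n → f i ⊗ g j ≈ zeroP
  term i j e with i ℕ.<? k
  ... | yes i<k = ≈-trans (⊗-cong (of i i<k) ≈-refl) (P.zeroˡ (g j))
  ... | no  i≮k = ≈-trans (⊗-cong {f i} ≈-refl (og j (ℕₚ.≰⇒> λ l≤j →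
                    ℕₚ.<⇒≱ n<k+l (subst (k ℕ.+ l ≤_) e (ℕₚ.+-mono-≤ (ℕₚ.≮⇒≥ i≮k) l≤j))))) (P.zeroʳ (f i))

order-pow : ∀ f → f 0 ≈ zeroP → ∀ j → Order j (powS f j)
order-pow f e zero    n ()
order-pow f e (suc j) n p = ≈-trans (powS-suc f j n) (order-⋆ {1} f (powS f j) (λ { zero _ → e ; (suc _) (s≤s ()) }) (order-pow f e j) n p)

module _ (f : Series) where
  private module S = Relation.Binary.Reasoning.Setoid Sᵣ.setoid
  open import Algebra.Solver.Ring.NaturalCoefficients.Default Sᵣ.commutativeSemiring
    using () renaming (solve to solveˢ; _:+_ to _+′_; _:*_ to _*′_; _:=_ to _=′_)

  -- Integers as constant series, so that the factor j + 1 of the power rule takes part in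
  -- identities of the series ring.
  castˢ : ℕ → Series
  castˢ k = FinSum.cast Sᵣ.commutativeSemiring k

  castˢ-⋆ : ∀ k g → castˢ k ⋆ g ≗ (λ n → num k ⊗ g n)
  castˢ-⋆ zero    g n = ≈-trans (Sᵣ.zeroˡ g n) (≈-sym (≈-trans (⊗-cong num-0 ≈-refl) (P.zeroˡ (g n))))
  castˢ-⋆ (suc k) g n = ≈-trans (⋆-distribʳ g oneS (castˢ k) n)
    (≈-trans (⊕-cong (≈-trans (⋆-identityˡ g n) (≈-sym (⊗-identityˡ (g n)))) (castˢ-⋆ k g n)) (≈-sym (≈-trans (⊗-cong (num-suc k) ≈-refl) (P.distribʳ (g n) oneP (num k)))))

  -- Leibniz rule on f · f^(j+1): the first summand is one copy of f^(j+1) D f, and the induction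
  -- hypothesis supplies j + 1 more.
  D-pow : ∀ j → D (powS f (suc j)) ≗ castˢ (suc j) ⋆ (powS f j ⋆ D f)
  D-pow zero = S.begin
    D (powS f 1)                            S.≈⟨ (λ n → ⊗-cong {num n} ≈-refl (≈-trans (powS-suc f 0 n) (Sᵣ.*-identityʳ f n))) ⟩
    D f                                     S.≈⟨ Sᵣ.sym {oneS ⋆ D f} (⋆-identityˡ (D f)) ⟩
    oneS ⋆ D f                              S.≈⟨ Sᵣ.sym {castˢ 1 ⋆ (oneS ⋆ D f)} (λ n → ≈-trans (Sᵣ.*-congʳ {oneS ⋆ D f} (Sᵣ.+-identityʳ oneS) n) (⋆-identityˡ (oneS ⋆ D f) n)) ⟩
    castˢ 1 ⋆ (oneS ⋆ D f) S.∎
  D-pow (suc j) = S.begin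
    D (powS f (suc (suc j)))
      S.≈⟨ (λ n → ⊗-cong {num n} ≈-refl (powS-suc f (suc j) n)) ⟩
    D (f ⋆ powS f (suc j))
      S.≈⟨ D-⋆ f (powS f (suc j)) ⟩
    D f ⋆ powS f (suc j) +ˢ f ⋆ D (powS f (suc j))
      S.≈⟨ Sᵣ.+-cong {D f ⋆ powS f (suc j)} {powS f (suc j) ⋆ D f} (⋆-comm (D f) (powS f (suc j))) (⋆-cong {f} {f} (λ _ → ≈-refl) (D-pow j)) ⟩
    powS f (suc j) ⋆ D f +ˢ f ⋆ (castˢ (suc j) ⋆ (powS f j ⋆ D f))
      S.≈⟨ Sᵣ.+-congˡ {powS f (suc j) ⋆ D f} (solveˢ 4 (λ x c p d → x *′ (c *′ (p *′ d)) =′ c *′ ((x *′ p) *′ d)) (λ _ → ≈-refl) f (castˢ (suc j)) (powS f j) (D f)) ⟩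
    powS f (suc j) ⋆ D f +ˢ castˢ (suc j) ⋆ ((f ⋆ powS f j) ⋆ D f)
      S.≈⟨ Sᵣ.+-cong {powS f (suc j) ⋆ D f} {oneS ⋆ (powS f (suc j) ⋆ D f)} (Sᵣ.sym {oneS ⋆ (powS f (suc j) ⋆ D f)} (⋆-identityˡ _))
           (Sᵣ.*-congˡ {castˢ (suc j)} (Sᵣ.*-congʳ {D f} (Sᵣ.sym {powS f (suc j)} (powS-suc f j)))) ⟩
    oneS ⋆ (powS f (suc j) ⋆ D f) +ˢ castˢ (suc j) ⋆ (powS f (suc j) ⋆ D f)
      S.≈⟨ Sᵣ.sym {castˢ (suc (suc j)) ⋆ (powS f (suc j) ⋆ D f)} (⋆-distribʳ (powS f (suc j) ⋆ D f) oneS (castˢ (suc j))) ⟩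
    castˢ (suc (suc j)) ⋆ (powS f (suc j) ⋆ D f) S.∎

evenᵇ-suc : ∀ n → evenᵇ (suc n) ≡ not (evenᵇ n)
evenᵇ-suc zero          = refl
evenᵇ-suc (suc zero)    = refl
evenᵇ-suc (suc (suc n)) = evenᵇ-suc n

signQ-suc : ∀ n → signQ (suc n) ≡ ℚ.- signQ n
signQ-suc n with evenᵇ n | evenᵇ (suc n) | evenᵇ-suc n
... | true  | _ | refl = refl
... | false | _ | refl = refl

-- With f = A − 1 and β = D B, the hypothesis reads D f = β + fβ, so the partial sums
-- of D (log A) = ∑ (−1)^i f^i D f telescope to β up to a term of high order.
module _ (A B : Series) (A0 : A 0 ≈ oneP) (B0 : B 0 ≈ zeroP) (ode : D A ≗ D B ⋆ A) where
  private
    f β : Series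
    f = minusOne A
    β = D B

    f0 : f 0 ≈ zeroP
    f0 = ≈-trans (⊕-cong A0 ≈-refl) (P.-‿inverseʳ oneP)

    A≗1+f : A ≗ oneS +ˢ f
    A≗1+f zero    = ≈-trans A0 (≈-sym (≈-trans (⊕-cong {oneP} ≈-refl f0) (P.+-identityʳ oneP)))
    A≗1+f (suc n) = ≈-refl

    β0 : β 0 ≈ zeroP
    β0 = ≈-trans (⊗-cong num-0 ≈-refl) (P.zeroˡ (B 0))

    Df : D f ≗ β +ˢ β ⋆ f
    Df n = ≈-trans (lem n) (≈-trans (ode n) (≈-trans (⋆-cong {β} {β} (λ _ → ≈-refl) A≗1+f n)
      (≈-trans (Sᵣ.distribˡ β oneS f n) (⊕-cong (Sᵣ.*-identityʳ β n) ≈-refl))))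
      where
      lem : D f ≗ D A
      lem zero    = ≈-trans (⊗-cong num-0 ≈-refl) (≈-sym (⊗-cong num-0 ≈-refl))
      lem (suc n) = ≈-refl

    term : ℕ → Series
    term i n = ι (signQ (suc i)) ⊗ (powS f i ⋆ D f) n

    term-split : ∀ i → powS f i ⋆ D f ≗ powS f i ⋆ β +ˢ powS f (suc i) ⋆ β
    term-split i n = ≈-trans (⋆-cong {powS f i} {powS f i} (λ _ → ≈-refl) Df n) (≈-trans (Sᵣ.distribˡ (powS f i) β (β ⋆ f) n) (⊕-cong ≈-refl
      (≈-trans (Sᵣ.*-congˡ {powS f i} (⋆-comm β f) n) (≈-trans (≈-sym (⋆-assoc (powS f i) f β n))
        (⋆-cong {powS f i ⋆ f} {powS f (suc i)} {β} {β} (λ n → ≈-trans (⋆-comm (powS f i) f n) (≈-sym (powS-suc f i n))) (λ _ → ≈-refl) n)))))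

    telescope : ∀ k n → sumP k (λ i → term i n) ≈ β n ⊕ ι (signQ (suc k)) ⊗ (powS f (suc k) ⋆ β) n
    telescope zero n = ≈-trans (ι1⊗ _) (≈-trans (term-split 0 n)
      (⊕-cong (⋆-identityˡ β n) (≈-sym (ι1⊗ _))))
      where
      ι1⊗ : ∀ p → ι 1ℚ ⊗ p ≈ p
      ι1⊗ p = ≈-trans (⊗-cong ι-1 ≈-refl) (⊗-identityˡ p)
    telescope (suc k) n = begin
      sumP k (λ i → term i n) ⊕ term (suc k) n
        ≈⟨ ⊕-cong (telescope k n) (≈-trans (⊗-cong {ι s′} ≈-refl (term-split (suc k) n)) (P.distribˡ (ι s′) _ _)) ⟩
      (β n ⊕ ι s ⊗ X) ⊕ (ι s′ ⊗ X ⊕ ι s′ ⊗ Y)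
        ≈⟨ solve 4 (λ b x x′ y → (b :+ x) :+ (x′ :+ y) := b :+ ((x :+ x′) :+ y)) ≈-refl (β n) (ι s ⊗ X) (ι s′ ⊗ X) (ι s′ ⊗ Y) ⟩
      β n ⊕ ((ι s ⊗ X ⊕ ι s′ ⊗ X) ⊕ ι s′ ⊗ Y)
        ≈⟨ P.+-congˡ {β n} (⊕-cong cancel ≈-refl) ⟩
      β n ⊕ ι s′ ⊗ Y ∎
      where
      open ≈-Reasoning
      s  = signQ (suc k)
      s′ = signQ (suc (suc k))
      X  = (powS f (suc k) ⋆ β) n
      Y  = (powS f (suc (suc k)) ⋆ β) n
      cancel : ι s ⊗ X ⊕ ι s′ ⊗ X ≈ zeroP
      cancel = ≈-trans (≈-sym (P.distribʳ X (ι s) (ι s′))) (≈-trans (⊗-cong (≈-trans (≈-sym (ι-+ s s′))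
        (≈-trans (≈-reflexive (cong ι (trans (cong (s ℚ.+_) (signQ-suc (suc k))) (ℚₚ.+-inverseʳ s)))) ι-0)) ≈-refl) (P.zeroˡ X))

  -- Compared after multiplication by n + 1, which turns f^(i+1)/(i+1) into f^i D f by the power
  -- rule. The constant terms, lost under `D`, are compared separately.
  log-unique : logS A ≗ B
  log-unique zero    = ≈-sym B0
  log-unique (suc n) = cancel-num n (begin
    num (suc n) ⊗ logS A (suc n)
      ≈⟨ ≈-sym (sumP-⊗ˡ n (num (suc n)) _) ⟩
    sumP n (λ i → num (suc n) ⊗ scale (signQ (suc i) ℚ.* inv (suc i)) (powS f (suc i) (suc n)))
      ≈⟨ sumP-cong n at-i ⟩
    sumP n (λ i → term i (suc n))
      ≈⟨ telescope n (suc n) ⟩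
    β (suc n) ⊕ ι (signQ (suc n)) ⊗ (powS f (suc n) ⋆ β) (suc n)
      ≈⟨ ⊕-cong {β (suc n)} ≈-refl (≈-trans (⊗-cong {ι (signQ (suc n))} ≈-refl small) (P.zeroʳ (ι (signQ (suc n))))) ⟩
    β (suc n) ⊕ zeroP
      ≈⟨ P.+-identityʳ _ ⟩
    β (suc n) ∎)
    where
    open ≈-Reasoning
    -- f^(n+1) has order n + 1 and β has order at least 1, so their product starts at u^(n+2).
    small : (powS f (suc n) ⋆ β) (suc n) ≈ zeroP
    small = order-⋆ {suc n} {1} (powS f (suc n)) β (order-pow f f0 (suc n)) (λ { zero _ → β0 ; (suc _) (s≤s ()) }) (suc n)
      (subst (suc n <_) (ℕₚ.+-comm 1 (suc n)) ℕₚ.≤-refl)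
    at-i : ∀ i → num (suc n) ⊗ scale (signQ (suc i) ℚ.* inv (suc i)) (powS f (suc i) (suc n)) ≈ term i (suc n)
    at-i i = begin
      num (suc n) ⊗ scale (s ℚ.* v) p
        ≈⟨ ⊗-cong {num (suc n)} ≈-refl (≈-trans (scale≈ (s ℚ.* v) p) (⊗-cong (ι-* s v) ≈-refl)) ⟩
      num (suc n) ⊗ (ι s ⊗ ι v ⊗ p)
        ≈⟨ solve 4 (λ c s v p → c :* (s :* v :* p) := s :* (v :* (c :* p))) ≈-refl (num (suc n)) (ι s) (ι v) p ⟩
      ι s ⊗ (ι v ⊗ (num (suc n) ⊗ p))
        ≈⟨ ⊗-cong {ι s} ≈-refl (⊗-cong {ι v} ≈-refl (≈-trans (D-pow f i (suc n)) (castˢ-⋆ f (suc i) _ (suc n)))) ⟩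
      ι s ⊗ (ι v ⊗ (num (suc i) ⊗ (powS f i ⋆ D f) (suc n)))
        ≈⟨ ⊗-cong {ι s} ≈-refl (≈-trans (≈-sym (⊗-assoc (ι v) (num (suc i)) _)) (≈-trans (⊗-cong (ι-inv-num (suc i)) ≈-refl) (⊗-identityˡ _))) ⟩
      term i (suc n) ∎
      where
      s = signQ (suc i)
      v = inv (suc i)
      p = powS f (suc i) (suc n)

-- expSum n Φ is the sum of Φ α / α! over all α ∈ ℕ^L with |α| = n.

expSum : ∀ {L} → ℕ → (Vec ℕ L → Poly) → Poly
expSum {zero}  zero    Φ = Φ []
expSum {zero}  (suc n) Φ = zeroP
expSum {suc L} n       Φ = conv n (λ a r → ι (inv (a !)) ⊗ expSum r (λ α → Φ (a ∷ α)))

inc : ∀ {L} → Fin L → Vec ℕ L → Vec ℕ L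
inc zero    (a ∷ α) = suc a ∷ α
inc (suc x) (a ∷ α) = a ∷ inc x α

expSum-cong : ∀ {L} n {Φ Ψ : Vec ℕ L → Poly} → (∀ α → Φ α ≈ Ψ α) → expSum n Φ ≈ expSum n Ψ
expSum-cong {zero}  zero    e = e []
expSum-cong {zero}  (suc n) e = ≈-refl
expSum-cong {suc L} n       e = conv-cong n λ a r → P.*-congˡ {ι (inv (a !))} (expSum-cong {L} r λ α → e (a ∷ α))

expSum-⊗ˡ : ∀ {L} n c (Φ : Vec ℕ L → Poly) → expSum n (λ α → c ⊗ Φ α) ≈ c ⊗ expSum n Φ
expSum-⊗ˡ {zero}  zero    c Φ = ≈-refl
expSum-⊗ˡ {zero}  (suc n) c Φ = ≈-sym (P.zeroʳ c)
expSum-⊗ˡ {suc L} n       c Φ = ≈-trans (conv-cong n λ a r →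
  ≈-trans (P.*-congˡ {ι (inv (a !))} (expSum-⊗ˡ {L} r c (Φ ∘ (a ∷_)))) (x∙yz≈y∙xz (ι (inv (a !))) c _)) (conv-⊗ˡ n c _)
  where open import Algebra.Properties.CommutativeSemigroup P.*-commutativeSemigroup using (x∙yz≈y∙xz)

expSum-0 : ∀ {L} n → expSum {L} n (λ _ → zeroP) ≈ zeroP
expSum-0 {zero}  zero    = ≈-refl
expSum-0 {zero}  (suc n) = ≈-refl
expSum-0 {suc L} n       = ≈-trans (conv-cong n λ a r → ≈-trans (P.*-congˡ {ι (inv (a !))} (expSum-0 {L} r)) (P.zeroʳ (ι (inv (a !))))) (conv-0 n)

expSum-⊕ : ∀ {L} n (Φ Ψ : Vec ℕ L → Poly) → expSum n (λ α → Φ α ⊕ Ψ α) ≈ expSum n Φ ⊕ expSum n Ψ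
expSum-⊕ {zero}  zero    Φ Ψ = ≈-refl
expSum-⊕ {zero}  (suc n) Φ Ψ = ≈-refl
expSum-⊕ {suc L} n       Φ Ψ = ≈-trans (conv-cong n λ a r →
  ≈-trans (P.*-congˡ {ι (inv (a !))} (expSum-⊕ {L} r (Φ ∘ (a ∷_)) (Ψ ∘ (a ∷_)))) (P.distribˡ (ι (inv (a !))) _ _)) (conv-⊕ n _ _)

expSum-∑ : ∀ {L} {A : Set} n (as : List A) (Φ : A → Vec ℕ L → Poly) →
           expSum n (λ α → ∑ as (λ a → Φ a α)) ≈ ∑ as (λ a → expSum n (Φ a))
expSum-∑ {L} n []   Φ = expSum-0 {L} n
expSum-∑ n (a ∷ as) Φ = ≈-trans (expSum-⊕ n (Φ a) _) (P.+-congˡ {expSum n (Φ a)} (expSum-∑ n as Φ))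

expSum-at-0 : ∀ {L} (Φ : Vec ℕ L → Poly) → expSum 0 Φ ≈ Φ (Vec.replicate L 0)
expSum-at-0 {zero}  Φ = ≈-refl
expSum-at-0 {suc L} Φ = ≈-trans (P.*-congʳ ι-1) (≈-trans (⊗-identityˡ _) (expSum-at-0 (Φ ∘ (0 ∷_))))

ι-inv-! : ∀ a → ι (inv (suc a !)) ⊗ num (suc a) ≈ ι (inv (a !))
ι-inv-! a = begin
  ι (inv (suc a !)) ⊗ num (suc a)              ≈⟨ P.*-congʳ (≈-reflexive (cong ι (inv-* (suc a) (a !) {{_}} {{a !≢0}}))) ⟩
  ι (inv (suc a) ℚ.* inv (a !)) ⊗ num (suc a)  ≈⟨ P.*-congʳ (ι-* (inv (suc a)) (inv (a !))) ⟩
  ι (inv (suc a)) ⊗ ι (inv (a !)) ⊗ num (suc a) ≈⟨ xy∙z≈xz∙y (ι (inv (suc a))) _ _ ⟩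
  ι (inv (suc a)) ⊗ num (suc a) ⊗ ι (inv (a !)) ≈⟨ P.*-congʳ (ι-inv-num (suc a)) ⟩
  oneP ⊗ ι (inv (a !))                          ≈⟨ ⊗-identityˡ _ ⟩
  ι (inv (a !)) ∎
  where
  open ≈-Reasoning
  open import Algebra.Properties.CommutativeSemigroup P.*-commutativeSemigroup using (xy∙z≈xz∙y)

num-0-⊗ : ∀ p → num 0 ⊗ p ≈ zeroP
num-0-⊗ p = ≈-trans (P.*-congʳ num-0) (P.zeroˡ p)

shift-0 : ∀ {L} (x : Fin L) (Φ : Vec ℕ L → Poly) → expSum 0 (λ α → num (lookup α x) ⊗ Φ α) ≈ zeroP
shift-0 {L} x Φ = ≈-trans (expSum-at-0 {L} (λ α → num (lookup α x) ⊗ Φ α)) (≈-trans (P.*-congʳ (≈-reflexive (cong num (Vecₚ.lookup-replicate x 0)))) (num-0-⊗ (Φ (Vec.replicate L 0))))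

-- α_x / α! is 1 / (α - e_x)!, so substituting `inc x α` for α absorbs the factor, and exponents
-- with α_x = 0 contribute nothing. If x is not the first index, the summand in which the first
-- exponent takes the whole degree leaves all others 0 and vanishes by `shift-0`.
shift : ∀ {L} n (x : Fin L) (Φ : Vec ℕ L → Poly) →
        expSum (suc n) (λ α → num (lookup α x) ⊗ Φ α) ≈ expSum n (λ α → Φ (inc x α))
shift {suc L} n zero Φ = begin
  ι (inv (0 !)) ⊗ expSum (suc n) (λ α → num 0 ⊗ Φ (0 ∷ α)) ⊕
    conv n (λ a r → ι (inv (suc a !)) ⊗ expSum r (λ α → num (suc a) ⊗ Φ (suc a ∷ α)))
    ≈⟨ ⊕-cong (≈-trans (P.*-congˡ {ι (inv (0 !))} (≈-trans (expSum-cong {L} (suc n) λ α → num-0-⊗ (Φ (0 ∷ α))) (expSum-0 {L} (suc n)))) (P.zeroʳ (ι (inv (0 !)))))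
       (conv-cong n λ a r → ≈-trans (P.*-congˡ {ι (inv (suc a !))} (expSum-⊗ˡ {L} r (num (suc a)) (Φ ∘ (suc a ∷_))))
         (≈-trans (≈-sym (⊗-assoc (ι (inv (suc a !))) (num (suc a)) _)) (P.*-congʳ (ι-inv-! a)))) ⟩
  conv n (λ a r → ι (inv (a !)) ⊗ expSum r (λ α → Φ (suc a ∷ α))) ∎
  where open ≈-Reasoning
shift {suc L} n (suc x) Φ = begin
  conv (suc n) (λ a r → ι (inv (a !)) ⊗ expSum r (λ α → num (lookup α x) ⊗ Φ (a ∷ α)))
    ≈⟨ conv-last n (λ a r → ι (inv (a !)) ⊗ expSum r (λ α → num (lookup α x) ⊗ Φ (a ∷ α))) ⟩
  conv n (λ a r → ι (inv (a !)) ⊗ expSum (suc r) (λ α → num (lookup α x) ⊗ Φ (a ∷ α))) ⊕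
    ι (inv (suc n !)) ⊗ expSum 0 (λ α → num (lookup α x) ⊗ Φ (suc n ∷ α))
    ≈⟨ ⊕-cong (conv-cong n λ a r → P.*-congˡ {ι (inv (a !))} (shift r x (Φ ∘ (a ∷_))))
       (≈-trans (P.*-congˡ {ι (inv (suc n !))} (shift-0 x (Φ ∘ (suc n ∷_)))) (P.zeroʳ (ι (inv (suc n !))))) ⟩
  conv n (λ a r → ι (inv (a !)) ⊗ expSum r (λ α → Φ (a ∷ inc x α))) ⊕ zeroP
    ≈⟨ P.+-identityʳ _ ⟩
  conv n (λ a r → ι (inv (a !)) ⊗ expSum r (λ α → Φ (a ∷ inc x α))) ∎
  where open ≈-Reasoning

num-total : ∀ {L} (α : Vec ℕ L) → num (Vec.sum α) ≈ ∑ (allFin L) (λ x → num (lookup α x))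
num-total []      = num-0
num-total (a ∷ α) = ≈-trans (num-+ a _) (≈-trans (P.+-congˡ {num a} (num-total α))
  (≈-sym (∑ₚ.∑-allFin-suc _ (λ x → num (lookup (a ∷ α) x)))))

expSum-total : ∀ {L} n (Φ : Vec ℕ L → Poly) → expSum n (λ α → num (Vec.sum α) ⊗ Φ α) ≈ num n ⊗ expSum n Φ
expSum-total {zero}  zero    Φ = ≈-refl
expSum-total {zero}  (suc n) Φ = ≈-sym (P.zeroʳ (num (suc n)))
expSum-total {suc L} n       Φ = ≈-trans (conv-cong⁺ n λ a r e → begin
    ι (inv (a !)) ⊗ expSum r (λ α → num (a ℕ.+ Vec.sum α) ⊗ Φ (a ∷ α))
      ≈⟨ P.*-congˡ {ι (inv (a !))} (≈-trans (expSum-cong {L} r λ α → ≈-trans (P.*-congʳ (num-+ a (Vec.sum α))) (P.distribʳ (Φ (a ∷ α)) (num a) (num (Vec.sum α)))) (expSum-⊕ {L} r (λ α → num a ⊗ Φ (a ∷ α)) (λ α → num (Vec.sum α) ⊗ Φ (a ∷ α)))) ⟩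
    ι (inv (a !)) ⊗ (expSum r (λ α → num a ⊗ Φ (a ∷ α)) ⊕ expSum r (λ α → num (Vec.sum α) ⊗ Φ (a ∷ α)))
      ≈⟨ P.*-congˡ {ι (inv (a !))} (⊕-cong (expSum-⊗ˡ {L} r (num a) (Φ ∘ (a ∷_))) (expSum-total {L} r (Φ ∘ (a ∷_)))) ⟩
    ι (inv (a !)) ⊗ (num a ⊗ expSum r (Φ ∘ (a ∷_)) ⊕ num r ⊗ expSum r (Φ ∘ (a ∷_)))
      ≈⟨ solve 4 (λ i a r s → i :* (a :* s :+ r :* s) := (a :+ r) :* (i :* s)) ≈-refl (ι (inv (a !))) (num a) (num r) (expSum r (Φ ∘ (a ∷_))) ⟩
    (num a ⊕ num r) ⊗ (ι (inv (a !)) ⊗ expSum r (Φ ∘ (a ∷_)))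
      ≈⟨ P.*-congʳ (≈-trans (≈-sym (num-+ a r)) (≈-reflexive (cong num e))) ⟩
    num n ⊗ (ι (inv (a !)) ⊗ expSum r (Φ ∘ (a ∷_))) ∎) (conv-⊗ˡ n (num n) _)
  where open ≈-Reasoning

euler-∑ : ∀ {L} n (Φ : Vec ℕ L → Poly) →
  num n ⊗ expSum n Φ ≈ ∑ (allFin L) (λ x → expSum n (λ α → num (lookup α x) ⊗ Φ α))
euler-∑ {L} n Φ = begin
  num n ⊗ expSum n Φ
    ≈⟨ expSum-total n Φ ⟨
  expSum n (λ α → num (Vec.sum α) ⊗ Φ α)
    ≈⟨ expSum-cong {L} n (λ α → ≈-trans (P.*-congʳ (num-total α)) (≈-sym (∑-*ʳ (allFin L) (Φ α) (λ x → num (lookup α x))))) ⟩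
  expSum n (λ α → ∑ (allFin L) (λ x → num (lookup α x) ⊗ Φ α))
    ≈⟨ expSum-∑ {L} n (allFin L) (λ x α → num (lookup α x) ⊗ Φ α) ⟩
  ∑ (allFin L) (λ x → expSum n (λ α → num (lookup α x) ⊗ Φ α)) ∎
  where open ≈-Reasoning

-- Euler's identity for homogeneous polynomials: the degree is the sum of the exponents, and each
-- factor α_x is absorbed by `shift`. It drives the Wick recursion, the binomial formula and the
-- count of subsets by size.
euler : ∀ {L} n (Φ : Vec ℕ L → Poly) →
  num (suc n) ⊗ expSum (suc n) Φ ≈ ∑ (allFin L) (λ x → expSum n (Φ ∘ inc x))
euler {L} n Φ = ≈-trans (euler-∑ (suc n) Φ) (∑-cong (allFin L) λ x → shift n x Φ)

-- Moments of ⟨·⟩ and Wick's formula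

data Kind : Set where
  kb kw ky kz : Kind

dual : Kind → Kind
dual kb = kb
dual kw = kw
dual ky = kz
dual kz = ky

_==_ : Kind → Kind → Bool
kb == kb = true
kw == kw = true
ky == ky = true
kz == kz = true
_  == _  = false

==-true : ∀ κ κ′ → κ == κ′ ≡ true → κ ≡ κ′
==-true kb kb _ = refl
==-true kw kw _ = refl
==-true ky ky _ = refl
==-true kz kz _ = refl

moment : (Kind → ℕ) → ℚ
moment c = gaussMoment (c kb) ℚ.* gaussMoment (c kw) ℚ.* yzMoment (c ky) (c kz)

addᴷ : Kind → (Kind → ℕ) → Kind → ℕ
addᴷ κ c κ′ = b2n (κ == κ′) ℕ.+ c κ′

predᴷ : Kind → (Kind → ℕ) → Kind → ℕ
predᴷ κ c κ′ = c κ′ ∸ b2n (κ == κ′)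

predᴷ-addᴷ : ∀ κ c κ′ → predᴷ κ (addᴷ κ c) κ′ ≡ c κ′
predᴷ-addᴷ κ c κ′ = ℕₚ.m+n∸m≡n (b2n (κ == κ′)) (c κ′)

moment-cong : ∀ {c d} → (∀ κ → c κ ≡ d κ) → moment c ≡ moment d
moment-cong e = cong₂ ℚ._*_ (cong₂ (λ x y → gaussMoment x ℚ.* gaussMoment y) (e kb) (e kw)) (cong₂ yzMoment (e ky) (e kz))

half-suc : ∀ n → suc (suc n) ℕ./ 2 ≡ suc (n ℕ./ 2)
half-suc n = trans (cong (ℕ._/ 2) (ℕₚ.+-comm 2 n)) (trans (DivMod.+-distrib-/-∣ʳ n {2} {2} (Div.divides 1 refl)) (ℕₚ.+-comm (n ℕ./ 2) 1))

-- Gaussian integration by parts, ⟨x · x^n⟩ = n ⟨x^(n-1)⟩. At n = 0 the factor is 0, so the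
-- truncation in `n ∸ 1` does no harm.
gaussMoment-suc : ∀ n → gaussMoment (suc n) ≡ castᵠ n ℚ.* gaussMoment (n ∸ 1)
gaussMoment-suc zero    = sym (ℚₚ.*-zeroˡ (gaussMoment 0))
gaussMoment-suc (suc n) = by-parity
  where
  open ≡-Reasoning
  h = n ℕ./ 2
  d = 2 ^ h ℕ.* (h !)
  instance
    d≢0 : ℕ.NonZero d
    d≢0 = ℕₚ.m*n≢0 (2 ^ h) (h !) {{ℕₚ.m^n≢0 2 h}} {{h !≢0}}
  -- With h = n/2 and n even, the new factor 2h + 2 of the denominator is n + 2; it cancels the
  -- leading factor of (n+2)! and leaves n + 1.
  rearrange : 2 ^ suc h ℕ.* (suc h !) ≡ suc (suc (h ℕ.+ h)) ℕ.* d
  rearrange = solveℕ 3 (λ h p f → (con 2 :*′ p) :*′ ((con 1 :+′ h) :*′ f) :=′ (con 2 :+′ (h :+′ h)) :*′ (p :*′ f)) refl h (2 ^ h) (h !)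
  twice : evenᵇ n ≡ true → h ℕ.+ h ≡ n
  twice = go n
    where
    go : ∀ n → evenᵇ n ≡ true → n ℕ./ 2 ℕ.+ n ℕ./ 2 ≡ n
    go zero          e = refl
    go (suc (suc n)) e = trans (cong (λ k → k ℕ.+ k) (half-suc n)) (cong suc (trans (ℕₚ.+-suc _ _) (cong suc (go n e))))
  even-case : evenᵇ n ≡ true → fromℕ (suc (suc n) !) ℚ.* inv (2 ^ (suc (suc n) ℕ./ 2) ℕ.* ((suc (suc n) ℕ./ 2) !))
                ≡ castᵠ (suc n) ℚ.* (fromℕ (n !) ℚ.* inv d)
  even-case e = begin
    fromℕ (suc (suc n) !) ℚ.* inv (2 ^ (suc (suc n) ℕ./ 2) ℕ.* ((suc (suc n) ℕ./ 2) !))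
      ≡⟨ cong₂ ℚ._*_ (trans (fromℕ≡cast (suc (suc n) !)) (trans (castᵠ-* (suc (suc n)) (suc n !)) (cong (castᵠ (suc (suc n)) ℚ.*_) (castᵠ-* (suc n) (n !)))))
           (trans (cong (λ k → inv (2 ^ k ℕ.* (k !))) (half-suc n)) (trans (cong inv rearrange)
             (trans (inv-* (suc (suc (h ℕ.+ h))) d) (cong (λ k → inv (suc (suc k)) ℚ.* inv d) (twice e))))) ⟩
    (castᵠ (suc (suc n)) ℚ.* (castᵠ (suc n) ℚ.* castᵠ (n !))) ℚ.* (inv (suc (suc n)) ℚ.* inv d)
      ≡⟨ solveᵠ 5 (λ a b c i j → (a :*″ (b :*″ c)) :*″ (i :*″ j) :=″ (i :*″ a) :*″ (b :*″ (c :*″ j))) refl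
           (castᵠ (suc (suc n))) (castᵠ (suc n)) (castᵠ (n !)) (inv (suc (suc n))) (inv d) ⟩
    inv (suc (suc n)) ℚ.* castᵠ (suc (suc n)) ℚ.* (castᵠ (suc n) ℚ.* (castᵠ (n !) ℚ.* inv d))
      ≡⟨ trans (cong (ℚ._* (castᵠ (suc n) ℚ.* (castᵠ (n !) ℚ.* inv d))) (inv-cast (suc n))) (ℚₚ.*-identityˡ _) ⟩
    castᵠ (suc n) ℚ.* (castᵠ (n !) ℚ.* inv d)
      ≡⟨ cong (λ q → castᵠ (suc n) ℚ.* (q ℚ.* inv d)) (sym (fromℕ≡cast (n !))) ⟩
    castᵠ (suc n) ℚ.* (fromℕ (n !) ℚ.* inv d) ∎
  by-parity : gaussMoment (suc (suc n)) ≡ castᵠ (suc n) ℚ.* gaussMoment n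
  by-parity with evenᵇ n in eq
  ... | true  = even-case eq
  ... | false = sym (ℚₚ.*-zeroʳ (castᵠ (suc n)))

yzMoment-sym : ∀ k l → yzMoment k l ≡ yzMoment l k
yzMoment-sym k l with k ≡ᵇ l in p | l ≡ᵇ k in q
... | true  | true  = cong (λ n → fromℕ (n !)) (≡ᵇ-true k l p)
... | false | false = refl
... | true  | false = contradiction (trans (sym q) (trans (cong (l ≡ᵇ_) (≡ᵇ-true k l p)) (≡ᵇ-refl l))) λ ()
... | false | true  = contradiction (trans (sym p) (trans (cong (k ≡ᵇ_) (≡ᵇ-true l k q)) (≡ᵇ-refl k))) λ ()

yzMoment-suc : ∀ k l → yzMoment (suc k) l ≡ castᵠ l ℚ.* yzMoment k (l ∸ 1)
yzMoment-suc k zero    = sym (ℚₚ.*-zeroˡ (yzMoment k 0))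
yzMoment-suc k (suc l) with k ≡ᵇ l in p
... | false = sym (ℚₚ.*-zeroʳ (castᵠ (suc l)))
... | true  = begin
  fromℕ (suc k !)                  ≡⟨ fromℕ≡cast (suc k !) ⟩
  castᵠ (suc k !)                  ≡⟨ castᵠ-* (suc k) (k !) ⟩
  castᵠ (suc k) ℚ.* castᵠ (k !)    ≡⟨ cong₂ (λ a q → castᵠ (suc a) ℚ.* q) (≡ᵇ-true k l p) (sym (fromℕ≡cast (k !))) ⟩
  castᵠ (suc l) ℚ.* fromℕ (k !) ∎
  where open ≡-Reasoning

-- Integration by parts in four variables whose only nonzero covariances are ⟨bb⟩ = ⟨ww⟩ = ⟨yz⟩ = 1,
-- whence `dual`. The case of z follows from that of y by the symmetry of `yzMoment`.
moment-suc : ∀ κ c → moment (addᴷ κ c) ≡ castᵠ (c (dual κ)) ℚ.* moment (predᴷ (dual κ) c)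
moment-suc kb c = trans (cong (λ g → g ℚ.* gaussMoment (c kw) ℚ.* yzMoment (c ky) (c kz)) (gaussMoment-suc (c kb)))
  (solveᵠ 4 (λ n x y z → ((n :*″ x) :*″ y) :*″ z :=″ n :*″ ((x :*″ y) :*″ z)) refl (castᵠ (c kb)) (gaussMoment (c kb ∸ 1)) (gaussMoment (c kw)) (yzMoment (c ky) (c kz)))
moment-suc kw c = trans (cong (λ g → gaussMoment (c kb) ℚ.* g ℚ.* yzMoment (c ky) (c kz)) (gaussMoment-suc (c kw)))
  (solveᵠ 4 (λ n x y z → (x :*″ (n :*″ y)) :*″ z :=″ n :*″ ((x :*″ y) :*″ z)) refl (castᵠ (c kw)) (gaussMoment (c kb)) (gaussMoment (c kw ∸ 1)) (yzMoment (c ky) (c kz)))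
moment-suc ky c = trans (cong (gaussMoment (c kb) ℚ.* gaussMoment (c kw) ℚ.*_) (yzMoment-suc (c ky) (c kz)))
  (solveᵠ 3 (λ n x z → x :*″ (n :*″ z) :=″ n :*″ (x :*″ z)) refl (castᵠ (c kz)) (gaussMoment (c kb) ℚ.* gaussMoment (c kw)) (yzMoment (c ky) (c kz ∸ 1)))
moment-suc kz c = trans (cong (gaussMoment (c kb) ℚ.* gaussMoment (c kw) ℚ.*_)
    (trans (yzMoment-sym (c ky) (suc (c kz))) (trans (yzMoment-suc (c kz) (c ky)) (cong (castᵠ (c ky) ℚ.*_) (yzMoment-sym (c kz) (c ky ∸ 1))))))
  (solveᵠ 3 (λ n x z → x :*″ (n :*″ z) :=″ n :*″ (x :*″ z)) refl (castᵠ (c ky)) (gaussMoment (c kb) ℚ.* gaussMoment (c kw)) (yzMoment (c ky ∸ 1) (c kz)))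

count : ∀ {L} → Vec Kind L → Vec ℕ L → Kind → ℕ
count []       []      κ = 0
count (k ∷ ks) (a ∷ α) κ = b2n (k == κ) ℕ.* a ℕ.+ count ks α κ

count-inc : ∀ {L} (ks : Vec Kind L) x α κ → count ks (inc x α) κ ≡ addᴷ (lookup ks x) (count ks α) κ
count-inc (k ∷ ks) zero    (a ∷ α) κ with k == κ
... | true  = refl
... | false = refl
count-inc (k ∷ ks) (suc x) (a ∷ α) κ = trans (cong (b2n (k == κ) ℕ.* a ℕ.+_) (count-inc ks x α κ)) (x∙yz≈y∙xz (b2n (k == κ) ℕ.* a) (b2n (lookup ks x == κ)) (count ks α κ))
  where open import Algebra.Properties.CommutativeSemigroup ℕₚ.+-commutativeSemigroup using (x∙yz≈y∙xz)

count-replicate : ∀ {L} (ks : Vec Kind L) κ → count ks (Vec.replicate L 0) κ ≡ 0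
count-replicate []       κ = refl
count-replicate (k ∷ ks) κ = trans (cong₂ ℕ._+_ (ℕₚ.*-zeroʳ (b2n (k == κ))) (count-replicate ks κ)) refl

num-b2n : ∀ b → num (b2n b) ≈ δ b
num-b2n true  = num-1
num-b2n false = num-0

num-count : ∀ {L} (ks : Vec Kind L) α κ →
            num (count ks α κ) ≈ ∑ (allFin L) (λ x → δ (lookup ks x == κ) ⊗ num (lookup α x))
num-count []       []      κ = num-0
num-count (k ∷ ks) (a ∷ α) κ = ≈-trans (num-+ (b2n (k == κ) ℕ.* a) _)
  (≈-trans (⊕-cong (≈-trans (num-* (b2n (k == κ)) a) (P.*-congʳ (num-b2n (k == κ)))) (num-count ks α κ))
  (≈-sym (∑ₚ.∑-allFin-suc _ (λ x → δ (lookup (k ∷ ks) x == κ) ⊗ num (lookup (a ∷ α) x)))))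

-- This is ⟨·⟩ of the sum of Φ α x^α / α! over |α| = n, where the i-th variable is a copy of b, w, y
-- or z as prescribed by `ks`. Copies of one kind are substituted by the same variable, so the
-- moment sees only the totals in `count`.
wick : ∀ {L} → Vec Kind L → ℕ → (Vec ℕ L → Poly) → Poly
wick ks n Φ = expSum n (λ α → ι (moment (count ks α)) ⊗ Φ α)

wick-0 : ∀ {L} (ks : Vec Kind L) Φ → wick ks 0 Φ ≈ Φ (Vec.replicate L 0)
wick-0 {L} ks Φ = ≈-trans (expSum-at-0 {L} (λ α → ι (moment (count ks α)) ⊗ Φ α)) (≈-trans (P.*-congʳ (≈-trans (≈-reflexive (cong ι (moment-cong (count-replicate ks)))) ι-1)) (⊗-identityˡ _))

-- Inside ⟨·⟩, multiplying by a variable of kind κ amounts to differentiating with respect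
-- to the variables of the dual kind.
wick-inc : ∀ {L} (ks : Vec Kind L) (x : Fin L) (Φ : Vec ℕ L → Poly) α →
  ι (moment (count ks (inc x α))) ⊗ Φ (inc x α) ≈
  ∑ (allFin L) (λ x′ → num (lookup α x′) ⊗
    (δ (lookup ks x′ == dual (lookup ks x)) ⊗ (ι (moment (predᴷ (dual (lookup ks x)) (count ks α))) ⊗ Φ (inc x α))))
wick-inc {L} ks x Φ α = begin
  ι (moment (count ks (inc x α))) ⊗ φ
    ≈⟨ P.*-congʳ (≈-trans (≈-reflexive (cong ι (trans (moment-cong (count-inc ks x α)) (moment-suc (lookup ks x) (count ks α))))) (ι-* _ _)) ⟩
  ι (castᵠ (count ks α κ)) ⊗ ι m ⊗ φ
    ≈⟨ P.*-congʳ (P.*-congʳ (≈-trans (≈-reflexive (sym (num≡ι _))) (num-count ks α κ))) ⟩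
  ∑ (allFin L) (λ x′ → δ (lookup ks x′ == κ) ⊗ num (lookup α x′)) ⊗ ι m ⊗ φ
    ≈⟨ ⊗-assoc (∑ (allFin L) (λ x′ → δ (lookup ks x′ == κ) ⊗ num (lookup α x′))) (ι m) φ ⟩
  ∑ (allFin L) (λ x′ → δ (lookup ks x′ == κ) ⊗ num (lookup α x′)) ⊗ (ι m ⊗ φ)
    ≈⟨ ∑-*ʳ (allFin L) (ι m ⊗ φ) _ ⟨
  ∑ (allFin L) (λ x′ → δ (lookup ks x′ == κ) ⊗ num (lookup α x′) ⊗ (ι m ⊗ φ))
    ≈⟨ ∑-cong (allFin L) (λ x′ → xy∙z≈y∙xz (δ (lookup ks x′ == κ)) _ _) ⟩
  _ ∎
  where
  open ≈-Reasoning
  open import Algebra.Properties.CommutativeSemigroup P.*-commutativeSemigroup using (xy∙z≈y∙xz)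
  κ = dual (lookup ks x)
  m = moment (predᴷ κ (count ks α))
  φ = Φ (inc x α)

private
  wick-partner : ∀ {L} (ks : Vec Kind L) (Φ : Vec ℕ L → Poly) (x x′ : Fin L) → Vec ℕ L → Poly
  wick-partner ks Φ x x′ α =
    δ (lookup ks x′ == dual (lookup ks x)) ⊗ (ι (moment (predᴷ (dual (lookup ks x)) (count ks α))) ⊗ Φ (inc x α))

  expSum-wick-inc : ∀ {L} (ks : Vec Kind L) n x Φ →
    expSum {L} n (λ α → ι (moment (count ks (inc x α))) ⊗ Φ (inc x α)) ≈
    ∑ (allFin L) (λ x′ → expSum {L} n (λ α → num (lookup α x′) ⊗ wick-partner ks Φ x x′ α))
  expSum-wick-inc {L} ks n x Φ = ≈-trans (expSum-cong {L} n (wick-inc ks x Φ))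
    (expSum-∑ {L} n (allFin L) (λ x′ α → num (lookup α x′) ⊗ wick-partner ks Φ x x′ α))

-- A lone half-edge has no partner: once it is removed, every candidate partner has exponent 0.
wick-1 : ∀ {L} (ks : Vec Kind L) Φ → wick ks 1 Φ ≈ zeroP
wick-1 {L} ks Φ = ≈-trans (≈-sym (≈-trans (P.*-congʳ num-1) (⊗-identityˡ _)))
  (≈-trans (euler {L} 0 (λ α → ι (moment (count ks α)) ⊗ Φ α)) (∑-zero (allFin L) λ x →
    ≈-trans (expSum-wick-inc ks 0 x Φ) (∑-zero (allFin L) λ x′ → shift-0 x′ (wick-partner ks Φ x x′))))

-- Euler's identity removes a half-edge x, integration by parts supplies a factor α_x′ for each
-- possible partner x′, and `shift` absorbs this factor too. Where the delta is 1, x′ has the dual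
-- kind, so `predᴷ` undoes exactly what `inc x′` added and the moment of the remaining half-edges is
-- left; this is why `term` splits on the value of the delta.
wick-suc-suc : ∀ {L} (ks : Vec Kind L) n Φ → num (suc (suc n)) ⊗ wick ks (suc (suc n)) Φ ≈
  ∑ (allFin L) (λ x → ∑ (allFin L) (λ x′ → δ (lookup ks x′ == dual (lookup ks x)) ⊗ wick ks n (λ α → Φ (inc x (inc x′ α)))))
wick-suc-suc {L} ks n Φ = ≈-trans (euler {L} (suc n) (λ α → ι (moment (count ks α)) ⊗ Φ α)) (∑-cong (allFin L) λ x →
  ≈-trans (expSum-wick-inc ks (suc n) x Φ) (∑-cong (allFin L) λ x′ →
    ≈-trans (shift n x′ (wick-partner ks Φ x x′)) (≈-trans (expSum-⊗ˡ {L} n (δ (lookup ks x′ == dual (lookup ks x))) (rest x x′))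
      (term x x′ (lookup ks x′ == dual (lookup ks x)) refl))))
  where
  rest : Fin L → Fin L → Vec ℕ L → Poly
  rest x x′ α = ι (moment (predᴷ (dual (lookup ks x)) (count ks (inc x′ α)))) ⊗ Φ (inc x (inc x′ α))
  term : ∀ x x′ b → lookup ks x′ == dual (lookup ks x) ≡ b →
    δ b ⊗ expSum {L} n (rest x x′) ≈ δ b ⊗ wick ks n (λ α → Φ (inc x (inc x′ α)))
  term x x′ false _ = ≈-refl
  term x x′ true  e = P.*-congˡ {oneP} (expSum-cong {L} n λ α → P.*-congʳ (≈-reflexive (cong ι (moment-cong λ κ →
    trans (cong (λ c → c ∸ b2n (dual (lookup ks x) == κ)) (count-inc ks x′ α κ))
      (trans (cong (λ l → addᴷ l (count ks α) κ ∸ b2n (dual (lookup ks x) == κ)) (==-true _ _ e)) (predᴷ-addᴷ (dual (lookup ks x)) (count ks α) κ))))))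

-- Expansion of ⟨S^V⟩ over colourings

term : Mono → Poly
term m = (1ℚ , m) ∷ []

eval-term : ∀ m φ → eval (term m) φ ≡ φ m
eval-term m φ = trans (ℚₚ.+-identityʳ (1ℚ ℚ.* φ m)) (ℚₚ.*-identityˡ (φ m))

term-cong : ∀ {m m′} → (∀ i → nth0 m i ≡ nth0 m′ i) → term m ≈ term m′
term-cong {m} {m′} e .at φ r = trans (eval-term m φ) (trans (r m m′ e) (sym (eval-term m′ φ)))

term-⊗ : ∀ m m′ → term m ⊗ term m′ ≈ term (addMono m m′)
term-⊗ m m′ .at φ r = trans (eval-⊗ (term m) (term m′) φ) (trans (eval-term m (λ m₁ → eval (term m′) (φ ∘ addMono m₁)))
  (trans (eval-term m′ (φ ∘ addMono m)) (sym (eval-term (addMono m m′) φ))))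

exponents : (Kind → ℕ) → Mono
exponents c = 0 ∷ c kb ∷ c kw ∷ c ky ∷ c kz ∷ []

exponents-cong : ∀ {c d} → (∀ κ → c κ ≡ d κ) → exponents c ≡ exponents d
exponents-cong {c} {d} e = cong (0 ∷_) (cong₂ _∷_ (e kb) (cong₂ _∷_ (e kw) (cong₂ _∷_ (e ky) (cong (_∷ []) (e kz)))))

varOf : Kind → Poly
varOf kb = bV
varOf kw = wV
varOf ky = yV
varOf kz = zV

varOf≈ : ∀ κ → varOf κ ≈ term (exponents (λ κ′ → b2n (κ == κ′)))
varOf≈ kb = term-cong (monoEq-sound (0 ∷ 1 ∷ []) (exponents (λ κ′ → b2n (kb == κ′))) refl)
varOf≈ kw = term-cong (monoEq-sound (0 ∷ 0 ∷ 1 ∷ []) (exponents (λ κ′ → b2n (kw == κ′))) refl)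
varOf≈ ky = term-cong (monoEq-sound (0 ∷ 0 ∷ 0 ∷ 1 ∷ []) (exponents (λ κ′ → b2n (ky == κ′))) refl)
varOf≈ kz = ≈-refl

pow-varOf : ∀ κ a → powP (varOf κ) a ≈ term (exponents (λ κ′ → b2n (κ == κ′) ℕ.* a))
pow-varOf κ zero    = ≈-trans (term-cong {[]} {exponents (λ _ → 0)} (monoEq-sound [] (exponents (λ _ → 0)) refl))
  (≈-reflexive (cong term (exponents-cong λ κ′ → sym (ℕₚ.*-zeroʳ (b2n (κ == κ′))))))
pow-varOf κ (suc a) = ≈-trans (⊗-cong (varOf≈ κ) (pow-varOf κ a))
  (≈-trans (term-⊗ (exponents λ κ′ → b2n (κ == κ′)) (exponents λ κ′ → b2n (κ == κ′) ℕ.* a))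
  (≈-reflexive (cong term (exponents-cong λ κ′ → sym (ℕₚ.*-suc (b2n (κ == κ′)) a)))))

monomial : ∀ {L} → Vec Kind L → Vec ℕ L → Poly
monomial []       []      = oneP
monomial (k ∷ ks) (a ∷ α) = powP (varOf k) a ⊗ monomial ks α

monomial≈ : ∀ {L} (ks : Vec Kind L) α → monomial ks α ≈ term (exponents (count ks α))
monomial≈ []       []      = term-cong {[]} {exponents (λ _ → 0)} (monoEq-sound [] (exponents (λ _ → 0)) refl)
monomial≈ (k ∷ ks) (a ∷ α) = ≈-trans (⊗-cong (pow-varOf k a) (monomial≈ ks α)) (term-⊗ (exponents (λ κ′ → b2n (k == κ′) ℕ.* a)) (exponents (count ks α)))

bw-monomial : ∀ {L} (ks : Vec Kind L) α → bw (monomial ks α) ≈ ι (moment (count ks α))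
bw-monomial ks α = ≈-trans (bw-cong (monomial≈ ks α)) (≈-trans lem (≈-reflexive (sym (ι≡constP (moment (count ks α))))))
  where
  c = count ks α
  lem : bw (term (exponents c)) ≈ constP (moment c)
  lem .at φ r = trans (eval-bw (term (exponents c)) φ) (trans (eval-term (exponents c) (λ m → bwWeight m ℚ.* φ (bwRest m)))
    (trans (cong (moment c ℚ.*_) (r (exponents (λ _ → 0)) [] (monoEq-sound (exponents (λ _ → 0)) [] refl))) (sym (eval-const (moment c) φ))))

-- Linearity of ⟨·⟩ over t and the ξ_k, phrased for one factor at a time so that it passes to
-- products such as the vertex weights.
Scalar : Poly → Set
Scalar r = ∀ p → bw (p ⊗ r) ≈ bw p ⊗ r

scalar-term : ∀ m → nth0 m 1 ≡ 0 → nth0 m 2 ≡ 0 → nth0 m 3 ≡ 0 → nth0 m 4 ≡ 0 → Scalar (term m)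
scalar-term m e₁ e₂ e₃ e₄ p .at φ r = begin
  eval (bw (p ⊗ term m)) φ
    ≡⟨ trans (eval-bw (p ⊗ term m) φ) (eval-⊗ p (term m) _) ⟩
  eval p (λ m′ → eval (term m) (λ m″ → bwWeight (addMono m′ m″) ℚ.* φ (bwRest (addMono m′ m″))))
    ≡⟨ eval-cong p (λ m′ → trans (eval-term m (λ m″ → bwWeight (addMono m′ m″) ℚ.* φ (bwRest (addMono m′ m″)))) (cong₂ ℚ._*_ (weight≡ m′) (r (bwRest (addMono m′ m)) (addMono (bwRest m′) m) (rest≡ m′)))) ⟩
  eval p (λ m′ → bwWeight m′ ℚ.* φ (addMono (bwRest m′) m))
    ≡⟨ sym (trans (eval-⊗ (bw p) (term m) φ) (trans (eval-bw p _) (eval-cong p λ m′ → cong (bwWeight m′ ℚ.*_) (eval-term m (φ ∘ addMono (bwRest m′)))))) ⟩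
  eval (bw p ⊗ term m) φ ∎
  where
  open ≡-Reasoning
  at-0 : ∀ m′ i → nth0 m i ≡ 0 → nth0 (addMono m′ m) i ≡ nth0 m′ i
  at-0 m′ i e = trans (nth0-addMono m′ m i) (trans (cong (nth0 m′ i ℕ.+_) e) (ℕₚ.+-identityʳ _))
  weight≡ : ∀ m′ → bwWeight (addMono m′ m) ≡ bwWeight m′
  weight≡ m′ = cong₂ ℚ._*_ (cong₂ (λ x y → gaussMoment x ℚ.* gaussMoment y) (at-0 m′ 1 e₁) (at-0 m′ 2 e₂)) (cong₂ yzMoment (at-0 m′ 3 e₃) (at-0 m′ 4 e₄))
  rest≡ : ∀ m′ i → nth0 (bwRest (addMono m′ m)) i ≡ nth0 (addMono (bwRest m′) m) i
  rest≡ m′ i = trans (lem i) (sym (nth0-addMono (bwRest m′) m i))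
    where
    lem : ∀ i → nth0 (bwRest (addMono m′ m)) i ≡ nth0 (bwRest m′) i ℕ.+ nth0 m i
    lem 0 = nth0-addMono m′ m 0
    lem 1 = sym e₁
    lem 2 = sym e₂
    lem 3 = sym e₃
    lem 4 = sym e₄
    lem (suc (suc (suc (suc (suc i))))) = trans (nth0-drop 5 (addMono m′ m) i) (trans (nth0-addMono m′ m (5 ℕ.+ i)) (cong (ℕ._+ nth0 m (5 ℕ.+ i)) (sym (nth0-drop 5 m′ i))))

scalar-⊗ : ∀ r s → Scalar r → Scalar s → Scalar (r ⊗ s)
scalar-⊗ r s er es p = ≈-trans (bw-cong (≈-sym (⊗-assoc p r s))) (≈-trans (es (p ⊗ r)) (≈-trans (P.*-congʳ (er p)) (⊗-assoc (bw p) r s)))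

scalar-one : Scalar oneP
scalar-one p = ≈-trans (bw-cong (P.*-identityʳ p)) (≈-sym (P.*-identityʳ (bw p)))

scalar-zero : Scalar zeroP
scalar-zero p = ≈-trans (bw-cong (P.zeroʳ p)) (≈-sym (P.zeroʳ (bw p)))

-- ξ 0 = 0 discards the graphs with isolated vertices.
ξ : ℕ → Poly
ξ zero    = zeroP
ξ (suc k) = ξV (suc k)

pc : Fin 2 → ℕ → Poly
pc zero    b = pp b
pc (suc _) b = oneP

-- The scalar factor of a vertex with `a` half-edges towards its own colour and `b` towards the
-- other. At a white vertex `b` is the number of half-edges leading to black vertices, so its parity
-- decides about the factor t.
ω : Fin 2 → ℕ → ℕ → Poly
ω col a b = pc col b ⊗ ξ (a ℕ.+ b)

scalar-ω : ∀ col a b → Scalar (ω col a b)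
scalar-ω col a b = scalar-⊗ (pc col b) (ξ (a ℕ.+ b)) (scalar-pc col) (scalar-ξ (a ℕ.+ b))
  where
  scalar-pp : ∀ e → Scalar (if e then tV else oneP)
  scalar-pp true  = scalar-term (1 ∷ []) refl refl refl refl
  scalar-pp false = scalar-one
  scalar-pc : ∀ col → Scalar (pc col b)
  scalar-pc zero    = scalar-pp (evenᵇ b)
  scalar-pc (suc _) = scalar-one
  scalar-ξ : ∀ k → Scalar (ξ k)
  scalar-ξ zero    = scalar-zero
  scalar-ξ (suc k) = scalar-term (0 ∷ 0 ∷ 0 ∷ 0 ∷ 0 ∷ (List.replicate k 0 ++ (1 ∷ []))) refl refl refl refl

-- The arguments are the colour of the vertex and whether the half-edge leads to the
-- same colour (0) or to the other one (1).
kindOf : Fin 2 → Fin 2 → Kind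
kindOf zero    zero    = kw
kindOf zero    (suc _) = kz
kindOf (suc _) zero    = kb
kindOf (suc _) (suc _) = ky

kinds : ∀ {V} → Vec (Fin 2) V → Vec Kind (V ℕ.* 2)
kinds []       = []
kinds (c ∷ cs) = kindOf c zero ∷ kindOf c (suc zero) ∷ kinds cs

weightOf : ∀ {V} → Vec (Fin 2) V → Vec ℕ (V ℕ.* 2) → Poly
weightOf []       []          = oneP
weightOf (c ∷ cs) (a ∷ b ∷ α) = ω c a b ⊗ weightOf cs α

scalar-weightOf : ∀ {V} (cs : Vec (Fin 2) V) α → Scalar (weightOf cs α)
scalar-weightOf []       []          = scalar-one
scalar-weightOf (c ∷ cs) (a ∷ b ∷ α) = scalar-⊗ (ω c a b) (weightOf cs α) (scalar-ω c a b) (scalar-weightOf cs α)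

expSum₁ : ∀ n (Φ : Vec ℕ 1 → Poly) → expSum n Φ ≈ ι (inv (n !)) ⊗ Φ (n ∷ [])
expSum₁ zero    Φ = ≈-refl
expSum₁ (suc n) Φ = ≈-trans (conv-last n (λ a r → ι (inv (a !)) ⊗ expSum r (λ α → Φ (a ∷ α))))
  (P.+-congʳ (≈-trans (conv-cong n λ a r → P.zeroʳ (ι (inv (a !)))) (conv-0 n)))

powers : (x y : Poly) → Vec ℕ 2 → Poly
powers x y (a ∷ b ∷ []) = powP x a ⊗ powP y b

expSum₂ : ∀ n (Φ : Vec ℕ 2 → Poly) → expSum n Φ ≈ conv n (λ a b → ι (inv (a !)) ⊗ (ι (inv (b !)) ⊗ Φ (a ∷ b ∷ [])))
expSum₂ n Φ = conv-cong n λ a b → P.*-congˡ {ι (inv (a !))} (expSum₁ b (Φ ∘ (a ∷_)))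

num-suc-inv : ∀ n → num (suc n) ⊗ ι (inv (suc n !)) ≈ ι (inv (n !))
num-suc-inv n = ≈-trans (⊗-comm (num (suc n)) _) (ι-inv-! n)

-- The binomial theorem in divided powers: multiplication by x + y raises one of the two exponents,
-- which is the right side of Euler's identity. It serves the black half of `F`; the white half
-- already displays binomial coefficients and is treated by `inv-binomial`.
exp-binomial : ∀ x y n → ι (inv (n !)) ⊗ powP (x ⊕ y) n ≈ expSum n (powers x y)
exp-binomial x y zero    = P.*-congˡ {ι (inv 1)} (≈-sym (≈-trans (P.*-congʳ ι-1) (⊗-identityˡ _)))
exp-binomial x y (suc n) = cancel-num n (begin
  num (suc n) ⊗ (ι (inv (suc n !)) ⊗ ((x ⊕ y) ⊗ powP (x ⊕ y) n))
    ≈⟨ ⊗-assoc (num (suc n)) (ι (inv (suc n !))) _ ⟨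
  num (suc n) ⊗ ι (inv (suc n !)) ⊗ ((x ⊕ y) ⊗ powP (x ⊕ y) n)
    ≈⟨ P.*-congʳ (num-suc-inv n) ⟩
  ι (inv (n !)) ⊗ ((x ⊕ y) ⊗ powP (x ⊕ y) n)
    ≈⟨ x∙yz≈y∙xz (ι (inv (n !))) (x ⊕ y) _ ⟩
  (x ⊕ y) ⊗ (ι (inv (n !)) ⊗ powP (x ⊕ y) n)
    ≈⟨ P.*-congˡ {x ⊕ y} (exp-binomial x y n) ⟩
  (x ⊕ y) ⊗ expSum n (powers x y)
    ≈⟨ P.distribʳ (expSum n (powers x y)) x y ⟩
  x ⊗ expSum n (powers x y) ⊕ y ⊗ expSum n (powers x y)
    ≈⟨ ⊕-cong (expSum-⊗ˡ {2} n x (powers x y)) (expSum-⊗ˡ {2} n y (powers x y)) ⟨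
  expSum n (λ α → x ⊗ powers x y α) ⊕ expSum n (λ α → y ⊗ powers x y α)
    ≈⟨ ⊕-cong (expSum-cong {2} n x-inc) (expSum-cong {2} n y-inc) ⟩
  expSum n (powers x y ∘ inc zero) ⊕ expSum n (powers x y ∘ inc (suc zero))
    ≈⟨ P.+-congˡ {expSum n (powers x y ∘ inc zero)} (≈-sym (P.+-identityʳ (expSum n (powers x y ∘ inc (suc zero))))) ⟩
  ∑ (allFin 2) (λ i → expSum n (powers x y ∘ inc i))
    ≈⟨ euler {2} n (powers x y) ⟨
  num (suc n) ⊗ expSum (suc n) (powers x y) ∎)
  where
  open ≈-Reasoning
  open import Algebra.Properties.CommutativeSemigroup P.*-commutativeSemigroup using (x∙yz≈y∙xz)
  x-inc : ∀ α → x ⊗ powers x y α ≈ powers x y (inc zero α)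
  x-inc (a ∷ b ∷ []) = ≈-sym (⊗-assoc x (powP x a) (powP y b))
  y-inc : ∀ α → y ⊗ powers x y α ≈ powers x y (inc (suc zero) α)
  y-inc (a ∷ b ∷ []) = x∙yz≈y∙xz y (powP x a) (powP y b)

inv-binomial : ∀ {i n} → i ≤ n → inv (n !) ℚ.* fromℕ (n C i) ≡ inv (i !) ℚ.* inv ((n ∸ i) !)
inv-binomial {i} {n} i≤n = trans lhs (inv-* (i !) ((n ∸ i) !) {{i !≢0}} {{(n ∸ i) !≢0}})
  where
  d = i ! ℕ.* (n ∸ i) !
  instance
    d≢0 : ℕ.NonZero d
    d≢0 = ℕₚ.m*n≢0 (i !) ((n ∸ i) !) {{i !≢0}} {{(n ∸ i) !≢0}}
  C*d : (n C i) ℕ.* d ≡ n !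
  C*d = trans (cong (ℕ._* d) (nCk≡n!/k![n-k]! i≤n)) (DivMod.m/n*n≡m (k![n∸k]!∣n! i≤n))
  lhs : inv (n !) ℚ.* fromℕ (n C i) ≡ inv d
  lhs = invertible-unique (castᵠ d) (begin
    inv (n !) ℚ.* fromℕ (n C i) ℚ.* castᵠ d       ≡⟨ cong (λ q → inv (n !) ℚ.* q ℚ.* castᵠ d) (fromℕ≡cast (n C i)) ⟩
    inv (n !) ℚ.* castᵠ (n C i) ℚ.* castᵠ d       ≡⟨ ℚₚ.*-assoc (inv (n !)) (castᵠ (n C i)) (castᵠ d) ⟩
    inv (n !) ℚ.* (castᵠ (n C i) ℚ.* castᵠ d)     ≡⟨ cong (inv (n !) ℚ.*_) (trans (sym (castᵠ-* (n C i) d)) (cong castᵠ C*d)) ⟩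
    inv (n !) ℚ.* castᵠ (n !)                     ≡⟨ inv-nonZero (n !) {{n !≢0}} ⟩
    1ℚ ∎) (inv-nonZero d)
    where open ≡-Reasoning

vertexTerm : Fin 2 → ℕ → ℕ → Poly
vertexTerm col a b = powP (varOf (kindOf col zero)) a ⊗ powP (varOf (kindOf col (suc zero))) b ⊗ ω col a b

vertexSum : Fin 2 → ℕ → Poly
vertexSum col n = conv n (λ a b → ι (inv (a !)) ⊗ (ι (inv (b !)) ⊗ vertexTerm col a b))

ξ-⊗-vertex : ∀ col a b n → a ℕ.+ b ≡ n → ∀ r →
  ι (inv (a !)) ⊗ (ι (inv (b !)) ⊗ (powP (varOf (kindOf col zero)) a ⊗ powP (varOf (kindOf col (suc zero))) b ⊗ (r ⊗ ξ (a ℕ.+ b)))) ≈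
  ι (inv (a !)) ⊗ (ι (inv (b !)) ⊗ (powP (varOf (kindOf col zero)) a ⊗ powP (varOf (kindOf col (suc zero))) b ⊗ r)) ⊗ ξ n
ξ-⊗-vertex col a b .(a ℕ.+ b) refl r = solve 6 (λ i j x y r z → i :* (j :* (x :* y :* (r :* z))) := i :* (j :* (x :* y :* r)) :* z) ≈-refl
  (ι (inv (a !))) (ι (inv (b !))) (powP (varOf (kindOf col zero)) a) (powP (varOf (kindOf col (suc zero))) b) r (ξ (a ℕ.+ b))

-- A factor S is one vertex: F(n)/n! sums over its colour and over the ways its n half-edges divide
-- between the two sides, weighted by 1/(a! b!). In degree 0 both sides vanish because `ξ 0` is 0.
S≈ : ∀ n → S n ≈ ∑ (allFin 2) (λ col → vertexSum col n)
S≈ zero = ≈-sym (∑-zero (allFin 2) λ col → ≈-trans (P.*-congˡ {ι (inv 1)} (≈-trans (P.*-congˡ {ι (inv 1)}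
  (≈-trans (P.*-congˡ {powP (varOf (kindOf col zero)) 0 ⊗ powP (varOf (kindOf col (suc zero))) 0} (P.zeroʳ (pc col 0)))
    (P.zeroʳ (powP (varOf (kindOf col zero)) 0 ⊗ powP (varOf (kindOf col (suc zero))) 0)))) (P.zeroʳ (ι (inv 1))))) (P.zeroʳ (ι (inv 1))))
S≈ (suc k) = begin
  S n
    ≈⟨ scale≈ (inv (n !)) (F n ⊗ ξ n) ⟩
  ι (inv (n !)) ⊗ (F n ⊗ ξ n)
    ≈⟨ ⊗-assoc (ι (inv (n !))) (F n) (ξ n) ⟨
  ι (inv (n !)) ⊗ (B ⊕ W) ⊗ ξ n
    ≈⟨ P.*-congʳ (P.distribˡ (ι (inv (n !))) B W) ⟩
  (ι (inv (n !)) ⊗ B ⊕ ι (inv (n !)) ⊗ W) ⊗ ξ n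
    ≈⟨ P.distribʳ (ξ n) (ι (inv (n !)) ⊗ B) (ι (inv (n !)) ⊗ W) ⟩
  ι (inv (n !)) ⊗ B ⊗ ξ n ⊕ ι (inv (n !)) ⊗ W ⊗ ξ n
    ≈⟨ ⊕-cong black white ⟩
  vertexSum (suc zero) n ⊕ vertexSum zero n
    ≈⟨ ⊕-comm (vertexSum (suc zero) n) (vertexSum zero n) ⟩
  vertexSum zero n ⊕ vertexSum (suc zero) n
    ≈⟨ P.+-congˡ {vertexSum zero n} (P.+-identityʳ (vertexSum (suc zero) n)) ⟨
  ∑ (allFin 2) (λ col → vertexSum col n) ∎
  where
  open ≈-Reasoning
  n = suc k
  B = powP (bV ⊕ yV) n
  w-term : ℕ → Poly
  w-term i = scale (fromℕ (n C i)) (pp i ⊗ powP wV (n ∸ i) ⊗ powP zV i)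
  W = sumP n w-term
  black : ι (inv (n !)) ⊗ B ⊗ ξ n ≈ vertexSum (suc zero) n
  black = begin
    ι (inv (n !)) ⊗ B ⊗ ξ n
      ≈⟨ P.*-congʳ (≈-trans (exp-binomial bV yV n) (expSum₂ n (powers bV yV))) ⟩
    conv n (λ a b → ι (inv (a !)) ⊗ (ι (inv (b !)) ⊗ (powP bV a ⊗ powP yV b))) ⊗ ξ n
      ≈⟨ conv-⊗ʳ n (ξ n) (λ a b → ι (inv (a !)) ⊗ (ι (inv (b !)) ⊗ (powP bV a ⊗ powP yV b))) ⟨
    conv n (λ a b → ι (inv (a !)) ⊗ (ι (inv (b !)) ⊗ (powP bV a ⊗ powP yV b)) ⊗ ξ n)
      ≈⟨ conv-cong⁺ n (λ a b e → ≈-trans (P.*-congʳ (P.*-congˡ {ι (inv (a !))} (P.*-congˡ {ι (inv (b !))} (≈-sym (P.*-identityʳ (powP bV a ⊗ powP yV b))))))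
           (≈-sym (ξ-⊗-vertex (suc zero) a b n e oneP))) ⟩
    vertexSum (suc zero) n ∎
  white : ι (inv (n !)) ⊗ W ⊗ ξ n ≈ vertexSum zero n
  white = begin
    ι (inv (n !)) ⊗ W ⊗ ξ n
      ≈⟨ P.*-congʳ (≈-sym (sumP-⊗ˡ n (ι (inv (n !))) w-term)) ⟩
    sumP n (λ i → ι (inv (n !)) ⊗ w-term i) ⊗ ξ n
      ≈⟨ P.*-congʳ (sumP-cong⁺ n λ i i≤n → ≈-trans (P.*-congˡ {ι (inv (n !))} (scale≈ (fromℕ (n C i)) (pp i ⊗ powP wV (n ∸ i) ⊗ powP zV i)))
           (≈-trans (≈-sym (⊗-assoc (ι (inv (n !))) (ι (fromℕ (n C i))) _))
           (≈-trans (P.*-congʳ (≈-trans (≈-sym (ι-* (inv (n !)) (fromℕ (n C i)))) (≈-trans (≈-reflexive (cong ι (inv-binomial i≤n))) (ι-* (inv (i !)) (inv ((n ∸ i) !))))))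
             (solve 5 (λ i j p w z → (i :* j) :* (p :* w :* z) := j :* (i :* (w :* z :* p))) ≈-refl (ι (inv (i !))) (ι (inv ((n ∸ i) !))) (pp i) (powP wV (n ∸ i)) (powP zV i))))) ⟩
    -- The summation index of `F` is the exponent of z, hence the second argument of `g`; reversing
    -- the convolution restores the order used in `vertexSum`.
    sumP n (λ i → g (n ∸ i) i) ⊗ ξ n
      ≈⟨ P.*-congʳ (≈-trans (sumP-conv n (λ i j → g j i)) (conv-comm n (λ i j → g j i))) ⟩
    conv n g ⊗ ξ n
      ≈⟨ conv-⊗ʳ n (ξ n) g ⟨
    conv n (λ a b → g a b ⊗ ξ n)
      ≈⟨ conv-cong⁺ n (λ a b e → ≈-sym (ξ-⊗-vertex zero a b n e (pp b))) ⟩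
    vertexSum zero n ∎
    where
    g : ℕ → ℕ → Poly
    g a b = ι (inv (a !)) ⊗ (ι (inv (b !)) ⊗ (powP wV a ⊗ powP zV b ⊗ pp b))

colourings : ∀ V → List (Vec (Fin 2) V)
colourings V = vecs (allFin 2) V

-- Expanding the product chooses a colour and two exponents in each of the V factors; reassociating
-- the convolution of the new factor with the old ones gives two further steps of the recursion of
-- `expSum`.
powS≈ : ∀ V n → powS S V n ≈ ∑ (colourings V) (λ cs → expSum n (λ α → monomial (kinds cs) α ⊗ weightOf cs α))
powS≈ zero    zero    = ≈-refl
powS≈ zero    (suc n) = ≈-refl
powS≈ (suc V) n = begin
  powS S (suc V) n
    ≈⟨ powS-suc S V n ⟩
  conv n (λ i j → S i ⊗ powS S V j)
    ≈⟨ conv-cong n (λ i j → ≈-trans (⊗-cong (S≈ i) (powS≈ V j)) (≈-trans (≈-sym (∑-*ʳ (allFin 2) (∑ (colourings V) (λ cs → Q cs j)) (λ col → vertexSum col i)))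
         (∑-cong (allFin 2) λ col → ≈-sym (∑-*ˡ (colourings V) (vertexSum col i) (λ cs → Q cs j))))) ⟩
  conv n (λ i j → ∑ (allFin 2) (λ col → ∑ (colourings V) (λ cs → vertexSum col i ⊗ Q cs j)))
    ≈⟨ ≈-trans (conv-∑ n (allFin 2) (λ col i j → ∑ (colourings V) (λ cs → vertexSum col i ⊗ Q cs j)))
         (∑-cong (allFin 2) λ col → conv-∑ n (colourings V) (λ cs i j → vertexSum col i ⊗ Q cs j)) ⟩
  ∑ (allFin 2) (λ col → ∑ (colourings V) (λ cs → conv n (λ i j → vertexSum col i ⊗ Q cs j)))
    ≈⟨ ∑-cong (allFin 2) (λ col → ∑-cong (colourings V) λ cs → regroup col cs) ⟩
  ∑ (allFin 2) (λ col → ∑ (colourings V) (λ cs → expSum n (λ α → monomial (kinds (col ∷ cs)) α ⊗ weightOf (col ∷ cs) α)))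
    ≈⟨ ∑E.∑-vecs-suc (allFin 2) V (λ cs → expSum n (λ α → monomial (kinds cs) α ⊗ weightOf cs α)) ⟨
  ∑ (colourings (suc V)) (λ cs → expSum n (λ α → monomial (kinds cs) α ⊗ weightOf cs α)) ∎
  where
  open ≈-Reasoning
  Q : Vec (Fin 2) V → ℕ → Poly
  Q cs j = expSum j (λ α → monomial (kinds cs) α ⊗ weightOf cs α)
  regroup : ∀ col cs → conv n (λ i j → vertexSum col i ⊗ Q cs j) ≈ expSum n (λ α → monomial (kinds (col ∷ cs)) α ⊗ weightOf (col ∷ cs) α)
  regroup col cs = begin
    conv n (λ i j → vertexSum col i ⊗ Q cs j)
      ≈⟨ conv-cong n (λ i j → ≈-sym (conv-⊗ʳ i (Q cs j) (λ a b → ι (inv (a !)) ⊗ (ι (inv (b !)) ⊗ vertexTerm col a b)))) ⟩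
    conv n (λ i j → conv i (λ a b → ι (inv (a !)) ⊗ (ι (inv (b !)) ⊗ vertexTerm col a b) ⊗ Q cs j))
      ≈⟨ conv-assoc n (λ a b j → ι (inv (a !)) ⊗ (ι (inv (b !)) ⊗ vertexTerm col a b) ⊗ Q cs j) ⟩
    conv n (λ a k → conv k (λ b j → ι (inv (a !)) ⊗ (ι (inv (b !)) ⊗ vertexTerm col a b) ⊗ Q cs j))
      ≈⟨ conv-cong n (λ a k → ≈-trans (conv-cong k λ b j →
           ≈-trans (⊗-assoc (ι (inv (a !))) (ι (inv (b !)) ⊗ vertexTerm col a b) (Q cs j)) (P.*-congˡ {ι (inv (a !))}
           (≈-trans (⊗-assoc (ι (inv (b !))) (vertexTerm col a b) (Q cs j)) (P.*-congˡ {ι (inv (b !))}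
             (≈-trans (≈-sym (expSum-⊗ˡ {V ℕ.* 2} j (vertexTerm col a b) (λ α → monomial (kinds cs) α ⊗ weightOf cs α))) (expSum-cong {V ℕ.* 2} j λ α →
               solve 5 (λ x y w m r → (x :* y :* w) :* (m :* r) := (x :* (y :* m)) :* (w :* r)) ≈-refl
                 (powP (varOf (kindOf col zero)) a) (powP (varOf (kindOf col (suc zero))) b) (ω col a b) (monomial (kinds cs) α) (weightOf cs α)))))))
           (conv-⊗ˡ k (ι (inv (a !))) _)) ⟩
    expSum n (λ α → monomial (kinds (col ∷ cs)) α ⊗ weightOf (col ∷ cs) α) ∎

bw-conv : ∀ n f → bw (conv n f) ≈ conv n (λ i j → bw (f i j))
bw-conv zero    f = ≈-refl
bw-conv (suc n) f = ≈-trans (bw-⊕ (f 0 (suc n)) _) (P.+-congˡ {bw (f 0 (suc n))} (bw-conv n (f ∘ suc)))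

bw-sumP : ∀ n f → bw (sumP n f) ≈ sumP n (bw ∘ f)
bw-sumP zero    f = ≈-refl
bw-sumP (suc n) f = ≈-trans (bw-⊕ (sumP n f) (f (suc n))) (P.+-congʳ (bw-sumP n f))

bw-expSum : ∀ {L} n (Φ : Vec ℕ L → Poly) → bw (expSum n Φ) ≈ expSum n (bw ∘ Φ)
bw-expSum {zero}  zero    Φ = ≈-refl
bw-expSum {zero}  (suc n) Φ = ≈-refl
bw-expSum {suc L} n       Φ = ≈-trans (bw-conv n (λ a r → ι (inv (a !)) ⊗ expSum r (λ α → Φ (a ∷ α))))
  (conv-cong n λ a r → ≈-trans (bw-ι-⊗ (inv (a !)) (expSum r (λ α → Φ (a ∷ α)))) (P.*-congˡ {ι (inv (a !))} (bw-expSum r (Φ ∘ (a ∷_)))))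

bw-expS : ∀ n → bwS (expS S) n ≈ sumP n (λ V → ι (inv (V !)) ⊗ ∑ (colourings V) (λ cs → wick (kinds cs) n (weightOf cs)))
bw-expS n = ≈-trans (bw-sumP n _) (sumP-cong n λ V → begin
  bw (scale (inv (V !)) (powS S V n))
    ≈⟨ bw-cong (scale≈ (inv (V !)) (powS S V n)) ⟩
  bw (ι (inv (V !)) ⊗ powS S V n)
    ≈⟨ bw-ι-⊗ (inv (V !)) (powS S V n) ⟩
  ι (inv (V !)) ⊗ bw (powS S V n)
    ≈⟨ P.*-congˡ {ι (inv (V !))} (≈-trans (bw-cong (powS≈ V n)) (bw-∑ (colourings V) _)) ⟩
  ι (inv (V !)) ⊗ ∑ (colourings V) (λ cs → bw (expSum n (λ α → monomial (kinds cs) α ⊗ weightOf cs α)))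
    ≈⟨ P.*-congˡ {ι (inv (V !))} (∑-cong (colourings V) λ cs → ≈-trans (bw-expSum {V ℕ.* 2} n (λ α → monomial (kinds cs) α ⊗ weightOf cs α))
         (expSum-cong {V ℕ.* 2} n λ α → ≈-trans (scalar-weightOf cs α (monomial (kinds cs) α)) (P.*-congʳ (bw-monomial (kinds cs) α)))) ⟩
  ι (inv (V !)) ⊗ ∑ (colourings V) (λ cs → wick (kinds cs) n (weightOf cs)) ∎)
  where open ≈-Reasoning

-- From moments to graphs

Edges : ℕ → ℕ → Set
Edges V E = Vec (Fin V × Fin V) E

pairEnum : ∀ V → Enum (Fin V × Fin V)
pairEnum V = ×Enum (finEnum V) (finEnum V)

edgePairs : ∀ V → List (Fin V × Fin V)
edgePairs V = Enum.elems (pairEnum V)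

graphs : ∀ V E → List (Edges V E)
graphs V E = vecs (edgePairs V) E

∑-edgePairs : ∀ V f → ∑ (edgePairs V) f ≈ ∑ (allFin V) (λ x → ∑ (allFin V) (λ y → f (x , y)))
∑-edgePairs V f = ≈-trans (∑ₚ.∑-concatMap (λ a → List.map (a ,_) (allFin V)) (allFin V) f) (∑-cong (allFin V) λ x → ∑ₚ.∑-map (x ,_) (allFin V) f)

-- The half-edges of kind s at x form the variable idx x s.
idx : ∀ {V} → Fin V → Fin 2 → Fin (V ℕ.* 2)
idx zero    zero    = zero
idx zero    (suc _) = suc zero
idx (suc x) s       = suc (suc (idx x s))

∑-idx : ∀ V f → ∑ (allFin (V ℕ.* 2)) f ≈ ∑ (allFin V) (λ x → ∑ (allFin 2) (λ s → f (idx x s)))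
∑-idx zero    f = ≈-refl
∑-idx (suc V) f = begin
  ∑ (allFin (suc (suc (V ℕ.* 2)))) f
    ≈⟨ ∑ₚ.∑-allFin-suc (suc (V ℕ.* 2)) f ⟩
  f zero ⊕ ∑ (allFin (suc (V ℕ.* 2))) (f ∘ suc)
    ≈⟨ P.+-congˡ {f zero} (∑ₚ.∑-allFin-suc (V ℕ.* 2) (f ∘ suc)) ⟩
  f zero ⊕ (f (suc zero) ⊕ ∑ (allFin (V ℕ.* 2)) (λ i → f (suc (suc i))))
    ≈⟨ P.+-congˡ {f zero} (P.+-congˡ {f (suc zero)} (∑-idx V (λ i → f (suc (suc i))))) ⟩
  f zero ⊕ (f (suc zero) ⊕ rest)
    ≈⟨ P.+-assoc (f zero) (f (suc zero)) rest ⟨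
  (f zero ⊕ f (suc zero)) ⊕ rest
    ≈⟨ P.+-congʳ (P.+-congˡ {f zero} (≈-sym (P.+-identityʳ (f (suc zero))))) ⟩
  ∑ (allFin 2) (λ s → f (idx {suc V} zero s)) ⊕ rest
    ≈⟨ ∑ₚ.∑-allFin-suc V (λ x → ∑ (allFin 2) (λ s → f (idx x s))) ⟨
  ∑ (allFin (suc V)) (λ x → ∑ (allFin 2) (λ s → f (idx x s))) ∎
  where
  open ≈-Reasoning
  rest = ∑ (allFin V) (λ x → ∑ (allFin 2) (λ s → f (suc (suc (idx x s)))))

lookup-kinds : ∀ {V} (cs : Vec (Fin 2) V) x s → lookup (kinds cs) (idx x s) ≡ kindOf (lookup cs x) s
lookup-kinds (zero ∷ cs)     zero    zero    = refl
lookup-kinds (zero ∷ cs)     zero    (suc _) = refl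
lookup-kinds (suc c ∷ cs)    zero    zero    = refl
lookup-kinds (suc c ∷ cs)    zero    (suc _) = refl
lookup-kinds (c ∷ cs)        (suc x) s       = lookup-kinds cs x s

sideOf : Fin 2 → Fin 2 → Fin 2
sideOf zero    zero    = zero
sideOf zero    (suc _) = suc zero
sideOf (suc _) zero    = suc zero
sideOf (suc _) (suc _) = zero

side : ∀ {V} → Vec (Fin 2) V → Fin V → Fin V → Fin 2
side cs x y = sideOf (lookup cs x) (lookup cs y)

-- Between vertices of given colours exactly one pair of sides carries dual kinds, and it is the
-- same side at both ends: b with b or w with w for equal colours, y with z for different ones.
∑-dual : ∀ c d (T : Fin 2 → Fin 2 → Poly) →
  ∑ (allFin 2) (λ s → ∑ (allFin 2) (λ s′ → δ (kindOf d s′ == dual (kindOf c s)) ⊗ T s s′)) ≈ T (sideOf c d) (sideOf c d)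
∑-dual zero       zero       T = ≈-trans (P.+-identityʳ _) (≈-trans (P.+-identityʳ _) (⊗-identityˡ (T zero zero)))
∑-dual zero       (suc zero) T = ≈-trans (P.+-identityʳ _) (≈-trans (P.+-identityʳ _) (⊗-identityˡ (T (suc zero) (suc zero))))
∑-dual (suc zero) zero       T = ≈-trans (P.+-identityʳ _) (≈-trans (P.+-identityʳ _) (⊗-identityˡ (T (suc zero) (suc zero))))
∑-dual (suc zero) (suc zero) T = ≈-trans (P.+-identityʳ _) (≈-trans (P.+-identityʳ _) (⊗-identityˡ (T zero zero)))

∑-dual-pairs : ∀ {V} (cs : Vec (Fin 2) V) (T : Fin (V ℕ.* 2) → Fin (V ℕ.* 2) → Poly) →
  ∑ (allFin (V ℕ.* 2)) (λ i → ∑ (allFin (V ℕ.* 2)) (λ i′ → δ (lookup (kinds cs) i′ == dual (lookup (kinds cs) i)) ⊗ T i i′)) ≈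
  ∑ (edgePairs V) (λ { (x , y) → T (idx x (side cs x y)) (idx y (side cs x y)) })
∑-dual-pairs {V} cs T = begin
  ∑ (allFin (V ℕ.* 2)) (λ i → ∑ (allFin (V ℕ.* 2)) (λ i′ → δ (k i′ == dual (k i)) ⊗ T i i′))
    ≈⟨ ≈-trans (∑-idx V (λ i → ∑ (allFin (V ℕ.* 2)) (D′ i))) (∑-cong (allFin V) λ x → ∑-cong (allFin 2) {g = λ s → ∑ (allFin V) (λ y → ∑ (allFin 2) (λ s′ → D′ (idx x s) (idx y s′)))} λ s → ∑-idx V (D′ (idx x s))) ⟩
  ∑ (allFin V) (λ x → ∑ (allFin 2) (λ s → ∑ (allFin V) (λ y → ∑ (allFin 2) (λ s′ → δ (k (idx y s′) == dual (k (idx x s))) ⊗ T (idx x s) (idx y s′)))))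
    ≈⟨ ∑-cong (allFin V) (λ x → ∑-swap (allFin 2) (allFin V) (λ s y → ∑ (allFin 2) (λ s′ → D′ (idx x s) (idx y s′)))) ⟩
  ∑ (allFin V) (λ x → ∑ (allFin V) (λ y → ∑ (allFin 2) (λ s → ∑ (allFin 2) (λ s′ → δ (k (idx y s′) == dual (k (idx x s))) ⊗ T (idx x s) (idx y s′)))))
    ≈⟨ ∑-cong (allFin V) (λ x → ∑-cong (allFin V) λ y →
         ≈-trans (∑-cong (allFin 2) {g = λ s → ∑ (allFin 2) (λ s′ → δ (kindOf (lookup cs y) s′ == dual (kindOf (lookup cs x) s)) ⊗ T (idx x s) (idx y s′))}
             λ s → ∑-cong (allFin 2) {g = λ s′ → δ (kindOf (lookup cs y) s′ == dual (kindOf (lookup cs x) s)) ⊗ T (idx x s) (idx y s′)} λ s′ → P.*-congʳ (≈-reflexive (cong₂ (λ l l′ → δ (l′ == dual l)) (lookup-kinds cs x s) (lookup-kinds cs y s′))))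
           (∑-dual (lookup cs x) (lookup cs y) (λ s s′ → T (idx x s) (idx y s′)))) ⟩
  ∑ (allFin V) (λ x → ∑ (allFin V) (λ y → T (idx x (side cs x y)) (idx y (side cs x y))))
    ≈⟨ ∑-edgePairs V _ ⟨
  ∑ (edgePairs V) (λ { (x , y) → T (idx x (side cs x y)) (idx y (side cs x y)) }) ∎
  where
  open ≈-Reasoning
  k = lookup (kinds cs)
  D′ : Fin (V ℕ.* 2) → Fin (V ℕ.* 2) → Poly
  D′ i i′ = δ (k i′ == dual (k i)) ⊗ T i i′

halfEdges : ∀ {V E} → Vec (Fin 2) V → Edges V E → Vec ℕ (V ℕ.* 2)
halfEdges {V} cs []            = Vec.replicate (V ℕ.* 2) 0
halfEdges     cs ((x , y) ∷ g) = inc (idx x (side cs x y)) (inc (idx y (side cs x y)) (halfEdges cs g))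

edgeAut : ℕ → ℕ
edgeAut E = E ! ℕ.* 2 ^ E

edgeAut≢0 : ∀ E → ℕ.NonZero (edgeAut E)
edgeAut≢0 E = ℕₚ.m*n≢0 (E !) (2 ^ E) {{E !≢0}} {{ℕₚ.m^n≢0 2 E}}

num-edgeAut-suc : ∀ E → num (suc E ℕ.* 2) ⊗ ι (inv (edgeAut (suc E))) ≈ ι (inv (edgeAut E))
num-edgeAut-suc E = begin
  num (suc E ℕ.* 2) ⊗ ι (inv (edgeAut (suc E)))
    ≈⟨ P.*-congˡ {num (suc E ℕ.* 2)} (≈-reflexive (cong ι (trans (cong inv (solveℕ 3 (λ e f p → ((con 1 :+′ e) :*′ f) :*′ (con 2 :*′ p) :=′ ((con 1 :+′ e) :*′ con 2) :*′ (f :*′ p)) refl E (E !) (2 ^ E)))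
         (inv-* (suc E ℕ.* 2) (edgeAut E) {{_}} {{edgeAut≢0 E}})))) ⟩
  num (suc E ℕ.* 2) ⊗ ι (inv (suc E ℕ.* 2) ℚ.* inv (edgeAut E))
    ≈⟨ P.*-congˡ {num (suc E ℕ.* 2)} (ι-* (inv (suc E ℕ.* 2)) (inv (edgeAut E))) ⟩
  num (suc E ℕ.* 2) ⊗ (ι (inv (suc E ℕ.* 2)) ⊗ ι (inv (edgeAut E)))
    ≈⟨ ⊗-assoc (num (suc E ℕ.* 2)) (ι (inv (suc E ℕ.* 2))) (ι (inv (edgeAut E))) ⟨
  num (suc E ℕ.* 2) ⊗ ι (inv (suc E ℕ.* 2)) ⊗ ι (inv (edgeAut E))
    ≈⟨ P.*-congʳ (≈-trans (⊗-comm (num (suc E ℕ.* 2)) (ι (inv (suc E ℕ.* 2)))) (ι-inv-num (suc E ℕ.* 2))) ⟩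
  oneP ⊗ ι (inv (edgeAut E))
    ≈⟨ ⊗-identityˡ _ ⟩
  ι (inv (edgeAut E)) ∎
  where open ≈-Reasoning

-- Each application of `wick-suc-suc` splits off one edge with ordered ends and divides by the
-- current number of half-edges. The divisors 2E, 2E - 2, ..., 2 multiply to 2^E E!.
wick-even : ∀ {V} (cs : Vec (Fin 2) V) E (Φ : Vec ℕ (V ℕ.* 2) → Poly) →
  wick (kinds cs) (E ℕ.* 2) Φ ≈ ι (inv (edgeAut E)) ⊗ ∑ (graphs V E) (λ g → Φ (halfEdges cs g))
wick-even {V} cs zero    Φ = ≈-trans (wick-0 (kinds cs) Φ) (≈-sym (≈-trans (P.*-congʳ ι-1) (≈-trans (⊗-identityˡ _) (P.+-identityʳ _))))
wick-even {V} cs (suc E) Φ = cancel-num (suc (E ℕ.* 2)) (begin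
  num (suc E ℕ.* 2) ⊗ wick (kinds cs) (suc E ℕ.* 2) Φ
    ≈⟨ wick-suc-suc (kinds cs) (E ℕ.* 2) Φ ⟩
  ∑ (allFin (V ℕ.* 2)) (λ i → ∑ (allFin (V ℕ.* 2)) (λ i′ → δ (lookup (kinds cs) i′ == dual (lookup (kinds cs) i)) ⊗ T i i′))
    ≈⟨ ∑-dual-pairs cs T ⟩
  ∑ (edgePairs V) (λ { (x , y) → T (idx x (side cs x y)) (idx y (side cs x y)) })
    ≈⟨ ∑-cong (edgePairs V) (λ { (x , y) → wick-even cs E _ }) ⟩
  ∑ (edgePairs V) (λ e → ι (inv (edgeAut E)) ⊗ ∑ (graphs V E) (λ g → Φ (halfEdges cs (e ∷ g))))
    ≈⟨ ∑-*ˡ (edgePairs V) (ι (inv (edgeAut E))) _ ⟩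
  ι (inv (edgeAut E)) ⊗ ∑ (edgePairs V) (λ e → ∑ (graphs V E) (λ g → Φ (halfEdges cs (e ∷ g))))
    ≈⟨ P.*-congˡ {ι (inv (edgeAut E))} (∑E.∑-vecs-suc (edgePairs V) E (λ g → Φ (halfEdges cs g))) ⟨
  ι (inv (edgeAut E)) ⊗ ∑ (graphs V (suc E)) (λ g → Φ (halfEdges cs g))
    ≈⟨ P.*-congʳ (num-edgeAut-suc E) ⟨
  num (suc E ℕ.* 2) ⊗ ι (inv (edgeAut (suc E))) ⊗ ∑ (graphs V (suc E)) (λ g → Φ (halfEdges cs g))
    ≈⟨ ⊗-assoc (num (suc E ℕ.* 2)) (ι (inv (edgeAut (suc E)))) _ ⟩
  num (suc E ℕ.* 2) ⊗ (ι (inv (edgeAut (suc E))) ⊗ ∑ (graphs V (suc E)) (λ g → Φ (halfEdges cs g))) ∎)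
  where
  open ≈-Reasoning
  T : Fin (V ℕ.* 2) → Fin (V ℕ.* 2) → Poly
  T i i′ = wick (kinds cs) (E ℕ.* 2) (λ α → Φ (inc i (inc i′ α)))

wick-odd : ∀ {L} (ks : Vec Kind L) E Φ → wick ks (suc (E ℕ.* 2)) Φ ≈ zeroP
wick-odd ks     zero    Φ = wick-1 ks Φ
wick-odd {L} ks (suc E) Φ = cancel-num (suc (suc (E ℕ.* 2))) (≈-trans (wick-suc-suc ks (suc (E ℕ.* 2)) Φ)
  (≈-trans (∑-zero (allFin L) λ x → ∑-zero (allFin L) λ x′ →
    ≈-trans (P.*-congˡ {δ (lookup ks x′ == dual (lookup ks x))} (wick-odd ks E (λ α → Φ (inc x (inc x′ α)))))
      (P.zeroʳ (δ (lookup ks x′ == dual (lookup ks x)))))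
  (≈-sym (P.zeroʳ (num (suc (suc (suc (E ℕ.* 2)))))))))

graphWeight : ∀ {V E} → Edges V E → Poly
graphWeight {V} g = ∑ (colourings V) (λ cs → weightOf cs (halfEdges cs g))

-- V! E! 2^E is the order of the group permuting the vertices and permuting and
-- reversing the edges.
labelled : ∀ V E → (Edges V E → Poly) → Poly
labelled V E h = ι (inv (V !)) ⊗ (ι (inv (edgeAut E)) ⊗ ∑ (graphs V E) h)

bw-expS-even : ∀ E → bwS (expS S) (E ℕ.* 2) ≈ sumP (E ℕ.* 2) (λ V → labelled V E graphWeight)
bw-expS-even E = ≈-trans (bw-expS (E ℕ.* 2)) (sumP-cong (E ℕ.* 2) λ V → P.*-congˡ {ι (inv (V !))}
  (≈-trans (∑-cong (colourings V) λ cs → wick-even cs E (weightOf cs))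
  (≈-trans (∑-*ˡ (colourings V) (ι (inv (edgeAut E))) _) (P.*-congˡ {ι (inv (edgeAut E))} (∑-swap (colourings V) (graphs V E) _)))))

bw-expS-odd : ∀ E → bwS (expS S) (suc (E ℕ.* 2)) ≈ zeroP
bw-expS-odd E = ≈-trans (bw-expS (suc (E ℕ.* 2))) (sumP-0 (suc (E ℕ.* 2)) λ V _ →
  ≈-trans (P.*-congˡ {ι (inv (V !))} (∑-zero (colourings V) λ cs → wick-odd (kinds cs) E (weightOf cs))) (P.zeroʳ (ι (inv (V !)))))

-- The weight of a graph as a product over its vertices

=ᶠ-does : ∀ {n} (x y : Fin n) → (x =ᶠ y) ≡ does (x Fin.≟ y)
=ᶠ-does x y = isYes≗does (x Fin.≟ y)

=ᶠ-true : ∀ {n} {x y : Fin n} → (x =ᶠ y) ≡ true → x ≡ y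
=ᶠ-true {x = x} {y} e = ≡-true (x Fin.≟ y) (trans (sym (=ᶠ-does x y)) e)

=ᶠ-refl : ∀ {n} (x : Fin n) → (x =ᶠ x) ≡ true
=ᶠ-refl x = trans (=ᶠ-does x x) (dec-true (x Fin.≟ x) refl)

=ᶠ-inj : ∀ {m n} (f : Fin m → Fin n) → (∀ {x y} → f x ≡ f y → x ≡ y) → ∀ x y → (f x =ᶠ f y) ≡ (x =ᶠ y)
=ᶠ-inj f inj x y = bool-⇔ _ _ (λ e → trans (cong (x =ᶠ_) (sym (inj (=ᶠ-true e)))) (=ᶠ-refl x))
  (λ e → trans (cong (f x =ᶠ_) (cong f (sym (=ᶠ-true e)))) (=ᶠ-refl (f x)))

touches : ∀ {V} → Fin V × Fin V → Fin V → ℕ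
touches (a , b) x = b2n (a =ᶠ x) ℕ.+ b2n (b =ᶠ x)

halfCount : ∀ {V E} → Vec (Fin 2) V → Edges V E → Fin 2 → Fin V → ℕ
halfCount cs []            s x = 0
halfCount cs ((a , b) ∷ g) s x = b2n (side cs a b =ᶠ s) ℕ.* touches (a , b) x ℕ.+ halfCount cs g s x

lookup-inc : ∀ {L} (i j : Fin L) α → lookup (inc i α) j ≡ b2n (i =ᶠ j) ℕ.+ lookup α j
lookup-inc zero    zero    (a ∷ α) = refl
lookup-inc zero    (suc j) (a ∷ α) = refl
lookup-inc (suc i) zero    (a ∷ α) = refl
lookup-inc (suc i) (suc j) (a ∷ α) = trans (lookup-inc i j α) (cong (λ b → b2n b ℕ.+ lookup α j) (sym (=ᶠ-inj suc Finₚ.suc-injective i j)))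

idx-=ᶠ : ∀ {V} (x y : Fin V) s s′ → b2n (idx x s =ᶠ idx y s′) ≡ b2n (s =ᶠ s′) ℕ.* b2n (x =ᶠ y)
idx-=ᶠ zero    zero    zero       zero       = refl
idx-=ᶠ zero    zero    zero       (suc zero) = refl
idx-=ᶠ zero    zero    (suc zero) zero       = refl
idx-=ᶠ zero    zero    (suc zero) (suc zero) = refl
idx-=ᶠ zero    (suc y) zero       s′         = sym (ℕₚ.*-zeroʳ (b2n (zero =ᶠ s′)))
idx-=ᶠ zero    (suc y) (suc s)    s′         = sym (ℕₚ.*-zeroʳ (b2n (suc s =ᶠ s′)))
idx-=ᶠ (suc x) zero    s          zero       = sym (ℕₚ.*-zeroʳ (b2n (s =ᶠ zero)))
idx-=ᶠ (suc x) zero    s          (suc s′)   = sym (ℕₚ.*-zeroʳ (b2n (s =ᶠ suc s′)))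
idx-=ᶠ (suc x) (suc y) s          s′         = trans
  (cong b2n (trans (=ᶠ-inj suc Finₚ.suc-injective (suc (idx x s)) (suc (idx y s′))) (=ᶠ-inj suc Finₚ.suc-injective (idx x s) (idx y s′))))
  (trans (idx-=ᶠ x y s s′) (cong (λ b → b2n (s =ᶠ s′) ℕ.* b2n b) (sym (=ᶠ-inj suc Finₚ.suc-injective x y))))

lookup-halfEdges : ∀ {V E} (cs : Vec (Fin 2) V) (g : Edges V E) x s → lookup (halfEdges cs g) (idx x s) ≡ halfCount cs g s x
lookup-halfEdges cs []            x s = Vecₚ.lookup-replicate (idx x s) 0
lookup-halfEdges cs ((a , b) ∷ g) x s = begin
  lookup (inc (idx a σ) (inc (idx b σ) α)) (idx x s)
    ≡⟨ trans (lookup-inc (idx a σ) (idx x s) _) (cong (b2n (idx a σ =ᶠ idx x s) ℕ.+_) (lookup-inc (idx b σ) (idx x s) α)) ⟩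
  b2n (idx a σ =ᶠ idx x s) ℕ.+ (b2n (idx b σ =ᶠ idx x s) ℕ.+ lookup α (idx x s))
    ≡⟨ cong₂ ℕ._+_ (idx-=ᶠ a x σ s) (cong₂ ℕ._+_ (idx-=ᶠ b x σ s) (lookup-halfEdges cs g x s)) ⟩
  b2n (σ =ᶠ s) ℕ.* b2n (a =ᶠ x) ℕ.+ (b2n (σ =ᶠ s) ℕ.* b2n (b =ᶠ x) ℕ.+ halfCount cs g s x)
    ≡⟨ solveℕ 4 (λ p q r h → p :*′ q :+′ (p :*′ r :+′ h) :=′ p :*′ (q :+′ r) :+′ h) refl (b2n (σ =ᶠ s)) (b2n (a =ᶠ x)) (b2n (b =ᶠ x)) (halfCount cs g s x) ⟩
  b2n (σ =ᶠ s) ℕ.* touches (a , b) x ℕ.+ halfCount cs g s x ∎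
  where
  open ≡-Reasoning
  σ = side cs a b
  α = halfEdges cs g

weightOf-∏ : ∀ {V} (cs : Vec (Fin 2) V) α →
  weightOf cs α ≈ ∏ V (λ x → ω (lookup cs x) (lookup α (idx x zero)) (lookup α (idx x (suc zero))))
weightOf-∏ []       []          = ≈-refl
weightOf-∏ (c ∷ cs) (a ∷ b ∷ α) = P.*-congˡ {ω c a b} (weightOf-∏ cs α)

vertexWeight : ∀ {V E} → Vec (Fin 2) V → Edges V E → Fin V → Poly
vertexWeight cs g x = ω (lookup cs x) (halfCount cs g zero x) (halfCount cs g (suc zero) x)

graphWeight≈ : ∀ {V E} (g : Edges V E) → graphWeight g ≈ ∑ (colourings V) (λ cs → ∏ V (vertexWeight cs g))
graphWeight≈ {V} g = ∑-cong (colourings V) λ cs → ≈-trans (weightOf-∏ cs (halfEdges cs g)) (∏-cong V λ x →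
  ≈-reflexive (cong₂ (ω (lookup cs x)) (lookup-halfEdges cs g x zero) (lookup-halfEdges cs g x (suc zero))))

-- Splitting along a subset of indices

#T #F : ∀ {n} → Vec Bool n → ℕ
#T []          = 0
#T (true  ∷ U) = suc (#T U)
#T (false ∷ U) = #T U
#F []          = 0
#F (true  ∷ U) = #F U
#F (false ∷ U) = suc (#F U)

inT : ∀ {n} (U : Vec Bool n) → Fin (#T U) → Fin n
inT (true  ∷ U) zero    = zero
inT (true  ∷ U) (suc i) = suc (inT U i)
inT (false ∷ U) i       = suc (inT U i)

inF : ∀ {n} (U : Vec Bool n) → Fin (#F U) → Fin n
inF (true  ∷ U) i       = suc (inF U i)
inF (false ∷ U) zero    = zero
inF (false ∷ U) (suc i) = suc (inF U i)

merge : ∀ {A : Set} {n} (U : Vec Bool n) → Vec A (#T U) → Vec A (#F U) → Vec A n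
merge []          []      []      = []
merge (true  ∷ U) (a ∷ p) q       = a ∷ merge U p q
merge (false ∷ U) p       (b ∷ q) = b ∷ merge U p q

data Split {n} (U : Vec Bool n) : Fin n → Set where
  isT : ∀ i → Split U (inT U i)
  isF : ∀ i → Split U (inF U i)

split : ∀ {n} (U : Vec Bool n) i → Split U i
split (true  ∷ U) zero = isT zero
split (false ∷ U) zero = isF zero
split (true  ∷ U) (suc i) with split U i
... | isT j = isT (suc j)
... | isF j = isF j
split (false ∷ U) (suc i) with split U i
... | isT j = isT j
... | isF j = isF (suc j)

lookup-inT : ∀ {n} (U : Vec Bool n) i → lookup U (inT U i) ≡ true
lookup-inT (true  ∷ U) zero    = refl
lookup-inT (true  ∷ U) (suc i) = lookup-inT U i
lookup-inT (false ∷ U) i       = lookup-inT U i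

lookup-inF : ∀ {n} (U : Vec Bool n) i → lookup U (inF U i) ≡ false
lookup-inF (true  ∷ U) i       = lookup-inF U i
lookup-inF (false ∷ U) zero    = refl
lookup-inF (false ∷ U) (suc i) = lookup-inF U i

inT-injective : ∀ {n} (U : Vec Bool n) {i j} → inT U i ≡ inT U j → i ≡ j
inT-injective (true  ∷ U) {zero}  {zero}  e = refl
inT-injective (true  ∷ U) {suc i} {suc j} e = cong suc (inT-injective U (Finₚ.suc-injective e))
inT-injective (false ∷ U) e = inT-injective U (Finₚ.suc-injective e)

inF-injective : ∀ {n} (U : Vec Bool n) {i j} → inF U i ≡ inF U j → i ≡ j
inF-injective (true  ∷ U) e = inF-injective U (Finₚ.suc-injective e)
inF-injective (false ∷ U) {zero}  {zero}  e = refl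
inF-injective (false ∷ U) {suc i} {suc j} e = cong suc (inF-injective U (Finₚ.suc-injective e))

inT≢inF : ∀ {n} (U : Vec Bool n) i j → inT U i ≢ inF U j
inT≢inF U i j e = contradiction (trans (sym (lookup-inT U i)) (trans (cong (lookup U) e) (lookup-inF U j))) λ ()

lookup-merge-inT : ∀ {A : Set} {n} (U : Vec Bool n) (p : Vec A (#T U)) q i → lookup (merge U p q) (inT U i) ≡ lookup p i
lookup-merge-inT (true  ∷ U) (a ∷ p) q       zero    = refl
lookup-merge-inT (true  ∷ U) (a ∷ p) q       (suc i) = lookup-merge-inT U p q i
lookup-merge-inT (false ∷ U) p       (b ∷ q) i       = lookup-merge-inT U p q i

lookup-merge-inF : ∀ {A : Set} {n} (U : Vec Bool n) (p : Vec A (#T U)) q i → lookup (merge U p q) (inF U i) ≡ lookup q i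
lookup-merge-inF (true  ∷ U) (a ∷ p) q       i       = lookup-merge-inF U p q i
lookup-merge-inF (false ∷ U) p       (b ∷ q) zero    = refl
lookup-merge-inF (false ∷ U) p       (b ∷ q) (suc i) = lookup-merge-inF U p q i

∑-split : ∀ {n} (U : Vec Bool n) f → ∑ (allFin n) f ≈ ∑ (allFin (#T U)) (f ∘ inT U) ⊕ ∑ (allFin (#F U)) (f ∘ inF U)
∑-split []                  f = ≈-refl
∑-split {suc n} (true  ∷ U) f = begin
  ∑ (allFin (suc n)) f           ≈⟨ ∑ₚ.∑-allFin-suc n f ⟩
  f zero ⊕ ∑ (allFin n) (f ∘ suc) ≈⟨ P.+-congˡ {f zero} (∑-split U (f ∘ suc)) ⟩
  f zero ⊕ (t ⊕ u)               ≈⟨ P.+-assoc (f zero) t u ⟨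
  f zero ⊕ t ⊕ u                 ≈⟨ P.+-congʳ (∑ₚ.∑-allFin-suc (#T U) (f ∘ inT (true ∷ U))) ⟨
  ∑ (allFin (suc (#T U))) (f ∘ inT (true ∷ U)) ⊕ u ∎
  where
  open ≈-Reasoning
  t = ∑ (allFin (#T U)) (f ∘ suc ∘ inT U)
  u = ∑ (allFin (#F U)) (f ∘ suc ∘ inF U)
∑-split {suc n} (false ∷ U) f = begin
  ∑ (allFin (suc n)) f           ≈⟨ ∑ₚ.∑-allFin-suc n f ⟩
  f zero ⊕ ∑ (allFin n) (f ∘ suc) ≈⟨ P.+-congˡ {f zero} (∑-split U (f ∘ suc)) ⟩
  f zero ⊕ (t ⊕ u)               ≈⟨ x∙yz≈y∙xz (f zero) t u ⟩
  t ⊕ (f zero ⊕ u)               ≈⟨ P.+-congˡ {t} (∑ₚ.∑-allFin-suc (#F U) (f ∘ inF (false ∷ U))) ⟨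
  t ⊕ ∑ (allFin (suc (#F U))) (f ∘ inF (false ∷ U)) ∎
  where
  open ≈-Reasoning
  open import Algebra.Properties.CommutativeSemigroup P.+-commutativeSemigroup using (x∙yz≈y∙xz)
  t = ∑ (allFin (#T U)) (f ∘ suc ∘ inT U)
  u = ∑ (allFin (#F U)) (f ∘ suc ∘ inF U)

∏-split : ∀ {n} (U : Vec Bool n) f → ∏ n f ≈ ∏ (#T U) (f ∘ inT U) ⊗ ∏ (#F U) (f ∘ inF U)
∏-split []          f = ≈-refl
∏-split (true  ∷ U) f = ≈-trans (P.*-congˡ {f zero} (∏-split U (f ∘ suc)))
  (≈-sym (⊗-assoc (f zero) (∏ (#T U) (f ∘ suc ∘ inT U)) (∏ (#F U) (f ∘ suc ∘ inF U))))
∏-split (false ∷ U) f = ≈-trans (P.*-congˡ {f zero} (∏-split U (f ∘ suc)))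
  (x∙yz≈y∙xz (f zero) (∏ (#T U) (f ∘ suc ∘ inT U)) (∏ (#F U) (f ∘ suc ∘ inF U)))
  where open import Algebra.Properties.CommutativeSemigroup P.*-commutativeSemigroup using (x∙yz≈y∙xz)

∑-merge : ∀ {A : Set} (as : List A) {n} (U : Vec Bool n) f →
  ∑ (vecs as n) f ≈ ∑ (vecs as (#T U)) (λ p → ∑ (vecs as (#F U)) (λ q → f (merge U p q)))
∑-merge as []                  f = ≈-sym (P.+-identityʳ _)
∑-merge as {suc n} (true  ∷ U) f = ≈-trans (∑E.∑-vecs-suc as n f) (≈-trans (∑-cong as λ a → ∑-merge as U (f ∘ (a ∷_)))
  (≈-sym (∑E.∑-vecs-suc as (#T U) (λ p → ∑ (vecs as (#F U)) (λ q → f (merge (true ∷ U) p q))))))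
∑-merge as {suc n} (false ∷ U) f = ≈-trans (∑E.∑-vecs-suc as n f) (≈-trans (∑-cong as λ a → ∑-merge as U (f ∘ (a ∷_)))
  (≈-trans (∑-swap as (vecs as (#T U)) (λ a p → ∑ (vecs as (#F U)) (λ q → f (a ∷ merge U p q))))
  (∑-cong (vecs as (#T U)) λ p → ≈-sym (∑E.∑-vecs-suc as (#F U) (λ q → f (merge (false ∷ U) p q))))))

masks : ∀ n → List (Vec Bool n)
masks n = vecs (false ∷ true ∷ []) n

maskEnum : ∀ n → Enum (Vec Bool n)
maskEnum n = vecEnum boolEnum n

-- There are n!/(a! b!) masks with `a` entries true and `b` false. The first entry raises one of the
-- two sizes, so Euler's identity applies as in the binomial theorem.
∑-masks : ∀ n (f : ℕ → ℕ → Poly) →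
  ι (inv (n !)) ⊗ ∑ (masks n) (λ U → f (#T U) (#F U)) ≈ conv n (λ a b → ι (inv (a !)) ⊗ (ι (inv (b !)) ⊗ f a b))
∑-masks n f = ≈-trans (go n f) (expSum₂ n (Φ f))
  where
  open ≈-Reasoning
  Φ : (ℕ → ℕ → Poly) → Vec ℕ 2 → Poly
  Φ f (a ∷ b ∷ []) = f a b
  go : ∀ n f → ι (inv (n !)) ⊗ ∑ (masks n) (λ U → f (#T U) (#F U)) ≈ expSum n (Φ f)
  go zero    f = P.*-congˡ {ι (inv 1)} (≈-trans (P.+-identityʳ (f 0 0)) (≈-sym (≈-trans (P.*-congʳ ι-1) (⊗-identityˡ (f 0 0)))))
  go (suc n) f = cancel-num n (begin
    num (suc n) ⊗ (ι (inv (suc n !)) ⊗ ∑ (masks (suc n)) (λ U → f (#T U) (#F U)))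
      ≈⟨ ⊗-assoc (num (suc n)) (ι (inv (suc n !))) _ ⟨
    num (suc n) ⊗ ι (inv (suc n !)) ⊗ ∑ (masks (suc n)) (λ U → f (#T U) (#F U))
      ≈⟨ ⊗-cong (num-suc-inv n) (≈-trans (∑E.∑-vecs-suc (false ∷ true ∷ []) n (λ U → f (#T U) (#F U))) (≈-trans (P.+-congˡ {y} (P.+-identityʳ x)) (⊕-comm y x))) ⟩
    ι (inv (n !)) ⊗ (x ⊕ y)
      ≈⟨ P.distribˡ (ι (inv (n !))) x y ⟩
    ι (inv (n !)) ⊗ x ⊕ ι (inv (n !)) ⊗ y
      ≈⟨ ⊕-cong (≈-trans (go n (λ a b → f (suc a) b)) (expSum-cong {2} n {Φ (λ a b → f (suc a) b)} {Φ f ∘ inc zero} λ { (a ∷ b ∷ []) → ≈-refl }))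
           (≈-trans (go n (λ a b → f a (suc b))) (expSum-cong {2} n {Φ (λ a b → f a (suc b))} {Φ f ∘ inc (suc zero)} λ { (a ∷ b ∷ []) → ≈-refl })) ⟩
    expSum n (Φ f ∘ inc zero) ⊕ expSum n (Φ f ∘ inc (suc zero))
      ≈⟨ P.+-congˡ {expSum n (Φ f ∘ inc zero)} (≈-sym (P.+-identityʳ (expSum n (Φ f ∘ inc (suc zero))))) ⟩
    ∑ (allFin 2) (λ i → expSum n (Φ f ∘ inc i))
      ≈⟨ euler {2} n (Φ f) ⟨
    num (suc n) ⊗ expSum (suc n) (Φ f) ∎)
    where
    x = ∑ (masks n) (λ U → f (suc (#T U)) (#F U))
    y = ∑ (masks n) (λ U → f (#T U) (suc (#F U)))

-- Components

toGraph : ∀ {V E} → Edges V E → Graph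
toGraph {V} {E} g = record { nv = V ; ne = E ; ends = lookup g }

reach-trans : ∀ {G x y z} → Reach G x y → Reach G y z → Reach G x z
reach-trans here      q = q
reach-trans (fwd e p) q = fwd e (reach-trans p q)
reach-trans (bwd e p) q = bwd e (reach-trans p q)

reach-sym : ∀ {G x y} → Reach G x y → Reach G y x
reach-sym here      = here
reach-sym (fwd e p) = reach-trans (reach-sym p) (bwd e here)
reach-sym (bwd e p) = reach-trans (reach-sym p) (fwd e here)

Closed : ∀ {V E} → Edges V E → Vec Bool V → Set
Closed {V} {E} g U = ∀ e → lookup U (proj₁ (lookup g e)) ≡ lookup U (proj₂ (lookup g e))

closed-reach : ∀ {V E} (g : Edges V E) U → Closed g U → ∀ {x y} → Reach (toGraph g) x y → lookup U x ≡ lookup U y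
closed-reach g U c here      = refl
closed-reach g U c (fwd e p) = trans (c e) (closed-reach g U c p)
closed-reach g U c (bwd e p) = trans (sym (c e)) (closed-reach g U c p)

closed? : ∀ {V E} (g : Edges V E) U →
  Closed g U ⊎ (∃ λ e → lookup U (proj₁ (lookup g e)) ≢ lookup U (proj₂ (lookup g e)))
closed? []      U = inj₁ λ ()
closed? (e ∷ g) U with lookup U (proj₁ e) Bool.≟ lookup U (proj₂ e) | closed? g U
... | no ≢   | _             = inj₂ (zero , ≢)
... | yes eq | inj₁ c        = inj₁ λ { zero → eq ; (suc i) → c i }
... | yes eq | inj₂ (i , ≢)  = inj₂ (suc i , ≢)

#F-insert : ∀ {n} (U : Vec Bool n) i → lookup U i ≡ false → #F U ≡ suc (#F (U Vec.[ i ]≔ true))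
#F-insert (false ∷ U) zero    e = refl
#F-insert (true  ∷ U) (suc i) e = #F-insert U i e
#F-insert (false ∷ U) (suc i) e = cong suc (#F-insert U i e)

IsComponent : ∀ {V E} → Edges V E → Fin V → Vec Bool V → Set
IsComponent g x U = Closed g U × lookup U x ≡ true × (∀ y → lookup U y ≡ true → Reach (toGraph g) x y)

-- Grow a set of vertices reachable from x until no edge leaves it.
component : ∀ {V E} (g : Edges V E) x → ∃ (IsComponent g x)
component {V} g x = grow (#F U₀) U₀ refl (Vecₚ.lookup∘updateAt x (Vec.replicate V false)) start
  where
  U₀ : Vec Bool V
  U₀ = Vec.replicate V false Vec.[ x ]≔ true
  Inside : Vec Bool V → Set
  Inside U = ∀ y → lookup U y ≡ true → Reach (toGraph g) x y
  insert-inside : ∀ U z → Inside U → Reach (toGraph g) x z → Inside (U Vec.[ z ]≔ true)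
  insert-inside U z ins r y e with y Fin.≟ z
  ... | yes refl = r
  ... | no  y≢z  = ins y (trans (sym (Vecₚ.lookup∘updateAt′ y z y≢z U)) e)
  start : Inside U₀
  start = insert-inside (Vec.replicate V false) x (λ y e → contradiction (trans (sym e) (Vecₚ.lookup-replicate y false)) λ ()) here
  insert-member : ∀ U z → lookup U x ≡ true → lookup (U Vec.[ z ]≔ true) x ≡ true
  insert-member U z e with x Fin.≟ z
  ... | yes refl = Vecₚ.lookup∘updateAt z U
  ... | no  x≢z  = trans (Vecₚ.lookup∘updateAt′ x z x≢z U) e
  -- The recursion is on the number `n` of vertices still outside `U`, which every extension lowers
  -- by one; at `n = 0` no vertex is left to add.
  grow : ∀ n U → #F U ≡ n → lookup U x ≡ true → Inside U → ∃ (IsComponent g x)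
  extend : ∀ n U → #F U ≡ n → lookup U x ≡ true → Inside U → ∀ z → lookup U z ≡ false → Reach (toGraph g) x z → ∃ (IsComponent g x)
  grow n U en ex ins with closed? g U
  ... | inj₁ c       = U , c , ex , ins
  ... | inj₂ (e , ≢) with lookup U (proj₁ (lookup g e)) in ea | lookup U (proj₂ (lookup g e)) in eb
  ...   | true  | true  = contradiction refl ≢
  ...   | false | false = contradiction refl ≢
  ...   | true  | false = extend n U en ex ins _ eb (reach-trans (ins _ ea) (fwd e here))
  ...   | false | true  = extend n U en ex ins _ ea (reach-trans (ins _ eb) (bwd e here))
  extend zero    U en ex ins z ez r = contradiction (trans (sym en) (#F-insert U z ez)) λ ()
  extend (suc n) U en ex ins z ez r = grow n (U Vec.[ z ]≔ true) (ℕₚ.suc-injective (trans (sym (#F-insert U z ez)) en))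
    (insert-member U z ex) (insert-inside U z ins r)

comp : ∀ {V E} → Edges V E → Fin V → Vec Bool V
comp g x = proj₁ (component g x)

lookup-ext : ∀ {A : Set} {n} (u v : Vec A n) → (∀ i → lookup u i ≡ lookup v i) → u ≡ v
lookup-ext u v e = trans (sym (Vecₚ.tabulate∘lookup u)) (trans (Vecₚ.tabulate-cong e) (Vecₚ.tabulate∘lookup v))

-- Both sets are closed and consist of vertices reachable from `x`, so each contains the other.
component-unique : ∀ {V E} (g : Edges V E) x U → IsComponent g x U → U ≡ comp g x
component-unique g x U (c , ex , ins) with component g x
... | U′ , c′ , ex′ , ins′ = lookup-ext U U′ λ y → bool-⇔ _ _
  (λ e → trans (sym (closed-reach g U′ c′ (ins y e))) ex′)
  (λ e → trans (sym (closed-reach g U c (ins′ y e))) ex)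

connected? : ∀ {V E} (g : Edges V E) → Dec (Connected (toGraph g))
connected? {zero}  g = no λ { (() , _) }
connected? {suc V} g with component g zero
... | U , c , ex , ins with Vecₚ.≡-dec Bool._≟_ U (Vec.replicate (suc V) true)
...   | yes refl = yes (zero , λ x y → reach-trans (reach-sym (ins x (Vecₚ.lookup-replicate x true))) (ins y (Vecₚ.lookup-replicate y true)))
...   | no  U≢   = no λ { (_ , r) → U≢ (lookup-ext U _ λ i → trans (sym (closed-reach g U c (r zero i))) (trans ex (sym (Vecₚ.lookup-replicate i true)))) }

both : ∀ {m n} → (Fin m → Fin n) → Fin m × Fin m → Fin n × Fin n
both f (a , b) = f a , f b

glue : ∀ {V E} (U : Vec Bool V) (K : Vec Bool E) → Edges (#T U) (#T K) → Edges (#F U) (#F K) → Edges V E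
glue U K g₁ g₂ = merge K (Vec.map (both (inT U)) g₁) (Vec.map (both (inF U)) g₂)

module _ {V E} (U : Vec Bool V) (K : Vec Bool E) (g₁ : Edges (#T U) (#T K)) (g₂ : Edges (#F U) (#F K)) where
  private g = glue U K g₁ g₂

  lookup-glue-inT : ∀ e → lookup g (inT K e) ≡ both (inT U) (lookup g₁ e)
  lookup-glue-inT e = trans (lookup-merge-inT K _ _ e) (Vecₚ.lookup-map e (both (inT U)) g₁)

  lookup-glue-inF : ∀ e → lookup g (inF K e) ≡ both (inF U) (lookup g₂ e)
  lookup-glue-inF e = trans (lookup-merge-inF K _ _ e) (Vecₚ.lookup-map e (both (inF U)) g₂)

  glue-closed : Closed g U
  glue-closed e with split K e
  ... | isT i rewrite lookup-glue-inT i = trans (lookup-inT U _) (sym (lookup-inT U _))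
  ... | isF i rewrite lookup-glue-inF i = trans (lookup-inF U _) (sym (lookup-inF U _))

  reach-up : ∀ {a b} → Reach (toGraph g₁) a b → Reach (toGraph g) (inT U a) (inT U b)
  reach-up here      = here
  reach-up (fwd e p) = reach-trans (subst (λ q → Reach (toGraph g) (proj₁ q) (proj₂ q)) (lookup-glue-inT e) (fwd (inT K e) here)) (reach-up p)
  reach-up (bwd e p) = reach-trans (subst (λ q → Reach (toGraph g) (proj₂ q) (proj₁ q)) (lookup-glue-inT e) (bwd (inT K e) here)) (reach-up p)

  -- A path starting in `U` meets only edges of `K`, since an edge outside `K` has both ends outside
  -- `U`. The end points are described by equations because the intermediate vertices of a path are
  -- not given as images under `inT`.
  reach-down : ∀ {x y} → Reach (toGraph g) x y → ∀ a b → x ≡ inT U a → y ≡ inT U b → Reach (toGraph g₁) a b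
  step-down : ∀ {x x′ y} e → lookup g e ≡ (x , x′) ⊎ lookup g e ≡ (x′ , x) → Reach (toGraph g) x′ y → ∀ a b → x ≡ inT U a → y ≡ inT U b → Reach (toGraph g₁) a b
  reach-down here      a b ex ey = subst (Reach (toGraph g₁) a) (inT-injective U (trans (sym ex) ey)) here
  reach-down (fwd e p) a b ex ey = step-down e (inj₁ refl) p a b ex ey
  reach-down (bwd e p) a b ex ey = step-down e (inj₂ refl) p a b ex ey
  step-down e eq p a b ex ey with split K e
  step-down .(inT K i) (inj₁ eq) p a b ex ey | isT i =
    let q = trans (sym (lookup-glue-inT i)) eq
        r = reach-down p (proj₂ (lookup g₁ i)) b (sym (cong proj₂ q)) ey
    in subst (λ a → Reach (toGraph g₁) a b) (inT-injective U (trans (cong proj₁ q) ex)) (fwd i r)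
  step-down .(inT K i) (inj₂ eq) p a b ex ey | isT i =
    let q = trans (sym (lookup-glue-inT i)) eq
        r = reach-down p (proj₁ (lookup g₁ i)) b (sym (cong proj₁ q)) ey
    in subst (λ a → Reach (toGraph g₁) a b) (inT-injective U (trans (cong proj₂ q) ex)) (bwd i r)
  step-down .(inF K i) (inj₁ eq) p a b ex ey | isF i = ⊥-elim (inT≢inF U a _ (sym (trans (cong proj₁ (trans (sym (lookup-glue-inF i)) eq)) ex)))
  step-down .(inF K i) (inj₂ eq) p a b ex ey | isF i = ⊥-elim (inT≢inF U a _ (sym (trans (cong proj₂ (trans (sym (lookup-glue-inF i)) eq)) ex)))

  component-glue : ∀ x → IsComponent g (inT U x) U → Connected (toGraph g₁)
  component-glue x (c , _ , ins) = x , λ y z →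
    reach-trans (reach-sym (reach-down (ins _ (lookup-inT U y)) x y refl refl)) (reach-down (ins _ (lookup-inT U z)) x z refl refl)

  glue-component : ∀ x → Connected (toGraph g₁) → IsComponent g (inT U x) U
  glue-component x (_ , r) = glue-closed , lookup-inT U x , inside
    where
    inside : ∀ y → lookup U y ≡ true → Reach (toGraph g) (inT U x) y
    inside y e with split U y
    ... | isT i = reach-up (r x i)
    ... | isF i = contradiction (trans (sym e) (lookup-inF U i)) λ ()

  -- Trades a condition on the whole graph, that `U` is the component of a given vertex, for one on
  -- the first part alone, so that the sum over the two parts factors.
  comp-glue : ∀ x → does (Vecₚ.≡-dec Bool._≟_ U (comp g (inT U x))) ≡ does (connected? g₁)
  comp-glue x = does-⇔ (Vecₚ.≡-dec Bool._≟_ U (comp g (inT U x))) (connected? g₁)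
    (λ e → component-glue x (subst (IsComponent g (inT U x)) (sym e) (proj₂ (component g (inT U x)))))
    (λ c → component-unique g (inT U x) U (glue-component x c))

-- Sums over graphs that decompose along a vertex set

∑-edgePairs-split : ∀ {V} (U : Vec Bool V) f → (∀ x y → lookup U x ≢ lookup U y → f (x , y) ≈ zeroP) →
  ∑ (edgePairs V) f ≈ ∑ (edgePairs (#T U)) (f ∘ both (inT U)) ⊕ ∑ (edgePairs (#F U)) (f ∘ both (inF U))
∑-edgePairs-split {V} U f cross = begin
  ∑ (edgePairs V) f
    ≈⟨ ∑-edgePairs V f ⟩
  ∑ (allFin V) (λ x → ∑ (allFin V) (λ y → f (x , y)))
    ≈⟨ ∑-split U (λ x → ∑ (allFin V) (λ y → f (x , y))) ⟩
  ∑ Ts (λ a → ∑ (allFin V) (λ y → f (inT U a , y))) ⊕ ∑ Fs (λ a → ∑ (allFin V) (λ y → f (inF U a , y)))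
    ≈⟨ ⊕-cong (∑-cong Ts λ a → ≈-trans (∑-split U (λ y → f (inT U a , y)))
          (≈-trans (P.+-congˡ {∑ Ts (λ b → f (inT U a , inT U b))} (∑-zero Fs λ b → cross (inT U a) (inF U b) (λ e → contradiction (trans (sym (lookup-inT U a)) (trans e (lookup-inF U b))) λ ()))) (P.+-identityʳ _)))
        (∑-cong Fs λ a → ≈-trans (∑-split U (λ y → f (inF U a , y)))
          (P.+-congʳ (∑-zero Ts λ b → cross (inF U a) (inT U b) (λ e → contradiction (trans (sym (lookup-inF U a)) (trans e (lookup-inT U b))) λ ())))) ⟩
  ∑ Ts (λ a → ∑ Ts (λ b → f (inT U a , inT U b))) ⊕ ∑ Fs (λ a → ∑ Fs (λ b → f (inF U a , inF U b)))
    ≈⟨ ⊕-cong (∑-edgePairs (#T U) (f ∘ both (inT U))) (∑-edgePairs (#F U) (f ∘ both (inF U))) ⟨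
  ∑ (edgePairs (#T U)) (f ∘ both (inT U)) ⊕ ∑ (edgePairs (#F U)) (f ∘ both (inF U)) ∎
  where
  open ≈-Reasoning
  Ts = allFin (#T U)
  Fs = allFin (#F U)

-- A graph without edges between `U` and its complement is `glue U K g₁ g₂` for exactly one choice
-- of `K`, `g₁`, `g₂`, found edge by edge; the other graphs contribute 0 by hypothesis.
∑-glue : ∀ {V} (U : Vec Bool V) E (h : Edges V E → Poly) → (∀ g → ¬ Closed g U → h g ≈ zeroP) →
  ∑ (graphs V E) h ≈ ∑ (masks E) (λ K → ∑ (graphs (#T U) (#T K)) (λ g₁ → ∑ (graphs (#F U) (#F K)) (λ g₂ → h (glue U K g₁ g₂))))
∑-glue {V} U zero    h cl = ≈-sym (≈-trans (P.+-identityʳ ((h [] ⊕ zeroP) ⊕ zeroP)) (P.+-identityʳ (h [] ⊕ zeroP)))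
∑-glue {V} U (suc E) h cl = begin
  ∑ (graphs V (suc E)) h
    ≈⟨ ∑E.∑-vecs-suc (edgePairs V) E h ⟩
  ∑ (edgePairs V) (λ e → ∑ (graphs V E) (λ g → h (e ∷ g)))
    ≈⟨ ∑-edgePairs-split U (λ e → ∑ (graphs V E) (λ g → h (e ∷ g))) (λ x y ≢ → ∑-zero (graphs V E) λ g → cl ((x , y) ∷ g) (λ c → ≢ (c zero))) ⟩
  ∑ Ts (λ e → ∑ (graphs V E) (λ g → h (both (inT U) e ∷ g))) ⊕ ∑ Fs (λ e → ∑ (graphs V E) (λ g → h (both (inF U) e ∷ g)))
    ≈⟨ ⊕-cong
         (≈-trans (∑-cong Ts λ e → ∑-glue U E (λ g → h (both (inT U) e ∷ g)) (λ g ¬c → cl _ (λ c → ¬c (c ∘ suc))))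
           (≈-trans (∑-swap Ts (masks E) _) (∑-cong (masks E) λ K → ≈-sym (∑E.∑-vecs-suc Ts (#T K) (λ g₁ → H (true ∷ K) g₁)))))
         (≈-trans (∑-cong Fs λ e → ∑-glue U E (λ g → h (both (inF U) e ∷ g)) (λ g ¬c → cl _ (λ c → ¬c (c ∘ suc))))
           (≈-trans (∑-swap Fs (masks E) _) (∑-cong (masks E) λ K → ≈-trans (∑-swap Fs (graphs (#T U) (#T K)) _)
             (∑-cong (graphs (#T U) (#T K)) λ g₁ → ≈-sym (∑E.∑-vecs-suc Fs (#F K) (λ g₂ → h (glue U (false ∷ K) g₁ g₂))))))) ⟩
  t ⊕ f
    ≈⟨ ⊕-comm t f ⟩
  f ⊕ t
    ≈⟨ P.+-congˡ {f} (P.+-identityʳ t) ⟨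
  ∑ (false ∷ true ∷ []) (λ b → ∑ (masks E) (λ K → ∑ (graphs (#T U) (#T (b ∷ K))) (λ g₁ → H (b ∷ K) g₁)))
    ≈⟨ ∑E.∑-vecs-suc (false ∷ true ∷ []) E (λ K → ∑ (graphs (#T U) (#T K)) (λ g₁ → H K g₁)) ⟨
  ∑ (masks (suc E)) (λ K → ∑ (graphs (#T U) (#T K)) (λ g₁ → H K g₁)) ∎
  where
  open ≈-Reasoning
  Ts = edgePairs (#T U)
  Fs = edgePairs (#F U)
  H : (K : Vec Bool (suc E)) → Edges (#T U) (#T K) → Poly
  H K g₁ = ∑ (graphs (#F U) (#F K)) (λ g₂ → h (glue U K g₁ g₂))
  t = ∑ (masks E) (λ K → ∑ (graphs (#T U) (#T (true ∷ K))) (λ g₁ → H (true ∷ K) g₁))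
  f = ∑ (masks E) (λ K → ∑ (graphs (#T U) (#T (false ∷ K))) (λ g₁ → H (false ∷ K) g₁))

touches-none : ∀ {m n k} (f : Fin m → Fin n) (h : Fin k → Fin n) → (∀ i j → f i ≢ h j) → ∀ e x → touches (both f e) (h x) ≡ 0
touches-none f h ≢ (a , b) x = cong₂ (λ p q → b2n p ℕ.+ b2n q) (off a) (off b)
  where
  off : ∀ a → (f a =ᶠ h x) ≡ false
  off a = trans (=ᶠ-does (f a) (h x)) (dec-false (f a Fin.≟ h x) (≢ a x))

touches-inj : ∀ {m n} (f : Fin m → Fin n) → (∀ {x y} → f x ≡ f y → x ≡ y) → ∀ e x → touches (both f e) (f x) ≡ touches e x
touches-inj f inj (a , b) x = cong₂ (λ p q → b2n p ℕ.+ b2n q) (=ᶠ-inj f inj a x) (=ᶠ-inj f inj b x)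

module _ {V} (U : Vec Bool V) (c₁ : Vec (Fin 2) (#T U)) (c₂ : Vec (Fin 2) (#F U)) where
  private cs = merge U c₁ c₂

  halfCount-inT : ∀ {E} (K : Vec Bool E) g₁ g₂ s x → halfCount cs (glue U K g₁ g₂) s (inT U x) ≡ halfCount c₁ g₁ s x
  halfCount-inT []          []            []            s x = refl
  halfCount-inT (true  ∷ K) ((a , b) ∷ g₁) g₂           s x = cong₂ ℕ._+_
    (cong₂ (λ c t → b2n (c =ᶠ s) ℕ.* t) (cong₂ sideOf (lookup-merge-inT U c₁ c₂ a) (lookup-merge-inT U c₁ c₂ b)) (touches-inj (inT U) (inT-injective U) (a , b) x))
    (halfCount-inT K g₁ g₂ s x)
  halfCount-inT (false ∷ K) g₁           ((a , b) ∷ g₂) s x = trans (cong (ℕ._+ halfCount cs (glue U K g₁ g₂) s (inT U x))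
    (trans (cong (b2n (side cs (inF U a) (inF U b) =ᶠ s) ℕ.*_) (touches-none (inF U) (inT U) (λ i j e → inT≢inF U j i (sym e)) (a , b) x)) (ℕₚ.*-zeroʳ (b2n (side cs (inF U a) (inF U b) =ᶠ s)))))
    (halfCount-inT K g₁ g₂ s x)

  halfCount-inF : ∀ {E} (K : Vec Bool E) g₁ g₂ s x → halfCount cs (glue U K g₁ g₂) s (inF U x) ≡ halfCount c₂ g₂ s x
  halfCount-inF []          []            []            s x = refl
  halfCount-inF (false ∷ K) g₁           ((a , b) ∷ g₂) s x = cong₂ ℕ._+_
    (cong₂ (λ c t → b2n (c =ᶠ s) ℕ.* t) (cong₂ sideOf (lookup-merge-inF U c₁ c₂ a) (lookup-merge-inF U c₁ c₂ b)) (touches-inj (inF U) (inF-injective U) (a , b) x))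
    (halfCount-inF K g₁ g₂ s x)
  halfCount-inF (true  ∷ K) ((a , b) ∷ g₁) g₂           s x = trans (cong (ℕ._+ halfCount cs (glue U K g₁ g₂) s (inF U x))
    (trans (cong (b2n (side cs (inT U a) (inT U b) =ᶠ s) ℕ.*_) (touches-none (inT U) (inF U) (inT≢inF U) (a , b) x)) (ℕₚ.*-zeroʳ (b2n (side cs (inT U a) (inT U b) =ᶠ s)))))
    (halfCount-inF K g₁ g₂ s x)

  vertexWeights-glue : ∀ {E} (K : Vec Bool E) g₁ g₂ →
    ∏ V (vertexWeight cs (glue U K g₁ g₂)) ≈ ∏ (#T U) (vertexWeight c₁ g₁) ⊗ ∏ (#F U) (vertexWeight c₂ g₂)
  vertexWeights-glue K g₁ g₂ = ≈-trans (∏-split U (vertexWeight cs (glue U K g₁ g₂))) (⊗-cong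
    (∏-cong (#T U) λ x → ≈-reflexive (ω-cong (lookup-merge-inT U c₁ c₂ x) (halfCount-inT K g₁ g₂ zero x) (halfCount-inT K g₁ g₂ (suc zero) x)))
    (∏-cong (#F U) λ x → ≈-reflexive (ω-cong (lookup-merge-inF U c₁ c₂ x) (halfCount-inF K g₁ g₂ zero x) (halfCount-inF K g₁ g₂ (suc zero) x))))
    where
    ω-cong : ∀ {c c′ a a′ b b′} → c ≡ c′ → a ≡ a′ → b ≡ b′ → ω c a b ≡ ω c′ a′ b′
    ω-cong refl refl refl = refl

-- The two parts are coloured independently, and the half-edges at a vertex depend only on the part
-- containing it, so the product over vertices and then the sum over colourings factor.
graphWeight-glue : ∀ {V E} (U : Vec Bool V) (K : Vec Bool E) g₁ g₂ → graphWeight (glue U K g₁ g₂) ≈ graphWeight g₁ ⊗ graphWeight g₂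
graphWeight-glue {V} U K g₁ g₂ = begin
  graphWeight (glue U K g₁ g₂)
    ≈⟨ graphWeight≈ (glue U K g₁ g₂) ⟩
  ∑ (colourings V) (λ cs → ∏ V (vertexWeight cs (glue U K g₁ g₂)))
    ≈⟨ ∑-merge (allFin 2) U (λ cs → ∏ V (vertexWeight cs (glue U K g₁ g₂))) ⟩
  ∑ (colourings (#T U)) (λ c₁ → ∑ (colourings (#F U)) (λ c₂ → ∏ V (vertexWeight (merge U c₁ c₂) (glue U K g₁ g₂))))
    ≈⟨ ∑-cong (colourings (#T U)) (λ c₁ → ≈-trans (∑-cong (colourings (#F U)) λ c₂ → vertexWeights-glue U c₁ c₂ K g₁ g₂)
         (∑-*ˡ (colourings (#F U)) (∏ (#T U) (vertexWeight c₁ g₁)) (λ c₂ → ∏ (#F U) (vertexWeight c₂ g₂)))) ⟩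
  ∑ (colourings (#T U)) (λ c₁ → ∏ (#T U) (vertexWeight c₁ g₁) ⊗ ∑ (colourings (#F U)) (λ c₂ → ∏ (#F U) (vertexWeight c₂ g₂)))
    ≈⟨ ∑-*ʳ (colourings (#T U)) (∑ (colourings (#F U)) (λ c₂ → ∏ (#F U) (vertexWeight c₂ g₂))) (λ c₁ → ∏ (#T U) (vertexWeight c₁ g₁)) ⟩
  ∑ (colourings (#T U)) (λ c₁ → ∏ (#T U) (vertexWeight c₁ g₁)) ⊗ ∑ (colourings (#F U)) (λ c₂ → ∏ (#F U) (vertexWeight c₂ g₂))
    ≈⟨ ⊗-cong (graphWeight≈ g₁) (graphWeight≈ g₂) ⟨
  graphWeight g₁ ⊗ graphWeight g₂ ∎
  where open ≈-Reasoning

connWeight : ∀ {V E} → Edges V E → Poly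
connWeight g = δ (does (connected? g)) ⊗ graphWeight g

-- U and K are the vertices and the remaining edges of the component of the first edge.
∑-component : ∀ V E → ∑ (graphs V (suc E)) graphWeight ≈
  ∑ (masks V) (λ U → ∑ (masks E) (λ K → ∑ (graphs (#T U) (suc (#T K))) connWeight ⊗ ∑ (graphs (#F U) (#F K)) graphWeight))
∑-component V E = begin
  ∑ (graphs V (suc E)) graphWeight
    -- The factor 1 is written as the sum over all `U` of the delta at the component of the first
    -- edge.
    ≈⟨ ∑-cong (graphs V (suc E)) (λ g → ≈-sym (≈-trans (∑-*ʳ (masks V) (graphWeight g) (λ U → δ (does (U ≟ᵐ first g)))) (≈-trans (P.*-congʳ (∑E.∑-δ≡1 (maskEnum V) (first g))) (⊗-identityˡ _)))) ⟩
  ∑ (graphs V (suc E)) (λ g → ∑ (masks V) (λ U → h U g))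
    ≈⟨ ∑-swap (graphs V (suc E)) (masks V) (λ g U → h U g) ⟩
  ∑ (masks V) (λ U → ∑ (graphs V (suc E)) (h U))
    ≈⟨ ∑-cong (masks V) at-U ⟩
  _ ∎
  where
  open ≈-Reasoning
  _≟ᵐ_ = Enum._≟_ (maskEnum V)
  first : Edges V (suc E) → Vec Bool V
  first g = comp g (proj₁ (Vec.head g))
  h : Vec Bool V → Edges V (suc E) → Poly
  h U g = δ (does (U ≟ᵐ first g)) ⊗ graphWeight g
  not-first : ∀ U g → U ≢ first g → h U g ≈ zeroP
  not-first U g ≢ = ≈-trans (P.*-congʳ (≈-reflexive (cong δ (dec-false (U ≟ᵐ first g) ≢)))) (P.zeroˡ (graphWeight g))
  at-U : ∀ U → ∑ (graphs V (suc E)) (h U) ≈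
    ∑ (masks E) (λ K → ∑ (graphs (#T U) (suc (#T K))) connWeight ⊗ ∑ (graphs (#F U) (#F K)) graphWeight)
  at-U U = begin
    ∑ (graphs V (suc E)) (h U)
      ≈⟨ ∑-glue U (suc E) (h U) (λ g ¬c → not-first U g (λ e → ¬c (subst (Closed g) (sym e) (proj₁ (proj₂ (component g (proj₁ (Vec.head g)))))))) ⟩
    ∑ (masks (suc E)) H
      ≈⟨ ∑E.∑-vecs-suc (false ∷ true ∷ []) E H ⟩
    ∑ (masks E) (H ∘ (false ∷_)) ⊕ (∑ (masks E) (H ∘ (true ∷_)) ⊕ zeroP)
      -- If the mask puts the first edge outside `U`, then `U` misses an end of that edge and is not
      -- its component; only masks starting with `true` survive.
      ≈⟨ ⊕-cong (∑-zero (masks E) λ K → ∑-zero (graphs (#T U) (#T K)) λ g₁ → ∑-zero (graphs (#F U) (suc (#F K))) λ { (e ∷ g₂) → not-first U (glue U (false ∷ K) g₁ (e ∷ g₂)) (outside K g₁ e g₂) })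
           (P.+-identityʳ _) ⟩
    ∑ (masks E) (H ∘ (true ∷_))
      ≈⟨ ∑-cong (masks E) (λ K → ≈-trans (∑-cong (graphs (#T U) (suc (#T K))) λ { (e ∷ g₁) →
             ≈-trans (∑-cong (graphs (#F U) (#F K)) λ g₂ → ≈-trans (⊗-cong (≈-reflexive (cong δ (comp-glue U (true ∷ K) (e ∷ g₁) g₂ (proj₁ e)))) (graphWeight-glue U (true ∷ K) (e ∷ g₁) g₂))
               (≈-sym (⊗-assoc (δ (does (connected? (e ∷ g₁)))) (graphWeight (e ∷ g₁)) (graphWeight g₂))))
             (∑-*ˡ (graphs (#F U) (#F K)) (connWeight (e ∷ g₁)) graphWeight) })
           (∑-*ʳ (graphs (#T U) (suc (#T K))) (∑ (graphs (#F U) (#F K)) graphWeight) connWeight)) ⟩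
    ∑ (masks E) (λ K → ∑ (graphs (#T U) (suc (#T K))) connWeight ⊗ ∑ (graphs (#F U) (#F K)) graphWeight) ∎
    where
    H : Vec Bool (suc E) → Poly
    H K = ∑ (graphs (#T U) (#T K)) (λ g₁ → ∑ (graphs (#F U) (#F K)) (λ g₂ → h U (glue U K g₁ g₂)))
    outside : ∀ K g₁ e g₂ → U ≢ first (glue U (false ∷ K) g₁ (e ∷ g₂))
    outside K g₁ e g₂ eq = contradiction (trans (sym (proj₁ (proj₂ (proj₂ (component (glue U (false ∷ K) g₁ (e ∷ g₂)) (inF U (proj₁ e)))))))
      (trans (cong (λ W → lookup W (inF U (proj₁ e))) (sym eq)) (lookup-inF U (proj₁ e)))) λ ()

-- The recursion for the generating functions

invAut : ℕ → ℕ → Poly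
invAut V E = ι (inv (V !)) ⊗ ι (inv (edgeAut E))

labelled≈ : ∀ V E h → labelled V E h ≈ invAut V E ⊗ ∑ (graphs V E) h
labelled≈ V E h = ≈-sym (⊗-assoc (ι (inv (V !))) (ι (inv (edgeAut E))) (∑ (graphs V E) h))

num-inv-edgeAut : ∀ e → num (suc e) ⊗ ι (inv (edgeAut (suc e))) ≈ ι (inv (e !)) ⊗ ι (inv (2 ^ suc e))
num-inv-edgeAut e = begin
  num (suc e) ⊗ ι (inv (suc e ! ℕ.* 2 ^ suc e))
    ≈⟨ P.*-congˡ {num (suc e)} (≈-trans (≈-reflexive (cong ι (inv-* (suc e !) (2 ^ suc e) {{suc e !≢0}} {{ℕₚ.m^n≢0 2 (suc e)}}))) (ι-* (inv (suc e !)) (inv (2 ^ suc e)))) ⟩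
  num (suc e) ⊗ (ι (inv (suc e !)) ⊗ ι (inv (2 ^ suc e)))
    ≈⟨ ⊗-assoc (num (suc e)) (ι (inv (suc e !))) (ι (inv (2 ^ suc e))) ⟨
  num (suc e) ⊗ ι (inv (suc e !)) ⊗ ι (inv (2 ^ suc e))
    ≈⟨ P.*-congʳ (num-suc-inv e) ⟩
  ι (inv (e !)) ⊗ ι (inv (2 ^ suc e)) ∎
  where open ≈-Reasoning

inv-2^-split : ∀ e e′ → ι (inv (2 ^ suc (e ℕ.+ e′))) ≈ ι (inv (2 ^ suc e)) ⊗ ι (inv (2 ^ e′))
inv-2^-split e e′ = ≈-trans (≈-reflexive (cong ι (trans (cong inv (ℕₚ.^-distribˡ-+-* 2 (suc e) e′))
  (inv-* (2 ^ suc e) (2 ^ e′) {{ℕₚ.m^n≢0 2 (suc e)}} {{ℕₚ.m^n≢0 2 e′}})))) (ι-* (inv (2 ^ suc e)) (inv (2 ^ e′)))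

inv-edgeAut : ∀ e → ι (inv (edgeAut e)) ≈ ι (inv (e !)) ⊗ ι (inv (2 ^ e))
inv-edgeAut e = ≈-trans (≈-reflexive (cong ι (inv-* (e !) (2 ^ e) {{e !≢0}} {{ℕₚ.m^n≢0 2 e}}))) (ι-* (inv (e !)) (inv (2 ^ e)))

-- Singling out the first edge accounts for the factor E + 1, which turns 1/(E+1)! into 1/E!. The
-- masks then distribute the other E edges and the V vertices between the component and the rest, in
-- E!/(e! e′!) and V!/(v! v′!) ways. Of 1/2^(E+1), the share of the first edge stays with the
-- component.
labelled-component : ∀ V E → num (suc E) ⊗ labelled V (suc E) graphWeight ≈
  conv V (λ v v′ → conv E (λ e e′ → num (suc e) ⊗ labelled v (suc e) connWeight ⊗ labelled v′ e′ graphWeight))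
labelled-component V E = begin
  num (suc E) ⊗ (iV ⊗ (ι (inv (edgeAut (suc E))) ⊗ ∑ (graphs V (suc E)) graphWeight))
    ≈⟨ solve 4 (λ n v e s → n :* (v :* (e :* s)) := v :* ((n :* e) :* s)) ≈-refl (num (suc E)) iV (ι (inv (edgeAut (suc E)))) (∑ (graphs V (suc E)) graphWeight) ⟩
  iV ⊗ (num (suc E) ⊗ ι (inv (edgeAut (suc E))) ⊗ ∑ (graphs V (suc E)) graphWeight)
    ≈⟨ P.*-congˡ {iV} (⊗-cong (num-inv-edgeAut E) (∑-component V E)) ⟩
  iV ⊗ (ι (inv (E !)) ⊗ p ⊗ ∑ (masks V) (λ U → ∑ (masks E) (λ K → f (#T U) (#F U) (#T K) (#F K))))
    ≈⟨ P.*-congˡ {iV} (≈-trans (≈-sym (∑-*ˡ (masks V) (ι (inv (E !)) ⊗ p) _)) (∑-cong (masks V) λ U →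
         ≈-trans (solve 3 (λ i p s → (i :* p) :* s := p :* (i :* s)) ≈-refl (ι (inv (E !))) p (∑ (masks E) (λ K → f (#T U) (#F U) (#T K) (#F K))))
           (P.*-congˡ {p} (∑-masks E (f (#T U) (#F U)))))) ⟩
  iV ⊗ ∑ (masks V) (λ U → G (#T U) (#F U))
    ≈⟨ ∑-masks V G ⟩
  conv V (λ v v′ → ι (inv (v !)) ⊗ (ι (inv (v′ !)) ⊗ G v v′))
    ≈⟨ conv-cong V (λ v v′ → ≈-trans (solve 4 (λ i j p s → i :* (j :* (p :* s)) := (i :* j :* p) :* s) ≈-refl (ι (inv (v !))) (ι (inv (v′ !))) p
           (conv E (λ e e′ → ι (inv (e !)) ⊗ (ι (inv (e′ !)) ⊗ f v v′ e e′))))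
         (≈-trans (≈-sym (conv-⊗ˡ E (ι (inv (v !)) ⊗ ι (inv (v′ !)) ⊗ p) (λ e e′ → ι (inv (e !)) ⊗ (ι (inv (e′ !)) ⊗ f v v′ e e′))))
           (conv-cong⁺ E λ e e′ eq → regroup v v′ e e′ eq))) ⟩
  conv V (λ v v′ → conv E (λ e e′ → num (suc e) ⊗ labelled v (suc e) connWeight ⊗ labelled v′ e′ graphWeight)) ∎
  where
  open ≈-Reasoning
  iV = ι (inv (V !))
  p  = ι (inv (2 ^ suc E))
  f : ℕ → ℕ → ℕ → ℕ → Poly
  f v v′ e e′ = ∑ (graphs v (suc e)) connWeight ⊗ ∑ (graphs v′ e′) graphWeight
  G : ℕ → ℕ → Poly
  G v v′ = p ⊗ conv E (λ e e′ → ι (inv (e !)) ⊗ (ι (inv (e′ !)) ⊗ f v v′ e e′))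
  regroup : ∀ v v′ e e′ → e ℕ.+ e′ ≡ E →
    ι (inv (v !)) ⊗ ι (inv (v′ !)) ⊗ p ⊗ (ι (inv (e !)) ⊗ (ι (inv (e′ !)) ⊗ f v v′ e e′)) ≈
    num (suc e) ⊗ labelled v (suc e) connWeight ⊗ labelled v′ e′ graphWeight
  regroup v v′ e e′ eq = begin
    i ⊗ i′ ⊗ p ⊗ (j ⊗ (j′ ⊗ (B ⊗ A)))
      ≈⟨ P.*-congʳ (P.*-congˡ {i ⊗ i′} (≈-trans (≈-reflexive (cong (λ n → ι (inv (2 ^ suc n))) (sym eq))) (inv-2^-split e e′))) ⟩
    i ⊗ i′ ⊗ (q ⊗ q′) ⊗ (j ⊗ (j′ ⊗ (B ⊗ A)))
      ≈⟨ solve 8 (λ i i′ q q′ j j′ b a → i :* i′ :* (q :* q′) :* (j :* (j′ :* (b :* a))) := (i :* ((j :* q) :* b)) :* (i′ :* ((j′ :* q′) :* a))) ≈-refl i i′ q q′ j j′ B A ⟩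
    (i ⊗ ((j ⊗ q) ⊗ B)) ⊗ (i′ ⊗ ((j′ ⊗ q′) ⊗ A))
      ≈⟨ ⊗-cong (P.*-congˡ {i} (P.*-congʳ (num-inv-edgeAut e))) (P.*-congˡ {i′} (P.*-congʳ (inv-edgeAut e′))) ⟨
    (i ⊗ ((num (suc e) ⊗ ι (inv (edgeAut (suc e)))) ⊗ B)) ⊗ labelled v′ e′ graphWeight
      ≈⟨ P.*-congʳ (solve 4 (λ i n a b → i :* ((n :* a) :* b) := n :* (i :* (a :* b))) ≈-refl i (num (suc e)) (ι (inv (edgeAut (suc e)))) B) ⟩
    num (suc e) ⊗ labelled v (suc e) connWeight ⊗ labelled v′ e′ graphWeight ∎
    where
    i = ι (inv (v !)) ; i′ = ι (inv (v′ !)) ; q = ι (inv (2 ^ suc e)) ; q′ = ι (inv (2 ^ e′))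
    j = ι (inv (e !)) ; j′ = ι (inv (e′ !))
    B = ∑ (graphs v (suc e)) connWeight
    A = ∑ (graphs v′ e′) graphWeight

sumFin-cong : ∀ n {f g : Fin n → ℕ} → (∀ x → f x ≡ g x) → sumFin n f ≡ sumFin n g
sumFin-cong zero    e = refl
sumFin-cong (suc n) e = cong₂ ℕ._+_ (e zero) (sumFin-cong n (e ∘ suc))

sumFin-+ : ∀ n (f g : Fin n → ℕ) → sumFin n (λ x → f x ℕ.+ g x) ≡ sumFin n f ℕ.+ sumFin n g
sumFin-+ zero    f g = refl
sumFin-+ (suc n) f g = trans (cong (f zero ℕ.+ g zero ℕ.+_) (sumFin-+ n (f ∘ suc) (g ∘ suc))) (interchange (f zero) (g zero) _ _)
  where open import Algebra.Properties.CommutativeSemigroup ℕₚ.+-commutativeSemigroup using (interchange)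

sumFin-0 : ∀ n → sumFin n (λ _ → 0) ≡ 0
sumFin-0 zero    = refl
sumFin-0 (suc n) = sumFin-0 n

sumFin-=ᶠ : ∀ {n} (a : Fin n) → sumFin n (λ x → b2n (a =ᶠ x)) ≡ 1
sumFin-=ᶠ {suc n} zero    = cong suc (trans (sumFin-cong n λ _ → refl) (sumFin-0 n))
sumFin-=ᶠ {suc n} (suc a) = trans (sumFin-cong n λ x → cong b2n (=ᶠ-inj suc Finₚ.suc-injective a x)) (sumFin-=ᶠ a)

deg : ∀ {V E} → Vec (Fin 2) V → Edges V E → Fin V → ℕ
deg cs g x = halfCount cs g zero x ℕ.+ halfCount cs g (suc zero) x

deg-∷ : ∀ {V E} (cs : Vec (Fin 2) V) e (g : Edges V E) x → deg cs (e ∷ g) x ≡ touches e x ℕ.+ deg cs g x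
deg-∷ cs (a , b) g x = lem (side cs a b)
  where
  t = touches (a , b) x
  h = halfCount cs g zero x
  h′ = halfCount cs g (suc zero) x
  lem : ∀ s → (b2n (s =ᶠ zero) ℕ.* t ℕ.+ h) ℕ.+ (b2n (s =ᶠ suc zero) ℕ.* t ℕ.+ h′) ≡ t ℕ.+ (h ℕ.+ h′)
  lem zero       = solveℕ 3 (λ t h h′ → (con 1 :*′ t :+′ h) :+′ h′ :=′ t :+′ (h :+′ h′)) refl t h h′
  lem (suc zero) = solveℕ 3 (λ t h h′ → h :+′ (con 1 :*′ t :+′ h′) :=′ t :+′ (h :+′ h′)) refl t h h′

sumFin-touches : ∀ {V} (e : Fin V × Fin V) → sumFin V (touches e) ≡ 2
sumFin-touches {V} (a , b) = trans (sumFin-+ V (λ x → b2n (a =ᶠ x)) (λ x → b2n (b =ᶠ x))) (cong₂ ℕ._+_ (sumFin-=ᶠ a) (sumFin-=ᶠ b))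

sumFin-deg : ∀ {V E} (cs : Vec (Fin 2) V) (g : Edges V E) → sumFin V (deg cs g) ≡ E ℕ.* 2
sumFin-deg {V} cs []      = sumFin-0 V
sumFin-deg {V} cs (e ∷ g) = trans (sumFin-cong V (deg-∷ cs e g)) (trans (sumFin-+ V (touches e) (deg cs g)) (cong₂ ℕ._+_ (sumFin-touches e) (sumFin-deg cs g)))

pigeonhole-zero : ∀ n (f : Fin n → ℕ) → sumFin n f < n → ∃ λ x → f x ≡ 0
pigeonhole-zero (suc n) f lt with f zero in e
... | zero  = zero , e
... | suc k with pigeonhole-zero n (f ∘ suc) (ℕₚ.≤-trans (s≤s (ℕₚ.m≤n+m (sumFin n (f ∘ suc)) k)) (ℕ.s≤s⁻¹ lt))
...   | x , ex = suc x , ex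

∏-zero : ∀ n (f : Fin n → Poly) x → f x ≈ zeroP → ∏ n f ≈ zeroP
∏-zero (suc n) f zero    e = ≈-trans (P.*-congʳ e) (P.zeroˡ (∏ n (f ∘ suc)))
∏-zero (suc n) f (suc x) e = ≈-trans (P.*-congˡ {f zero} (∏-zero n (f ∘ suc) x e)) (P.zeroʳ (f zero))

ω-isolated : ∀ c a b → a ℕ.+ b ≡ 0 → ω c a b ≈ zeroP
ω-isolated c a b e = ≈-trans (P.*-congˡ {pc c b} (≈-reflexive (cong ξ e))) (P.zeroʳ (pc c b))

graphWeight-isolated : ∀ {V E} (g : Edges V E) → E ℕ.* 2 < V → graphWeight g ≈ zeroP
graphWeight-isolated {V} g lt = ≈-trans (graphWeight≈ g) (∑-zero (colourings V) λ cs →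
  let (x , e) = pigeonhole-zero V (deg cs g) (subst (_< V) (sym (sumFin-deg cs g)) lt)
  in ∏-zero V (vertexWeight cs g) x (ω-isolated (lookup cs x) _ _ e))

labelled-zero : ∀ V E h → (∀ g → h g ≈ zeroP) → labelled V E h ≈ zeroP
labelled-zero V E h e = ≈-trans (labelled≈ V E h) (≈-trans (P.*-congˡ {invAut V E} (∑-zero (graphs V E) e)) (P.zeroʳ (invAut V E)))

-- Graphs with more than 2E vertices have isolated vertices, hence weight 0.
allGF connGF : ℕ → Poly
allGF  E = sumP (E ℕ.* 2) (λ V → labelled V E graphWeight)
connGF E = sumP (E ℕ.* 2) (λ V → labelled V E connWeight)

sumP-extend : ∀ n k (f : ℕ → Poly) → (∀ i → n < i → f i ≈ zeroP) → sumP (k ℕ.+ n) f ≈ sumP n f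
sumP-extend n zero    f z = ≈-refl
sumP-extend n (suc k) f z = ≈-trans (⊕-cong (sumP-extend n k f z) (z (suc (k ℕ.+ n)) (s≤s (ℕₚ.m≤n+m n k)))) (P.+-identityʳ (sumP n f))

sumP-⊕ : ∀ n (f g : ℕ → Poly) → sumP n (λ i → f i ⊕ g i) ≈ sumP n f ⊕ sumP n g
sumP-⊕ zero    f g = ≈-refl
sumP-⊕ (suc n) f g = ≈-trans (P.+-congʳ (sumP-⊕ n f g)) (interchange (sumP n f) (sumP n g) (f (suc n)) (g (suc n)))
  where open import Algebra.Properties.CommutativeSemigroup P.+-commutativeSemigroup using (interchange)

sumP-conv-triangle : ∀ n (f : ℕ → ℕ → Poly) → sumP n (λ k → conv k f) ≈ conv n (λ i r → sumP r (f i))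
sumP-conv-triangle zero    f = ≈-refl
sumP-conv-triangle (suc n) f = begin
  sumP (suc n) (λ k → conv k f)
    ≈⟨ sumP-cons n (λ k → conv k f) ⟩
  f 0 0 ⊕ sumP n (λ k → f 0 (suc k) ⊕ conv k (f ∘ suc))
    ≈⟨ P.+-congˡ {f 0 0} (sumP-⊕ n (λ k → f 0 (suc k)) (λ k → conv k (f ∘ suc))) ⟩
  f 0 0 ⊕ (sumP n (λ k → f 0 (suc k)) ⊕ sumP n (λ k → conv k (f ∘ suc)))
    ≈⟨ P.+-assoc (f 0 0) _ _ ⟨
  f 0 0 ⊕ sumP n (λ k → f 0 (suc k)) ⊕ sumP n (λ k → conv k (f ∘ suc))
    ≈⟨ ⊕-cong (≈-sym (sumP-cons n (f 0))) (sumP-conv-triangle n (f ∘ suc)) ⟩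
  sumP (suc n) (f 0) ⊕ conv n (λ i r → sumP r (f (suc i))) ∎
  where open ≈-Reasoning

-- Since `f` and `g` vanish beyond p and q, the truncated sums are complete, and every pair with a
-- nonzero product has i + j at most p + q.
sumP-conv-product : ∀ p q (f g : ℕ → Poly) → (∀ i → p < i → f i ≈ zeroP) → (∀ i → q < i → g i ≈ zeroP) →
  sumP (p ℕ.+ q) (λ k → conv k (λ i j → f i ⊗ g j)) ≈ sumP p f ⊗ sumP q g
sumP-conv-product p q f g fz gz = begin
  sumP (p ℕ.+ q) (λ k → conv k (λ i j → f i ⊗ g j))
    ≈⟨ sumP-conv-triangle (p ℕ.+ q) (λ i j → f i ⊗ g j) ⟩
  conv (p ℕ.+ q) (λ i r → sumP r (λ j → f i ⊗ g j))
    ≈⟨ conv-cong⁺ (p ℕ.+ q) (λ i r e → ≈-trans (sumP-⊗ˡ r (f i) g) (trunc i r e)) ⟩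
  conv (p ℕ.+ q) (λ i r → f i ⊗ sumP q g)
    ≈⟨ sumP-conv (p ℕ.+ q) (λ i r → f i ⊗ sumP q g) ⟨
  sumP (p ℕ.+ q) (λ i → f i ⊗ sumP q g)
    ≈⟨ ≈-trans (≈-reflexive (cong (λ n → sumP n (λ i → f i ⊗ sumP q g)) (ℕₚ.+-comm p q))) (sumP-extend p q (λ i → f i ⊗ sumP q g) (λ i lt → ≈-trans (P.*-congʳ (fz i lt)) (P.zeroˡ (sumP q g)))) ⟩
  sumP p (λ i → f i ⊗ sumP q g)
    ≈⟨ sumP-⊗ʳ p (sumP q g) f ⟩
  sumP p f ⊗ sumP q g ∎
  where
  open ≈-Reasoning
  trunc : ∀ i r → i ℕ.+ r ≡ p ℕ.+ q → f i ⊗ sumP r g ≈ f i ⊗ sumP q g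
  trunc i r e with i ℕ.≤? p
  ... | no  i≰p = ≈-trans (P.*-congʳ (fz i (ℕₚ.≰⇒> i≰p))) (≈-trans (P.zeroˡ (sumP r g)) (≈-sym (≈-trans (P.*-congʳ (fz i (ℕₚ.≰⇒> i≰p))) (P.zeroˡ (sumP q g)))))
  ... | yes i≤p = P.*-congˡ {f i} (≈-trans (≈-reflexive (cong (λ n → sumP n g) (sym (ℕₚ.m∸n+n≡m q≤r)))) (sumP-extend q (r ∸ q) g gz))
    where
    q≤r : q ≤ r
    q≤r = ℕₚ.+-cancelˡ-≤ i q r (subst (i ℕ.+ q ≤_) (sym e) (ℕₚ.+-monoˡ-≤ q i≤p))

sumP-swap-conv : ∀ n m (f : ℕ → ℕ → ℕ → Poly) → sumP n (λ k → conv m (f k)) ≈ conv m (λ i j → sumP n (λ k → f k i j))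
sumP-swap-conv zero    m f = ≈-refl
sumP-swap-conv (suc n) m f = ≈-trans (P.+-congʳ (sumP-swap-conv n m f)) (≈-sym (conv-⊕ m (λ i j → sumP n (λ k → f k i j)) (f (suc n))))

conv-swap : ∀ n m (f : ℕ → ℕ → ℕ → ℕ → Poly) → conv n (λ i j → conv m (f i j)) ≈ conv m (λ k l → conv n (λ i j → f i j k l))
conv-swap zero    m f = ≈-refl
conv-swap (suc n) m f = ≈-trans (P.+-congˡ {conv m (f 0 (suc n))} (conv-swap n m (f ∘ suc))) (≈-sym (conv-⊕ m (f 0 (suc n)) (λ k l → conv n (λ i j → f (suc i) j k l))))

-- The sum of `labelled-component` over V. The truncations match because 2(E+1) = 2(e+1) + 2e′
-- whenever e + e′ = E, and beyond these bounds isolated vertices make all weights vanish.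
allGF-recursion : ∀ E → num (suc E) ⊗ allGF (suc E) ≈ conv E (λ e e′ → num (suc e) ⊗ connGF (suc e) ⊗ allGF e′)
allGF-recursion E = begin
  num (suc E) ⊗ allGF (suc E)
    ≈⟨ sumP-⊗ˡ N (num (suc E)) (λ V → labelled V (suc E) graphWeight) ⟨
  sumP N (λ V → num (suc E) ⊗ labelled V (suc E) graphWeight)
    ≈⟨ sumP-cong N (λ V → ≈-trans (labelled-component V E) (conv-swap V E (λ v v′ e e′ → t e v ⊗ labelled v′ e′ graphWeight))) ⟩
  sumP N (λ V → conv E (λ e e′ → conv V (λ v v′ → t e v ⊗ labelled v′ e′ graphWeight)))
    ≈⟨ sumP-swap-conv N E (λ V e e′ → conv V (λ v v′ → t e v ⊗ labelled v′ e′ graphWeight)) ⟩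
  conv E (λ e e′ → sumP N (λ V → conv V (λ v v′ → t e v ⊗ labelled v′ e′ graphWeight)))
    ≈⟨ conv-cong⁺ E (λ e e′ eq → ≈-trans (≈-reflexive (cong (λ n → sumP n (λ V → conv V (λ v v′ → t e v ⊗ labelled v′ e′ graphWeight)))
           (trans (cong (λ n → suc n ℕ.* 2) (sym eq)) (ℕₚ.*-distribʳ-+ 2 (suc e) e′))))
         (≈-trans (sumP-conv-product (suc e ℕ.* 2) (e′ ℕ.* 2) (t e) (λ v′ → labelled v′ e′ graphWeight)
             (λ v lt → ≈-trans (P.*-congˡ {num (suc e)} (labelled-zero v (suc e) connWeight (λ g → ≈-trans (P.*-congˡ {δ (does (connected? g))} (graphWeight-isolated g lt)) (P.zeroʳ (δ (does (connected? g))))))) (P.zeroʳ (num (suc e))))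
             (λ v lt → labelled-zero v e′ graphWeight (λ g → graphWeight-isolated g lt)))
           (P.*-congʳ (sumP-⊗ˡ (suc e ℕ.* 2) (num (suc e)) (λ v → labelled v (suc e) connWeight))))) ⟩
  conv E (λ e e′ → num (suc e) ⊗ connGF (suc e) ⊗ allGF e′) ∎
  where
  open ≈-Reasoning
  N = suc E ℕ.* 2
  t : ℕ → ℕ → Poly
  t e v = num (suc e) ⊗ labelled v (suc e) connWeight

-- Graphs with E edges contribute to u^(2E).
spread : (ℕ → Poly) → Series
spread f zero          = f 0
spread f (suc zero)    = zeroP
spread f (suc (suc n)) = spread (f ∘ suc) n

spread-even : ∀ f E → spread f (E ℕ.* 2) ≡ f E
spread-even f zero    = refl
spread-even f (suc E) = spread-even (f ∘ suc) E

spread-odd : ∀ f E → spread f (suc (E ℕ.* 2)) ≡ zeroP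
spread-odd f zero    = refl
spread-odd f (suc E) = spread-odd (f ∘ suc) E

data Parity : ℕ → Set where
  even : ∀ E → Parity (E ℕ.* 2)
  odd  : ∀ E → Parity (suc (E ℕ.* 2))

parity : ∀ n → Parity n
parity zero          = even zero
parity (suc zero)    = odd zero
parity (suc (suc n)) with parity n
... | even E = even (suc E)
... | odd E  = odd (suc E)

-- `spread` is the substitution of u² for u, a ring homomorphism.
spread-⋆ : ∀ f g n → (spread f ⋆ spread g) n ≈ spread (f ⋆ g) n
spread-⋆ f g zero          = ≈-refl
spread-⋆ f g (suc zero)    = ≈-trans (P.+-congʳ (P.zeroʳ (f 0))) (P.zeroˡ (g 0))
spread-⋆ f g (suc (suc n)) = ≈-trans (P.+-congˡ {f 0 ⊗ spread (g ∘ suc) n} (spread-⋆ (f ∘ suc) g n))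
  (lem n f g)
  where
  lem : ∀ n f g → f 0 ⊗ spread (g ∘ suc) n ⊕ spread ((f ∘ suc) ⋆ g) n ≈ spread (λ E → (f ⋆ g) (suc E)) n
  lem n f g = ≈-trans (P.+-congʳ (const-spread n (f 0) (g ∘ suc))) (add-spread n (λ E → f 0 ⊗ g (suc E)) ((f ∘ suc) ⋆ g))
    where
    const-spread : ∀ n c h → c ⊗ spread h n ≈ spread (λ E → c ⊗ h E) n
    const-spread zero          c h = ≈-refl
    const-spread (suc zero)    c h = P.zeroʳ c
    const-spread (suc (suc n)) c h = const-spread n c (h ∘ suc)
    add-spread : ∀ n h k → spread h n ⊕ spread k n ≈ spread (λ E → h E ⊕ k E) n
    add-spread zero          h k = ≈-refl
    add-spread (suc zero)    h k = ≈-refl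
    add-spread (suc (suc n)) h k = add-spread n (h ∘ suc) (k ∘ suc)

bw-expS≗ : bwS (expS S) ≗ spread allGF
bw-expS≗ n with parity n
... | even E = ≈-trans (bw-expS-even E) (≈-reflexive (sym (spread-even allGF E)))
... | odd E  = ≈-trans (bw-expS-odd E) (≈-reflexive (sym (spread-odd allGF E)))

D-spread : ∀ f n → D (spread f) n ≈ spread (λ E → num (E ℕ.* 2) ⊗ f E) n
D-spread f n with parity n
... | even E = ≈-trans (P.*-congˡ {num (E ℕ.* 2)} (≈-reflexive (spread-even f E))) (≈-reflexive (sym (spread-even _ E)))
... | odd E  = ≈-trans (P.*-congˡ {num (suc (E ℕ.* 2))} (≈-reflexive (spread-odd f E))) (≈-trans (P.zeroʳ (num (suc (E ℕ.* 2)))) (≈-reflexive (sym (spread-odd _ E))))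

spread-cong : ∀ {f g : ℕ → Poly} → (∀ E → f E ≈ g E) → spread f ≗ spread g
spread-cong e zero          = e 0
spread-cong e (suc zero)    = ≈-refl
spread-cong e (suc (suc n)) = spread-cong (e ∘ suc) n

-- `D` multiplies by 2E instead of E, a common factor 2 on both sides of the edge recursion. The
-- extra summand e = 0 carries the factor 0.
allGF-ode : D (spread allGF) ≗ D (spread connGF) ⋆ spread allGF
allGF-ode n = ≈-trans (D-spread allGF n) (≈-trans (spread-cong step n) (≈-sym (≈-trans
  (⋆-cong {D (spread connGF)} {spread (λ E → num (E ℕ.* 2) ⊗ connGF E)} {spread allGF} {spread allGF} (D-spread connGF) (λ _ → ≈-refl) n)
  (spread-⋆ (λ E → num (E ℕ.* 2) ⊗ connGF E) allGF n))))
  where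
  open ≈-Reasoning
  step : ∀ E → num (E ℕ.* 2) ⊗ allGF E ≈ conv E (λ e e′ → num (e ℕ.* 2) ⊗ connGF e ⊗ allGF e′)
  step zero    = ≈-trans (num-0-⊗ (allGF 0)) (≈-sym (≈-trans (P.*-congʳ (num-0-⊗ (connGF 0))) (P.zeroˡ (allGF 0))))
  step (suc E) = begin
    num (suc E ℕ.* 2) ⊗ allGF (suc E)
      ≈⟨ ≈-trans (P.*-congʳ (num-* (suc E) 2)) (solve 3 (λ n t a → n :* t :* a := t :* (n :* a)) ≈-refl (num (suc E)) (num 2) (allGF (suc E))) ⟩
    num 2 ⊗ (num (suc E) ⊗ allGF (suc E))
      ≈⟨ P.*-congˡ {num 2} (allGF-recursion E) ⟩
    num 2 ⊗ conv E (λ e e′ → num (suc e) ⊗ connGF (suc e) ⊗ allGF e′)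
      ≈⟨ conv-⊗ˡ E (num 2) (λ e e′ → num (suc e) ⊗ connGF (suc e) ⊗ allGF e′) ⟨
    conv E (λ e e′ → num 2 ⊗ (num (suc e) ⊗ connGF (suc e) ⊗ allGF e′))
      ≈⟨ conv-cong E (λ e e′ → ≈-sym (≈-trans (P.*-congʳ (P.*-congʳ (num-* (suc e) 2)))
           (solve 4 (λ n t b a → n :* t :* b :* a := t :* (n :* b :* a)) ≈-refl (num (suc e)) (num 2) (connGF (suc e)) (allGF e′)))) ⟩
    conv E (λ e e′ → num (suc e ℕ.* 2) ⊗ connGF (suc e) ⊗ allGF e′)
      ≈⟨ P.+-congʳ (≈-trans (P.*-congʳ (num-0-⊗ (connGF 0))) (P.zeroˡ (allGF (suc E)))) ⟨
    conv (suc E) (λ e e′ → num (e ℕ.* 2) ⊗ connGF e ⊗ allGF e′) ∎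

allGF-0 : allGF 0 ≈ oneP
allGF-0 = ≈-trans (P.*-congʳ ι-1) (≈-trans (⊗-identityˡ _) (≈-trans (P.*-congʳ ι-1) (≈-trans (⊗-identityˡ _) ≈-refl)))

-- Without edges only V = 0 is summed, and the empty graph does not count as connected.
connGF-0 : connGF 0 ≈ zeroP
connGF-0 = labelled-zero 0 0 connWeight λ { [] → ≈-refl }

logS-cong : ∀ {A B : Series} → A ≗ B → logS A ≗ logS B
logS-cong e zero = ≈-refl
logS-cong {A} {B} e (suc n) = sumP-cong n λ i → ≈-trans (scale≈ (c i) (powS (minusOne A) (suc i) (suc n)))
  (≈-trans (P.*-congˡ {ι (c i)} (pow-cong (suc i) (suc n))) (≈-sym (scale≈ (c i) (powS (minusOne B) (suc i) (suc n)))))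
  where
  c : ℕ → ℚ
  c i = signQ (suc i) ℚ.* inv (suc i)
  minusOne-cong : minusOne A ≗ minusOne B
  minusOne-cong zero    = P.+-congʳ (e 0)
  minusOne-cong (suc n) = e (suc n)
  pow-cong : ∀ j → powS (minusOne A) j ≗ powS (minusOne B) j
  pow-cong zero    n = ≈-refl
  pow-cong (suc j) n = ≈-trans (powS-suc (minusOne A) j n) (≈-trans (⋆-cong {minusOne A} {minusOne B} minusOne-cong (pow-cong j) n) (≈-sym (powS-suc (minusOne B) j n)))

log-bw-expS : logS (bwS (expS S)) ≗ spread connGF
log-bw-expS n = ≈-trans (logS-cong {bwS (expS S)} {spread allGF} bw-expS≗ n) (log-unique (spread allGF) (spread connGF) allGF-0 connGF-0 allGF-ode n)

-- Orbit counting

sumFin-∑ : ∀ n (f : Fin n → ℕ) → sumFin n f ≡ ∑ℕ.∑ (allFin n) f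
sumFin-∑ zero    f = refl
sumFin-∑ (suc n) f = trans (cong (f zero ℕ.+_) (sumFin-∑ n (f ∘ suc))) (sym (∑ℕ.∑-allFin-suc n f))

module ∑ℕE = EnumSum ℕₚ.+-*-commutativeSemiring
module ∑ℚE = EnumSum Qᵣ.commutativeSemiring

module FunSum (R : CommutativeSemiring 0ℓ 0ℓ) where
  open CommutativeSemiring R using (Carrier) renaming (_≈_ to _≈ᴿ_; refl to reflᴿ; sym to symᴿ; trans to transᴿ)
  private
    module Σᴿ = FinSum R
    module Eᴿ = EnumSum R

  -- `allFuns` meets each function only up to pointwise equality. Summands that respect it may be
  -- moved to vectors, where equality is decidable and reindexing applies.
  Extensional : ∀ {n k} → ((Fin n → Fin k) → Carrier) → Set
  Extensional {n} {k} F = ∀ (f g : Fin n → Fin k) → (∀ x → f x ≡ g x) → F f ≈ᴿ F g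

  ∑-allFuns : ∀ n k (F : (Fin n → Fin k) → Carrier) → Extensional F →
              Σᴿ.∑ (allFuns n k) F ≈ᴿ Σᴿ.∑ (vecs (allFin k) n) (F ∘ lookup)
  ∑-allFuns zero    k F ext = CommutativeSemiring.+-congʳ R (ext _ _ λ ())
  ∑-allFuns (suc n) k F ext = begin
    Σᴿ.∑ (allFuns (suc n) k) F
      ≈⟨ Σᴿ.∑-concatMap (λ f → List.map (λ i → consF i f) (allFin k)) (allFuns n k) F ⟩
    Σᴿ.∑ (allFuns n k) (λ f → Σᴿ.∑ (List.map (λ i → consF i f) (allFin k)) F)
      ≈⟨ Σᴿ.∑-cong (allFuns n k) (λ f → Σᴿ.∑-map (λ i → consF i f) (allFin k) F) ⟩
    Σᴿ.∑ (allFuns n k) (λ f → Σᴿ.∑ (allFin k) (λ i → F (consF i f)))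
      ≈⟨ ∑-allFuns n k _ (λ f g e → Σᴿ.∑-cong (allFin k) λ i → ext _ _ λ { zero → refl ; (suc x) → e x }) ⟩
    Σᴿ.∑ (vecs (allFin k) n) (λ v → Σᴿ.∑ (allFin k) (λ i → F (consF i (lookup v))))
      ≈⟨ Σᴿ.∑-cong (vecs (allFin k) n) (λ v → Σᴿ.∑-cong (allFin k) λ i → ext _ _ λ { zero → refl ; (suc x) → refl }) ⟩
    Σᴿ.∑ (vecs (allFin k) n) (λ v → Σᴿ.∑ (allFin k) (λ i → F (lookup (i ∷ v))))
      ≈⟨ Σᴿ.∑-swap (vecs (allFin k) n) (allFin k) _ ⟩
    Σᴿ.∑ (allFin k) (λ i → Σᴿ.∑ (vecs (allFin k) n) (λ v → F (lookup (i ∷ v))))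
      ≈⟨ Eᴿ.∑-vecs-suc (allFin k) n (F ∘ lookup) ⟨
    Σᴿ.∑ (vecs (allFin k) (suc n)) (F ∘ lookup) ∎
    where open import Relation.Binary.Reasoning.Setoid (CommutativeSemiring.setoid R)

  -- The permutation of the values may vary with the argument: it is constant when vertex or edge
  -- maps are composed with an isomorphism, but the correction of flips depends on the edge.
  ∑-allFuns-perm : ∀ n k (π π⁻ : Fin n → Fin k → Fin k) → (∀ x i → π x (π⁻ x i) ≡ i) → (∀ x i → π⁻ x (π x i) ≡ i) →
    (F : (Fin n → Fin k) → Carrier) → Extensional F →
    Σᴿ.∑ (allFuns n k) F ≈ᴿ Σᴿ.∑ (allFuns n k) (λ f → F (λ x → π x (f x)))
  ∑-allFuns-perm n k π π⁻ ππ⁻ π⁻π F ext = begin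
    Σᴿ.∑ (allFuns n k) F
      ≈⟨ ∑-allFuns n k F ext ⟩
    Σᴿ.∑ (vecs (allFin k) n) (F ∘ lookup)
      ≈⟨ Eᴿ.∑-reindex funs funs act act⁻ (inverse π π⁻ ππ⁻) (inverse π⁻ π π⁻π) (F ∘ lookup) ⟨
    Σᴿ.∑ (vecs (allFin k) n) (F ∘ lookup ∘ act)
      ≈⟨ Σᴿ.∑-cong (vecs (allFin k) n) (λ v → ext _ _ (Vecₚ.lookup∘tabulate _)) ⟩
    Σᴿ.∑ (vecs (allFin k) n) (λ v → F (λ x → π x (lookup v x)))
      ≈⟨ ∑-allFuns n k (λ f → F (λ x → π x (f x))) (λ f g e → ext _ _ λ x → cong (π x) (e x)) ⟨
    Σᴿ.∑ (allFuns n k) (λ f → F (λ x → π x (f x))) ∎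
    where
    open import Relation.Binary.Reasoning.Setoid (CommutativeSemiring.setoid R)
    funs : Enum (Vec (Fin k) n)
    funs = vecEnum (finEnum k) n
    act act⁻ : Vec (Fin k) n → Vec (Fin k) n
    act  v = Vec.tabulate (λ x → π x (lookup v x))
    act⁻ v = Vec.tabulate (λ x → π⁻ x (lookup v x))
    inverse : ∀ (p q : Fin n → Fin k → Fin k) → (∀ x i → p x (q x i) ≡ i) → ∀ v →
      Vec.tabulate (λ x → p x (lookup (Vec.tabulate (λ x → q x (lookup v x))) x)) ≡ v
    inverse p q pq v = lookup-ext _ v λ x → trans (Vecₚ.lookup∘tabulate _ x)
      (trans (cong (p x) (Vecₚ.lookup∘tabulate _ x)) (pq x (lookup v x)))

module Fun = FunSum ℕₚ.+-*-commutativeSemiring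

-- Injective maps between finite sets and their number

allFinᵇ-true : ∀ n f → allFinᵇ n f ≡ true → ∀ x → f x ≡ true
allFinᵇ-true (suc n) f e zero    = proj₁ (∧-true (f zero) _ e)
allFinᵇ-true (suc n) f e (suc x) = allFinᵇ-true n (f ∘ suc) (proj₂ (∧-true (f zero) _ e)) x

allFinᵇ-intro : ∀ n f → (∀ x → f x ≡ true) → allFinᵇ n f ≡ true
allFinᵇ-intro zero    f e = refl
allFinᵇ-intro (suc n) f e = ∧-intro (e zero) (allFinᵇ-intro n (f ∘ suc) (e ∘ suc))

allFinᵇ-cong : ∀ n {f g : Fin n → Bool} → (∀ x → f x ≡ g x) → allFinᵇ n f ≡ allFinᵇ n g
allFinᵇ-cong zero    e = refl
allFinᵇ-cong (suc n) e = cong₂ _∧_ (e zero) (allFinᵇ-cong n (e ∘ suc))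

Inj : ∀ {n k} → (Fin n → Fin k) → Set
Inj f = ∀ {x y} → f x ≡ f y → x ≡ y

injᵇ-sound : ∀ {n k} (f : Fin n → Fin k) → injᵇ f ≡ true → Inj f
injᵇ-sound {n} f e {x} {y} fxy = =ᶠ-true (lem (f x =ᶠ f y) (trans (cong (f x =ᶠ_) (sym fxy)) (=ᶠ-refl (f x))) (allFinᵇ-true n _ (allFinᵇ-true n _ e x) y))
  where
  lem : ∀ b {c} → b ≡ true → not b ∨ c ≡ true → c ≡ true
  lem true _ e = e

injᵇ-complete : ∀ {n k} (f : Fin n → Fin k) → Inj f → injᵇ f ≡ true
injᵇ-complete {n} f inj = allFinᵇ-intro n _ λ x → allFinᵇ-intro n _ λ y → lem (f x =ᶠ f y) refl
  where
  lem : ∀ {x y} b → (f x =ᶠ f y) ≡ b → not b ∨ (x =ᶠ y) ≡ true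
  lem         false e = refl
  lem {x} {y} true  e = trans (cong (x =ᶠ_) (sym (inj (=ᶠ-true e)))) (=ᶠ-refl x)

injᵇ-ext : ∀ {n k} (f g : Fin n → Fin k) → (∀ x → f x ≡ g x) → injᵇ f ≡ injᵇ g
injᵇ-ext {n} f g e = allFinᵇ-cong n λ x → allFinᵇ-cong n λ y → cong₂ (λ a b → not (a =ᶠ b) ∨ (x =ᶠ y)) (e x) (e y)

injᵇ-∘ : ∀ {n k l} (h : Fin k → Fin l) → Inj h → (f : Fin n → Fin k) → injᵇ (h ∘ f) ≡ injᵇ f
injᵇ-∘ {n} h inj f = allFinᵇ-cong n λ x → allFinᵇ-cong n λ y → cong (λ b → not b ∨ (x =ᶠ y)) (=ᶠ-inj h inj (f x) (f y))

-- Deleting a missed value would give an injection into Fin (n − 1).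
injective-inverse : ∀ {n} (f : Fin n → Fin n) → Inj f → ∀ y → ∃ λ x → f x ≡ y
injective-inverse {suc n} f inj y with Finₚ.any? (λ x → f x Fin.≟ y)
... | yes p = p
... | no ¬p = contradiction (Finₚ.injective⇒≤ {f = λ x → Fin.punchOut (λ e → ¬p (x , sym e))} (λ {a} {b} e → inj (Finₚ.punchOut-injective (λ e → ¬p (a , sym e)) (λ e → ¬p (b , sym e)) e))) (ℕₚ.<⇒≱ (ℕₚ.n<1+n n))

missed : ∀ {n k} → (Fin n → Fin k) → Fin k → Bool
missed {n} f i = allFinᵇ n (λ x → not (i =ᶠ f x))

=ᶠ-sym : ∀ {n} (x y : Fin n) → (x =ᶠ y) ≡ (y =ᶠ x)
=ᶠ-sym x y = bool-⇔ _ _ (λ e → trans (cong (y =ᶠ_) (=ᶠ-true e)) (=ᶠ-refl y)) (λ e → trans (cong (x =ᶠ_) (=ᶠ-true e)) (=ᶠ-refl x))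

not-true : ∀ b → not b ≡ true → b ≡ false
not-true false _ = refl

injᵇ-cons : ∀ {n k} (i : Fin k) (f : Fin n → Fin k) → injᵇ (consF i f) ≡ injᵇ f ∧ missed f i
injᵇ-cons {n} i f = bool-⇔ _ _
  (λ e → let inj = injᵇ-sound (consF i f) e in ∧-intro
    (injᵇ-complete f (λ eq → Finₚ.suc-injective (inj eq)))
    (allFinᵇ-intro n _ λ x → cong not (trans (=ᶠ-does i (f x)) (dec-false (i Fin.≟ f x) λ eq → contradiction (inj {zero} {suc x} eq) λ ()))))
  (λ e → let (e₁ , e₂) = ∧-true (injᵇ f) _ e in injᵇ-complete (consF i f) (cons-inj (injᵇ-sound f e₁)
    (λ x eq → contradiction (trans (sym (trans (cong (_=ᶠ f x) eq) (=ᶠ-refl (f x)))) (not-true _ (allFinᵇ-true n _ e₂ x))) λ ())))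
  where
  cons-inj : Inj f → (∀ x → i ≢ f x) → Inj (consF i f)
  cons-inj inj miss {zero}  {zero}  eq = refl
  cons-inj inj miss {zero}  {suc y} eq = contradiction eq (miss y)
  cons-inj inj miss {suc x} {zero}  eq = contradiction (sym eq) (miss x)
  cons-inj inj miss {suc x} {suc y} eq = cong suc (inj eq)

∑-=ᶠ : ∀ {n} (a : Fin n) → ∑ℕ.∑ (allFin n) (λ x → b2n (a =ᶠ x)) ≡ 1
∑-=ᶠ {n} a = trans (sym (sumFin-∑ n _)) (sumFin-=ᶠ a)

∑-1 : ∀ n → ∑ℕ.∑ (allFin n) (λ _ → 1) ≡ n
∑-1 zero    = refl
∑-1 (suc n) = trans (∑ℕ.∑-allFin-suc n (λ _ → 1)) (cong suc (∑-1 n))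

missed-or-hit : ∀ {n k} (f : Fin n → Fin k) → Inj f → ∀ i → b2n (missed f i) ℕ.+ ∑ℕ.∑ (allFin n) (λ x → b2n (i =ᶠ f x)) ≡ 1
missed-or-hit {zero}  f inj i = refl
missed-or-hit {suc n} f inj i = trans (cong (b2n (missed f i) ℕ.+_) (∑ℕ.∑-allFin-suc n (λ x → b2n (i =ᶠ f x)))) (go (i =ᶠ f zero) refl)
  where
  rest = ∑ℕ.∑ (allFin n) (λ x → b2n (i =ᶠ f (suc x)))
  off : i ≡ f zero → ∀ x → (i =ᶠ f (suc x)) ≡ false
  off e x = trans (=ᶠ-does i (f (suc x))) (dec-false (i Fin.≟ f (suc x)) λ e′ → contradiction (inj (trans (sym e) e′)) λ ())
  go : ∀ b → (i =ᶠ f zero) ≡ b → b2n (not b ∧ missed (f ∘ suc) i) ℕ.+ (b2n b ℕ.+ rest) ≡ 1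
  go true  e = cong suc (∑ℕ.∑-zero (allFin n) λ x → cong b2n (off (=ᶠ-true e) x))
  go false e = missed-or-hit (f ∘ suc) (λ e → Finₚ.suc-injective (inj e)) i

-- Double counting of the pairs (i, x) with f x = i: every i is either missed or hit exactly once.
∑-missed : ∀ {n k} (f : Fin n → Fin k) → Inj f → ∑ℕ.∑ (allFin k) (b2n ∘ missed f) ≡ k ∸ n
∑-missed {n} {k} f inj = begin
  M                 ≡⟨ sym (ℕₚ.m+n∸n≡m M n) ⟩
  M ℕ.+ n ∸ n       ≡⟨ cong (_∸ n) (begin
    M ℕ.+ n
      ≡⟨ cong (M ℕ.+_) (sym (trans (∑ℕ.∑-swap (allFin k) (allFin n) (λ i x → b2n (i =ᶠ f x))) (trans (∑ℕ.∑-cong (allFin n) λ x → trans (∑ℕ.∑-cong (allFin k) λ i → cong b2n (=ᶠ-sym i (f x))) (∑-=ᶠ (f x))) (∑-1 n)))) ⟩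
    M ℕ.+ ∑ℕ.∑ (allFin k) (λ i → ∑ℕ.∑ (allFin n) (λ x → b2n (i =ᶠ f x)))
      ≡⟨ sym (∑ℕ.∑-+ (allFin k) (b2n ∘ missed f) _) ⟩
    ∑ℕ.∑ (allFin k) (λ i → b2n (missed f i) ℕ.+ ∑ℕ.∑ (allFin n) (λ x → b2n (i =ᶠ f x)))
      ≡⟨ trans (∑ℕ.∑-cong (allFin k) (missed-or-hit f inj)) (∑-1 k) ⟩
    k ∎) ⟩
  k ∸ n ∎
  where
  open ≡-Reasoning
  M = ∑ℕ.∑ (allFin k) (b2n ∘ missed f)

-- An injection on n + 1 points extends one on n points by any of the k - n missed values. The
-- factor (k - n)! keeps the count k!/(k - n)! free of division.
injections : ∀ n k → n ≤ k → ∑ℕ.∑ (allFuns n k) (b2n ∘ injᵇ) ℕ.* (k ∸ n) ! ≡ k !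
injections zero    k _ = ℕₚ.+-identityʳ (k !)
injections (suc n) k n<k = begin
  ∑ℕ.∑ (allFuns (suc n) k) (b2n ∘ injᵇ) ℕ.* (k ∸ suc n) !
    ≡⟨ cong (ℕ._* (k ∸ suc n) !) (begin
      ∑ℕ.∑ (allFuns (suc n) k) (b2n ∘ injᵇ)
        ≡⟨ ∑ℕ.∑-concatMap (λ f → List.map (λ i → consF i f) (allFin k)) (allFuns n k) (b2n ∘ injᵇ) ⟩
      ∑ℕ.∑ (allFuns n k) (λ f → ∑ℕ.∑ (List.map (λ i → consF i f) (allFin k)) (b2n ∘ injᵇ))
        ≡⟨ ∑ℕ.∑-cong (allFuns n k) (λ f → trans (∑ℕ.∑-map (λ i → consF i f) (allFin k) (b2n ∘ injᵇ))
             (trans (∑ℕ.∑-cong (allFin k) λ i → trans (cong b2n (injᵇ-cons i f)) (b2n-∧ (injᵇ f) (missed f i)))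
             (trans (∑ℕ.∑-*ˡ (allFin k) (b2n (injᵇ f)) (b2n ∘ missed f)) (each f (injᵇ f) refl)))) ⟩
      ∑ℕ.∑ (allFuns n k) (λ f → b2n (injᵇ f) ℕ.* (k ∸ n))
        ≡⟨ ∑ℕ.∑-*ʳ (allFuns n k) (k ∸ n) (b2n ∘ injᵇ) ⟩
      ∑ℕ.∑ (allFuns n k) (b2n ∘ injᵇ) ℕ.* (k ∸ n) ∎) ⟩
  ∑ℕ.∑ (allFuns n k) (b2n ∘ injᵇ) ℕ.* (k ∸ n) ℕ.* (k ∸ suc n) !
    ≡⟨ trans (ℕₚ.*-assoc (∑ℕ.∑ (allFuns n k) (b2n ∘ injᵇ)) (k ∸ n) _) (cong (∑ℕ.∑ (allFuns n k) (b2n ∘ injᵇ) ℕ.*_) (trans (cong (ℕ._* (k ∸ suc n) !) k∸n) (cong _! (sym k∸n)))) ⟩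
  ∑ℕ.∑ (allFuns n k) (b2n ∘ injᵇ) ℕ.* (k ∸ n) !
    ≡⟨ injections n k (ℕₚ.<⇒≤ n<k) ⟩
  k ! ∎
  where
  open ≡-Reasoning
  k∸n : k ∸ n ≡ suc (k ∸ suc n)
  k∸n = ℕₚ.+-∸-assoc 1 n<k
  each : ∀ f b → injᵇ f ≡ b → b2n b ℕ.* ∑ℕ.∑ (allFin k) (b2n ∘ missed f) ≡ b2n b ℕ.* (k ∸ n)
  each f false e = refl
  each f true  e = cong (1 ℕ.*_) (∑-missed f (injᵇ-sound f e))

permutations : ∀ n → ∑ℕ.∑ (allFuns n n) (b2n ∘ injᵇ) ≡ n !
permutations n = trans (sym (ℕₚ.*-identityʳ _)) (trans (cong (λ k → ∑ℕ.∑ (allFuns n n) (b2n ∘ injᵇ) ℕ.* k !) (sym (ℕₚ.n∸n≡0 n))) (injections n n ℕₚ.≤-refl))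

∑-allFuns-1 : ∀ n k → ∑ℕ.∑ (allFuns n k) (λ _ → 1) ≡ k ^ n
∑-allFuns-1 zero    k = refl
∑-allFuns-1 (suc n) k = trans (∑ℕ.∑-concatMap (λ f → List.map (λ i → consF i f) (allFin k)) (allFuns n k) (λ _ → 1))
  (trans (∑ℕ.∑-cong (allFuns n k) {g = λ f → 1 ℕ.* k} λ f → trans (∑ℕ.∑-map (λ i → consF i f) (allFin k) (λ _ → 1)) (trans (∑-1 k) (sym (ℕₚ.*-identityˡ k))))
  (trans (∑ℕ.∑-*ʳ (allFuns n k) k (λ _ → 1)) (trans (cong (ℕ._* k) (∑-allFuns-1 n k)) (ℕₚ.*-comm (k ^ n) k))))

-- Counting isomorphisms by triples of maps

validᵇ : (G H : Graph) → (Fin (nv G) → Fin (nv H)) → (Fin (ne G) → Fin (ne H)) → (Fin (ne G) → Fin 2) → Bool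
validᵇ G H σ τ ε = allFinᵇ (ne G) (λ e → pairEq (ends H (τ e)) (flipIf (ε e) (both σ (ends G e))))

-- The triples of `autCount`, but between two graphs. Letting the target vary over all labelled
-- graphs is what makes the double count in `∑-isoCount` possible.
isoCount : Graph → Graph → ℕ
isoCount G H = ∑ℕ.∑ (allFuns (nv G) (nv H)) (λ σ → b2n (injᵇ σ) ℕ.*
  ∑ℕ.∑ (allFuns (ne G) (ne H)) (λ τ → b2n (injᵇ τ) ℕ.* ∑ℕ.∑ (allFuns (ne G) 2) (λ ε → b2n (validᵇ G H σ τ ε))))

if-b2n : ∀ b n → (if b then n else 0) ≡ b2n b ℕ.* n
if-b2n true  n = sym (ℕₚ.+-identityʳ n)
if-b2n false n = refl

sumL-∑ : ∀ {A : Set} (f : A → ℕ) as → sumL f as ≡ ∑ℕ.∑ as f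
sumL-∑ f []       = refl
sumL-∑ f (a ∷ as) = cong (f a ℕ.+_) (sumL-∑ f as)

autCount≡isoCount : ∀ G → autCount G ≡ isoCount G G
autCount≡isoCount G = trans (sumL-∑ _ (allFuns (nv G) (nv G))) (∑ℕ.∑-cong (allFuns (nv G) (nv G)) λ σ → trans (if-b2n (injᵇ σ) _) (cong (b2n (injᵇ σ) ℕ.*_)
  (trans (sumL-∑ _ (allFuns (ne G) (ne G))) (∑ℕ.∑-cong (allFuns (ne G) (ne G)) λ τ → trans (if-b2n (injᵇ τ) _) (cong (b2n (injᵇ τ) ℕ.*_)
    (countL-∑ (validᵇ G G σ τ) (allFuns (ne G) 2)))))))

pairEq-true : ∀ {n} (p q : Fin n × Fin n) → pairEq p q ≡ true → p ≡ q
pairEq-true (a , b) (c , d) e = let (e₁ , e₂) = ∧-true (a =ᶠ c) _ e in cong₂ _,_ (=ᶠ-true e₁) (=ᶠ-true e₂)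

pairEq-refl : ∀ {n} (p : Fin n × Fin n) → pairEq p p ≡ true
pairEq-refl (a , b) = ∧-intro (=ᶠ-refl a) (=ᶠ-refl b)

pairEq-cong-inj : ∀ {m n} {p q : Fin m × Fin m} {p′ q′ : Fin n × Fin n} → (p ≡ q → p′ ≡ q′) → (p′ ≡ q′ → p ≡ q) → pairEq p q ≡ pairEq p′ q′
pairEq-cong-inj {p = p} {q} {p′} {q′} f g = bool-⇔ _ _
  (λ e → trans (cong (pairEq p′) (sym (f (pairEq-true p q e)))) (pairEq-refl p′))
  (λ e → trans (cong (pairEq p) (sym (g (pairEq-true p′ q′ e)))) (pairEq-refl p))

xor₂ : Fin 2 → Fin 2 → Fin 2
xor₂ zero       b          = b
xor₂ (suc zero) zero       = suc zero
xor₂ (suc zero) (suc zero) = zero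

xor₂-involutive : ∀ a b → xor₂ a (xor₂ a b) ≡ b
xor₂-involutive zero       b          = refl
xor₂-involutive (suc zero) zero       = refl
xor₂-involutive (suc zero) (suc zero) = refl

flipIf-xor₂ : ∀ {A : Set} a b (p : A × A) → flipIf (xor₂ a b) p ≡ flipIf a (flipIf b p)
flipIf-xor₂ zero       b          p = refl
flipIf-xor₂ (suc zero) zero       p = refl
flipIf-xor₂ (suc zero) (suc zero) p = refl

flipIf-involutive : ∀ {A : Set} a (p : A × A) → flipIf a (flipIf a p) ≡ p
flipIf-involutive zero    p = refl
flipIf-involutive (suc _) p = refl

flipIf-both : ∀ {m n} a (f : Fin m → Fin n) p → flipIf a (both f p) ≡ both f (flipIf a p)
flipIf-both zero    f p = refl
flipIf-both (suc _) f p = refl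

both-injective : ∀ {m n} (f : Fin m → Fin n) → Inj f → ∀ {p q} → both f p ≡ both f q → p ≡ q
both-injective f inj e = cong₂ _,_ (inj (cong proj₁ e)) (inj (cong proj₂ e))

module _ {G H : Graph} (iso : Iso G H) where
  open Iso iso

  private
    orientation : ∀ {A : Set} {p q : A × A} → p ≡ q ⊎ p ≡ swap q → ∃ λ a → p ≡ flipIf a q
    orientation (inj₁ e) = zero , e
    orientation (inj₂ e) = suc zero , e

  flipped : Fin (ne G) → Fin 2
  flipped e = proj₁ (orientation (incid e))

  ends-flipped : ∀ e → ends H (τ e) ≡ flipIf (flipped e) (both σ (ends G e))
  ends-flipped e = proj₂ (orientation (incid e))

  σ-inj : Inj σ
  σ-inj {x} {y} e = trans (sym (σ⁻σ x)) (trans (cong σ⁻ e) (σ⁻σ y))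

  τ-inj : Inj τ
  τ-inj {x} {y} e = trans (sym (τ⁻τ x)) (trans (cong τ⁻ e) (τ⁻τ y))

iso-sym : ∀ {G H} → Iso G H → Iso H G
iso-sym {G} {H} iso = record { σ = σ⁻ ; σ⁻ = σ ; σσ⁻ = σ⁻σ ; σ⁻σ = σσ⁻ ; τ = τ⁻ ; τ⁻ = τ ; ττ⁻ = τ⁻τ ; τ⁻τ = ττ⁻ ; incid = inc′ }
  where
  open Iso iso
  undo : ∀ p → both σ⁻ (both σ p) ≡ p
  undo (a , b) = cong₂ _,_ (σ⁻σ a) (σ⁻σ b)
  inc′ : ∀ e → ends G (τ⁻ e) ≡ both σ⁻ (ends H e) ⊎ ends G (τ⁻ e) ≡ swap (both σ⁻ (ends H e))
  inc′ e with incid (τ⁻ e)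
  ... | inj₁ q = inj₁ (trans (sym (undo _)) (cong (both σ⁻) (trans (sym q) (cong (ends H) (ττ⁻ e)))))
  ... | inj₂ q = inj₂ (trans (sym (undo _)) (cong (both σ⁻ ∘ swap) (trans (sym q) (cong (ends H) (ττ⁻ e)))))

iso-trans : ∀ {G H K} → Iso G H → Iso H K → Iso G K
iso-trans {G} {H} {K} i j = record
  { σ = J.σ ∘ I.σ ; σ⁻ = I.σ⁻ ∘ J.σ⁻
  ; σσ⁻ = λ x → trans (cong J.σ (I.σσ⁻ _)) (J.σσ⁻ x) ; σ⁻σ = λ x → trans (cong I.σ⁻ (J.σ⁻σ _)) (I.σ⁻σ x)
  ; τ = J.τ ∘ I.τ ; τ⁻ = I.τ⁻ ∘ J.τ⁻
  ; ττ⁻ = λ x → trans (cong J.τ (I.ττ⁻ _)) (J.ττ⁻ x) ; τ⁻τ = λ x → trans (cong I.τ⁻ (J.τ⁻τ _)) (I.τ⁻τ x)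
  ; incid = inc′ }
  where
  module I = Iso i
  module J = Iso j
  inc′ : ∀ e → ends K (J.τ (I.τ e)) ≡ both (J.σ ∘ I.σ) (ends G e) ⊎ ends K (J.τ (I.τ e)) ≡ swap (both (J.σ ∘ I.σ) (ends G e))
  inc′ e with I.incid e | J.incid (I.τ e)
  ... | inj₁ p | inj₁ q = inj₁ (trans q (cong (both J.σ) p))
  ... | inj₁ p | inj₂ q = inj₂ (trans q (cong (swap ∘ both J.σ) p))
  ... | inj₂ p | inj₁ q = inj₂ (trans q (cong (both J.σ) p))
  ... | inj₂ p | inj₂ q = inj₁ (trans q (cong (swap ∘ both J.σ) p))

-- Composition with a fixed isomorphism permutes the candidate triples.
isoCount-iso : ∀ {V E} (f : Fin E → Fin V × Fin V) (g : Fin E → Fin V × Fin V) →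
  let G = record { nv = V ; ne = E ; ends = f } ; H = record { nv = V ; ne = E ; ends = g } in
  Iso G H → isoCount G H ≡ autCount G
isoCount-iso {V} {E} f g iso = begin
  isoCount G H
    ≡⟨ Fun.∑-allFuns-perm V V (λ _ → σ) (λ _ → σ⁻) (λ _ → σσ⁻) (λ _ → σ⁻σ) (λ s → b2n (injᵇ s) ℕ.* ΣT s)
         (λ s s′ e → cong₂ ℕ._*_ (cong b2n (injᵇ-ext s s′ e)) (∑ℕ.∑-cong (allFuns E E) λ t → cong (b2n (injᵇ t) ℕ.*_) (∑ℕ.∑-cong (allFuns E 2) λ ε → cong b2n
           (allFinᵇ-cong E λ x → cong (λ p → pairEq (g (t x)) (flipIf (ε x) p)) (cong₂ _,_ (e _) (e _)))))) ⟩
  ∑ℕ.∑ (allFuns V V) (λ s → b2n (injᵇ (σ ∘ s)) ℕ.* ΣT (σ ∘ s))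
    ≡⟨ ∑ℕ.∑-cong (allFuns V V) (λ s → cong₂ ℕ._*_ (cong b2n (injᵇ-∘ σ (σ-inj iso) s)) (at-s s)) ⟩
  isoCount G G
    ≡⟨ sym (autCount≡isoCount G) ⟩
  autCount G ∎
  where
  open ≡-Reasoning
  open Iso iso
  G = record { nv = V ; ne = E ; ends = f }
  H = record { nv = V ; ne = E ; ends = g }
  ΣE : (Fin V → Fin V) → (Fin E → Fin E) → ℕ
  ΣE s t = ∑ℕ.∑ (allFuns E 2) (λ ε → b2n (validᵇ G H s t ε))
  ΣT : (Fin V → Fin V) → ℕ
  ΣT s = ∑ℕ.∑ (allFuns E E) (λ t → b2n (injᵇ t) ℕ.* ΣE s t)
  -- Flips compose by exclusive or, so the flip that the isomorphism performs on the edge `t e` is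
  -- added to `ε e`.
  valid≡ : ∀ s t ε → validᵇ G H (σ ∘ s) (τ ∘ t) (λ e → xor₂ (flipped iso (t e)) (ε e)) ≡ validᵇ G G s t ε
  valid≡ s t ε = allFinᵇ-cong E λ e → pairEq-cong-inj
    (λ q → both-injective σ (σ-inj iso) (begin
      both σ (f (t e))
        ≡⟨ sym (flipIf-involutive (flipped iso (t e)) _) ⟩
      flipIf (flipped iso (t e)) (flipIf (flipped iso (t e)) (both σ (f (t e))))
        ≡⟨ cong (flipIf (flipped iso (t e))) (trans (sym (ends-flipped iso (t e))) (trans q (flipIf-xor₂ (flipped iso (t e)) (ε e) _))) ⟩
      flipIf (flipped iso (t e)) (flipIf (flipped iso (t e)) (flipIf (ε e) (both (σ ∘ s) (f e))))
        ≡⟨ trans (flipIf-involutive (flipped iso (t e)) _) (flipIf-both (ε e) σ (both s (f e))) ⟩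
      both σ (flipIf (ε e) (both s (f e))) ∎))
    (λ q → trans (ends-flipped iso (t e)) (trans (cong (flipIf (flipped iso (t e)) ∘ both σ) q)
      (trans (cong (flipIf (flipped iso (t e))) (sym (flipIf-both (ε e) σ (both s (f e))))) (sym (flipIf-xor₂ (flipped iso (t e)) (ε e) _)))))
  at-s : ∀ s → ΣT (σ ∘ s) ≡ ∑ℕ.∑ (allFuns E E) (λ t → b2n (injᵇ t) ℕ.* ∑ℕ.∑ (allFuns E 2) (λ ε → b2n (validᵇ G G s t ε)))
  at-s s = trans (Fun.∑-allFuns-perm E E (λ _ → τ) (λ _ → τ⁻) (λ _ → ττ⁻) (λ _ → τ⁻τ) (λ t → b2n (injᵇ t) ℕ.* ΣE (σ ∘ s) t)
      (λ t t′ e → cong₂ ℕ._*_ (cong b2n (injᵇ-ext t t′ e)) (∑ℕ.∑-cong (allFuns E 2) λ ε → cong b2n (allFinᵇ-cong E λ x → cong (λ y → pairEq (g y) (flipIf (ε x) (both (σ ∘ s) (f x)))) (e x)))))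
    (∑ℕ.∑-cong (allFuns E E) λ t → cong₂ ℕ._*_ (cong b2n (injᵇ-∘ τ (τ-inj iso) t))
      (trans (Fun.∑-allFuns-perm E 2 (λ e → xor₂ (flipped iso (t e))) (λ e → xor₂ (flipped iso (t e)))
          (λ e → xor₂-involutive (flipped iso (t e))) (λ e → xor₂-involutive (flipped iso (t e))) (λ ε → b2n (validᵇ G H (σ ∘ s) (τ ∘ t) ε))
          (λ ε ε′ eq → cong b2n (allFinᵇ-cong E λ x → cong (λ y → pairEq (g (τ (t x))) (flipIf y (both (σ ∘ s) (f x)))) (eq x))))
        (∑ℕ.∑-cong (allFuns E 2) λ ε → cong b2n (valid≡ s t ε))))

valid-iso : ∀ {V E} (f g : Fin E → Fin V × Fin V) →
  let G = record { nv = V ; ne = E ; ends = f } ; H = record { nv = V ; ne = E ; ends = g } in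
  ∀ σ τ ε → Inj σ → Inj τ → validᵇ G H σ τ ε ≡ true → Iso G H
valid-iso {V} {E} f g σ τ ε iσ iτ v = record
  { σ = σ ; σ⁻ = λ y → proj₁ (injective-inverse σ iσ y)
  ; σσ⁻ = λ y → proj₂ (injective-inverse σ iσ y) ; σ⁻σ = λ x → iσ (proj₂ (injective-inverse σ iσ (σ x)))
  ; τ = τ ; τ⁻ = λ y → proj₁ (injective-inverse τ iτ y)
  ; ττ⁻ = λ y → proj₂ (injective-inverse τ iτ y) ; τ⁻τ = λ x → iτ (proj₂ (injective-inverse τ iτ (τ x)))
  ; incid = λ e → unflip (ε e) (pairEq-true _ _ (allFinᵇ-true E _ v e)) }
  where
  unflip : ∀ {A : Set} {p q : A × A} a → p ≡ flipIf a q → p ≡ q ⊎ p ≡ swap q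
  unflip zero    e = inj₁ e
  unflip (suc _) e = inj₂ e

isoCount-¬iso : ∀ {V E} (f g : Fin E → Fin V × Fin V) →
  let G = record { nv = V ; ne = E ; ends = f } ; H = record { nv = V ; ne = E ; ends = g } in
  ¬ Iso G H → isoCount G H ≡ 0
isoCount-¬iso {V} {E} f g ¬iso = ∑ℕ.∑-zero (allFuns V V) λ σ → when (injᵇ σ) λ iσ →
  ∑ℕ.∑-zero (allFuns E E) λ τ → when (injᵇ τ) λ iτ → ∑ℕ.∑-zero (allFuns E 2) λ ε → off _ λ v →
    ¬iso (valid-iso f g σ τ ε (injᵇ-sound σ iσ) (injᵇ-sound τ iτ) v)
  where
  when : ∀ b {n} → (b ≡ true → n ≡ 0) → b2n b ℕ.* n ≡ 0
  when true  e = trans (ℕₚ.+-identityʳ _) (e refl)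
  when false e = refl
  off : ∀ b → (b ≡ true → ⊥) → b2n b ≡ 0
  off true  e = ⊥-elim (e refl)
  off false e = refl

-- For bijective σ and τ, the triple (σ, τ, ε) is valid for exactly one target, the transported
-- graph `g₀`. The sum therefore counts all triples: V! choices of σ, E! of τ and 2^E of ε. It takes
-- the place of the orbit-stabiliser theorem.
∑-isoCount : ∀ {V E} (f : Fin E → Fin V × Fin V) →
  ∑ℕ.∑ (graphs V E) (λ g → isoCount (record { nv = V ; ne = E ; ends = f }) (toGraph g)) ≡ V ! ℕ.* edgeAut E
∑-isoCount {V} {E} f = begin
  ∑ℕ.∑ (graphs V E) (λ g → isoCount G (toGraph g))
    ≡⟨ ∑ℕ.∑-swap (graphs V E) (allFuns V V) _ ⟩
  ∑ℕ.∑ (allFuns V V) (λ σ → ∑ℕ.∑ (graphs V E) (λ g → b2n (injᵇ σ) ℕ.* ΣT σ g))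
    ≡⟨ ∑ℕ.∑-cong (allFuns V V) (λ σ → trans (∑ℕ.∑-*ˡ (graphs V E) (b2n (injᵇ σ)) (ΣT σ)) (cong (b2n (injᵇ σ) ℕ.*_) (at-σ σ))) ⟩
  ∑ℕ.∑ (allFuns V V) (λ σ → b2n (injᵇ σ) ℕ.* edgeAut E)
    ≡⟨ trans (∑ℕ.∑-*ʳ (allFuns V V) (edgeAut E) (b2n ∘ injᵇ)) (cong (ℕ._* edgeAut E) (permutations V)) ⟩
  V ! ℕ.* edgeAut E ∎
  where
  open ≡-Reasoning
  G = record { nv = V ; ne = E ; ends = f }
  ΣE : (Fin V → Fin V) → (Fin E → Fin E) → Edges V E → ℕ
  ΣE σ τ g = ∑ℕ.∑ (allFuns E 2) (λ ε → b2n (validᵇ G (toGraph g) σ τ ε))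
  ΣT : (Fin V → Fin V) → Edges V E → ℕ
  ΣT σ g = ∑ℕ.∑ (allFuns E E) (λ τ → b2n (injᵇ τ) ℕ.* ΣE σ τ g)
  one : ∀ σ τ ε → Inj τ → ∑ℕ.∑ (graphs V E) (λ g → b2n (validᵇ G (toGraph g) σ τ ε)) ≡ 1
  one σ τ ε iτ = trans (∑ℕ.∑-cong (graphs V E) λ g → b2n-δ (validᵇ G (toGraph g) σ τ ε)) (∑ℕE.∑-unique (vecEnum (pairEnum V) E) g₀ (λ g → validᵇ G (toGraph g) σ τ ε)
    (allFinᵇ-intro E _ λ e → trans (cong (λ p → pairEq p (u e)) (trans (Vecₚ.lookup∘tabulate _ (τ e)) (cong u (iτ (proj₂ (injective-inverse τ iτ (τ e))))))) (pairEq-refl (u e)))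
    (λ g v → lookup-ext g g₀ λ y → trans (cong (lookup g) (sym (proj₂ (injective-inverse τ iτ y)))) (trans (pairEq-true _ _ (allFinᵇ-true E _ v (proj₁ (injective-inverse τ iτ y)))) (sym (Vecₚ.lookup∘tabulate _ y)))))
    where
    u : Fin E → Fin V × Fin V
    u e = flipIf (ε e) (both σ (f e))
    g₀ : Edges V E
    g₀ = Vec.tabulate (λ y → u (proj₁ (injective-inverse τ iτ y)))
    b2n-δ : ∀ b → b2n b ≡ ∑ℕ.δ b
    b2n-δ true  = refl
    b2n-δ false = refl
  at-τ : ∀ σ τ b → injᵇ τ ≡ b → b2n b ℕ.* ∑ℕ.∑ (graphs V E) (ΣE σ τ) ≡ b2n b ℕ.* 2 ^ E
  at-τ σ τ false _ = refl
  at-τ σ τ true  e = cong (1 ℕ.*_) (trans (∑ℕ.∑-swap (graphs V E) (allFuns E 2) _)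
    (trans (∑ℕ.∑-cong (allFuns E 2) λ ε → one σ τ ε (injᵇ-sound τ e)) (∑-allFuns-1 E 2)))
  at-σ : ∀ σ → ∑ℕ.∑ (graphs V E) (ΣT σ) ≡ edgeAut E
  at-σ σ = trans (∑ℕ.∑-swap (graphs V E) (allFuns E E) (λ g τ → b2n (injᵇ τ) ℕ.* ΣE σ τ g))
    (trans (∑ℕ.∑-cong (allFuns E E) λ τ → trans (∑ℕ.∑-*ˡ (graphs V E) (b2n (injᵇ τ)) (ΣE σ τ)) (at-τ σ τ (injᵇ τ) refl))
    (trans (∑ℕ.∑-*ʳ (allFuns E E) (2 ^ E) (b2n ∘ injᵇ)) (cong (ℕ._* 2 ^ E) (permutations E))))

-- If it were 0, every summand of `∑-isoCount` would be 0, for isomorphic and non-isomorphic targets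
-- alike, while the total V! E! 2^E is positive.
autCount≢0 : ∀ G → ℕ.NonZero (autCount G)
autCount≢0 G = ℕ.≢-nonZero λ z → ℕ.≢-nonZero⁻¹ (nv G ! ℕ.* edgeAut (ne G)) {{ℕₚ.m*n≢0 (nv G !) (edgeAut (ne G)) {{nv G !≢0}} {{edgeAut≢0 (ne G)}}}}
  (trans (sym (∑-isoCount (ends G))) (∑ℕ.∑-zero (graphs (nv G) (ne G)) λ g → none z g))
  where
  none : autCount G ≡ 0 → ∀ g → isoCount G (toGraph g) ≡ 0
  none z g with isoCount G (toGraph g) ℕ.≟ 0
  ... | yes e = e
  ... | no ≢0 = isoCount-¬iso (ends G) (lookup g) (λ iso → ≢0 (trans (isoCount-iso (ends G) (lookup g) iso) z))

-- From labelled graphs to isomorphism classes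

sameSize? : ∀ G V E → Dec (nv G ≡ V × ne G ≡ E)
sameSize? G V E = (nv G ℕ.≟ V) ×-dec (ne G ℕ.≟ E)

-- A representative comes with its own numbers of vertices and edges; it is compared with the
-- labelled graphs on V vertices and E edges only if the sizes agree.
isoCountTo : ∀ {V E} (G : Graph) → Dec (nv G ≡ V × ne G ≡ E) → Edges V E → ℕ
isoCountTo G (yes (refl , refl)) g = isoCount G (toGraph g)
isoCountTo G (no _)              g = 0

isoCountTo-iso : ∀ {V E} G d (g : Edges V E) → Iso G (toGraph g) → isoCountTo G d g ≡ autCount G
isoCountTo-iso G (yes (refl , refl)) g iso = isoCount-iso (ends G) (lookup g) iso
isoCountTo-iso G (no ¬size)          g iso = contradiction (bijection-≡ σ σ⁻ σσ⁻ σ⁻σ , bijection-≡ τ τ⁻ ττ⁻ τ⁻τ) ¬size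
  where
  open Iso iso
  bijection-≡ : ∀ {m n} (f : Fin m → Fin n) (f⁻ : Fin n → Fin m) → (∀ y → f (f⁻ y) ≡ y) → (∀ x → f⁻ (f x) ≡ x) → m ≡ n
  bijection-≡ f f⁻ p q = ℕₚ.≤-antisym
    (Finₚ.injective⇒≤ {f = f} λ {x} {y} e → trans (sym (q x)) (trans (cong f⁻ e) (q y)))
    (Finₚ.injective⇒≤ {f = f⁻} λ {x} {y} e → trans (sym (p x)) (trans (cong f e) (p y)))

isoCountTo-¬iso : ∀ {V E} G d (g : Edges V E) → ¬ Iso G (toGraph g) → isoCountTo G d g ≡ 0
isoCountTo-¬iso G (yes (refl , refl)) g ¬iso = isoCount-¬iso (ends G) (lookup g) ¬iso
isoCountTo-¬iso G (no _)              g ¬iso = refl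

∑-isoCountTo : ∀ V E G d → ∑ℕ.∑ (graphs V E) (isoCountTo G d) ≡ b2n (does d) ℕ.* (V ! ℕ.* edgeAut E)
∑-isoCountTo V E G (yes (refl , refl)) = trans (∑-isoCount (ends G)) (sym (ℕₚ.+-identityʳ _))
∑-isoCountTo V E G (no _)              = ∑ℕ.∑-0 (graphs V E)

∑ᵠ-lookup : ∀ {A : Set} (L : List A) (f : A → ℚ) → ∑ᵠ L f ≡ ∑ᵠ (allFin (List.length L)) (f ∘ List.lookup L)
∑ᵠ-lookup []      f = refl
∑ᵠ-lookup (a ∷ L) f = trans (cong (f a ℚ.+_) (∑ᵠ-lookup L f)) (sym (∑ℚ.∑-allFin-suc (List.length L) (f ∘ List.lookup (a ∷ L))))

castᵠ-∑ : ∀ {A : Set} (as : List A) (f : A → ℕ) → castᵠ (∑ℕ.∑ as f) ≡ ∑ᵠ as (castᵠ ∘ f)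
castᵠ-∑ []       f = refl
castᵠ-∑ (a ∷ as) f = trans (castᵠ-+ (f a) _) (cong (castᵠ (f a) ℚ.+_) (castᵠ-∑ as f))

orbitWeight : ℕ → ℕ → ℚ
orbitWeight V E = inv (V !) ℚ.* inv (edgeAut E)

orbitWeight-inverse : ∀ V E → orbitWeight V E ℚ.* castᵠ (V ! ℕ.* edgeAut E) ≡ 1ℚ
orbitWeight-inverse V E = trans (cong (ℚ._* castᵠ (V ! ℕ.* edgeAut E)) (sym (inv-* (V !) (edgeAut E) {{V !≢0}} {{edgeAut≢0 E}})))
  (inv-nonZero (V ! ℕ.* edgeAut E) {{ℕₚ.m*n≢0 (V !) (edgeAut E) {{V !≢0}} {{edgeAut≢0 E}}}})

module Orbits
  (Q : Graph → Set) (Q-iso : ∀ {G H} → Iso G H → Q G → Q H)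
  (v : Graph → ℚ) (v-iso : ∀ {G H} → Iso G H → v G ≡ v H)
  (L : List Graph)
  (complete : ∀ G → Q G → ∃[ i ] Iso (List.lookup L i) G)
  (unique : ∀ i j → Iso (List.lookup L i) (List.lookup L j) → i ≡ j)
  where

  module _ V E (f : Edges V E → ℚ)
    (f-spec : ∀ g → (Q (toGraph g) × f g ≡ v (toGraph g)) ⊎ (¬ Q (toGraph g) × f g ≡ 0ℚ))
    (sound : ∀ i → Q (List.lookup L i))
    where

    private
      c : Graph → Edges V E → ℕ
      c G = isoCountTo G (sameSize? G V E)

      -- The number of isomorphisms from `G` to `g` is |Aut G| or 0, so this is a form of "v(g) if
      -- `g` is isomorphic to `G`, else 0" that can be summed over `g`.
      share : Graph → Edges V E → ℚ
      share G g = castᵠ (c G g) ℚ.* (inv (autCount G) ℚ.* v G)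

      share-zero : ∀ G g → ¬ Iso G (toGraph g) → share G g ≡ 0ℚ
      share-zero G g ¬iso = trans (cong (λ n → castᵠ n ℚ.* (inv (autCount G) ℚ.* v G)) (isoCountTo-¬iso G (sameSize? G V E) g ¬iso)) (ℚₚ.*-zeroˡ (inv (autCount G) ℚ.* v G))

      share-iso : ∀ G g → Iso G (toGraph g) → share G g ≡ v (toGraph g)
      share-iso G g iso = begin
        castᵠ (c G g) ℚ.* (inv (autCount G) ℚ.* v G)          ≡⟨ cong (λ n → castᵠ n ℚ.* (inv (autCount G) ℚ.* v G)) (isoCountTo-iso G (sameSize? G V E) g iso) ⟩
        castᵠ (autCount G) ℚ.* (inv (autCount G) ℚ.* v G)     ≡⟨ sym (ℚₚ.*-assoc (castᵠ (autCount G)) (inv (autCount G)) (v G)) ⟩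
        castᵠ (autCount G) ℚ.* inv (autCount G) ℚ.* v G       ≡⟨ cong (ℚ._* v G) (trans (ℚₚ.*-comm (castᵠ (autCount G)) (inv (autCount G))) (inv-nonZero (autCount G) {{autCount≢0 G}})) ⟩
        1ℚ ℚ.* v G                                            ≡⟨ trans (ℚₚ.*-identityˡ (v G)) (v-iso iso) ⟩
        v (toGraph g) ∎
        where open ≡-Reasoning

      shares : ∀ g → f g ≡ ∑ᵠ (allFin (List.length L)) (λ i → share (List.lookup L i) g)
      shares g with f-spec g
      ... | inj₂ (¬q , fg) = trans fg (sym (∑ℚ.∑-zero (allFin (List.length L)) λ i → share-zero (List.lookup L i) g λ iso → ¬q (Q-iso iso (sound i))))
      ... | inj₁ (q , fg) with complete (toGraph g) q
      ...   | i₀ , iso₀ = begin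
        f g
          ≡⟨ trans fg (sym (share-iso (List.lookup L i₀) g iso₀)) ⟩
        share (List.lookup L i₀) g
          ≡⟨ sym (∑ℚE.∑-δ (finEnum (List.length L)) i₀ (λ i → share (List.lookup L i) g)) ⟩
        ∑ᵠ (allFin (List.length L)) (λ i → δᵠ (does (i Fin.≟ i₀)) ℚ.* share (List.lookup L i) g)
          ≡⟨ ∑ℚ.∑-cong (allFin (List.length L)) each ⟩
        ∑ᵠ (allFin (List.length L)) (λ i → share (List.lookup L i) g) ∎
        where
        open ≡-Reasoning
        each : ∀ i → δᵠ (does (i Fin.≟ i₀)) ℚ.* share (List.lookup L i) g ≡ share (List.lookup L i) g
        each i with i Fin.≟ i₀
        ... | yes _ = ℚₚ.*-identityˡ (share (List.lookup L i) g)
        ... | no i≢ = trans (ℚₚ.*-zeroˡ (share (List.lookup L i) g)) (sym (share-zero (List.lookup L i) g λ iso → i≢ (unique i i₀ (iso-trans iso (iso-sym iso₀)))))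

    -- After each `f g` is replaced by the shares of all representatives and the sums are exchanged,
    -- the labelled graphs contribute V! E! 2^E isomorphisms from each `G` of the right size.
    -- `orbitWeight` cancels this number and v(G)/|Aut G| remains.
    orbit-sum : orbitWeight V E ℚ.* ∑ᵠ (graphs V E) f ≡ ∑ᵠ L (λ G → δᵠ (does (sameSize? G V E)) ℚ.* (inv (autCount G) ℚ.* v G))
    orbit-sum = begin
      orbitWeight V E ℚ.* ∑ᵠ (graphs V E) f
        ≡⟨ cong (orbitWeight V E ℚ.*_) (trans (∑ℚ.∑-cong (graphs V E) λ g → trans (shares g) (sym (∑ᵠ-lookup L (λ G → share G g)))) (∑ℚ.∑-swap (graphs V E) L (λ g G → share G g))) ⟩
      orbitWeight V E ℚ.* ∑ᵠ L (λ G → ∑ᵠ (graphs V E) (share G))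
        ≡⟨ sym (∑ℚ.∑-*ˡ L (orbitWeight V E) (λ G → ∑ᵠ (graphs V E) (share G))) ⟩
      ∑ᵠ L (λ G → orbitWeight V E ℚ.* ∑ᵠ (graphs V E) (share G))
        ≡⟨ ∑ℚ.∑-cong L each ⟩
      ∑ᵠ L (λ G → δᵠ (does (sameSize? G V E)) ℚ.* (inv (autCount G) ℚ.* v G)) ∎
      where
      open ≡-Reasoning
      each : ∀ G → orbitWeight V E ℚ.* ∑ᵠ (graphs V E) (share G) ≡ δᵠ (does (sameSize? G V E)) ℚ.* (inv (autCount G) ℚ.* v G)
      each G = begin
        orbitWeight V E ℚ.* ∑ᵠ (graphs V E) (share G)
          ≡⟨ cong (orbitWeight V E ℚ.*_) (trans (∑ℚ.∑-*ʳ (graphs V E) w (castᵠ ∘ c G)) (cong (ℚ._* w) (trans (sym (castᵠ-∑ (graphs V E) (c G))) (cong castᵠ (∑-isoCountTo V E G (sameSize? G V E)))))) ⟩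
        orbitWeight V E ℚ.* (castᵠ (b2n b ℕ.* o) ℚ.* w)
          ≡⟨ cong (λ q → orbitWeight V E ℚ.* (q ℚ.* w)) (trans (castᵠ-* (b2n b) o) (cong (ℚ._* castᵠ o) (∑ℚ.cast-b2n b))) ⟩
        orbitWeight V E ℚ.* (δᵠ b ℚ.* castᵠ o ℚ.* w)
          ≡⟨ solveᵠ 4 (λ a d k w → a :*″ ((d :*″ k) :*″ w) :=″ (a :*″ k) :*″ (d :*″ w)) refl (orbitWeight V E) (δᵠ b) (castᵠ o) w ⟩
        orbitWeight V E ℚ.* castᵠ o ℚ.* (δᵠ b ℚ.* w)
          ≡⟨ trans (cong (ℚ._* (δᵠ b ℚ.* w)) (orbitWeight-inverse V E)) (ℚₚ.*-identityˡ (δᵠ b ℚ.* w)) ⟩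
        δᵠ b ℚ.* w ∎
        where
        b = does (sameSize? G V E)
        o = V ! ℕ.* edgeAut E
        w = inv (autCount G) ℚ.* v G

-- Isomorphism invariance

sumFin-reindex : ∀ {m n} (σ : Fin m → Fin n) (σ⁻ : Fin n → Fin m) → (∀ y → σ (σ⁻ y) ≡ y) → (∀ x → σ⁻ (σ x) ≡ x) →
  ∀ f → sumFin m (f ∘ σ) ≡ sumFin n f
sumFin-reindex {m} {n} σ σ⁻ p q f = trans (sumFin-∑ m (f ∘ σ)) (trans (∑ℕE.∑-reindex (finEnum m) (finEnum n) σ σ⁻ p q f) (sym (sumFin-∑ n f)))

adjacentBlack : ∀ {V} → (Fin V → Fin 2) → Fin V → Fin V × Fin V → ℕ
adjacentBlack c x p = if proj₁ p =ᶠ proj₂ p then 0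
  else b2n ((proj₁ p =ᶠ x) ∧ isBlack (c (proj₂ p))) ℕ.+ b2n ((proj₂ p =ᶠ x) ∧ isBlack (c (proj₁ p)))

module _ {G H : Graph} (iso : Iso G H) where
  open Iso iso
  private
    σ-injective : Inj σ
    σ-injective = σ-inj iso

  -- Degrees and numbers of black neighbours are both sums over edges of a function that is
  -- symmetric in the two ends, so an isomorphism may reverse edges freely.
  edge-sum-iso : (F : Fin (nv G) × Fin (nv G) → ℕ) (F′ : Fin (nv H) × Fin (nv H) → ℕ) →
    (∀ p → F′ (swap p) ≡ F′ p) → (∀ p → F′ (both σ p) ≡ F p) → sumFin (ne H) (F′ ∘ ends H) ≡ sumFin (ne G) (F ∘ ends G)
  edge-sum-iso F F′ sw eq = trans (sym (sumFin-reindex τ τ⁻ ττ⁻ τ⁻τ (F′ ∘ ends H))) (sumFin-cong (ne G) λ e → step e (incid e))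
    where
    step : ∀ e → ends H (τ e) ≡ both σ (ends G e) ⊎ ends H (τ e) ≡ swap (both σ (ends G e)) → F′ (ends H (τ e)) ≡ F (ends G e)
    step e (inj₁ q) = trans (cong F′ q) (eq (ends G e))
    step e (inj₂ q) = trans (cong F′ q) (trans (sw (both σ (ends G e))) (eq (ends G e)))

  iso-degree : ∀ x → degree H (σ x) ≡ degree G x
  iso-degree x = edge-sum-iso (λ p → touches p x) (λ p → touches p (σ x))
    (λ p → ℕₚ.+-comm (b2n (proj₂ p =ᶠ σ x)) (b2n (proj₁ p =ᶠ σ x))) (λ p → touches-inj σ σ-injective p x)

  iso-profile : ∀ n → HasProfile n G → HasProfile n H
  iso-profile n (pos , counts) =
    (λ y e → pos (σ⁻ y) (trans (sym (iso-degree (σ⁻ y))) (trans (cong (degree H) (σσ⁻ y)) e))) ,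
    (λ k → trans (sym (sumFin-reindex σ σ⁻ σσ⁻ σ⁻σ (λ y → b2n (degree H y ≡ᵇ suc k))))
      (trans (sumFin-cong (nv G) λ x → cong (λ d → b2n (d ≡ᵇ suc k)) (iso-degree x)) (counts k)))

  iso-reach : ∀ {x y} → Reach G x y → Reach H (σ x) (σ y)
  iso-reach here = here
  iso-reach (fwd e p) with incid e
  ... | inj₁ q = reach-trans (subst (λ r → Reach H (proj₁ r) (proj₂ r)) q (fwd (τ e) here)) (iso-reach p)
  ... | inj₂ q = reach-trans (subst (λ r → Reach H (proj₂ r) (proj₁ r)) q (bwd (τ e) here)) (iso-reach p)
  iso-reach (bwd e p) with incid e
  ... | inj₁ q = reach-trans (subst (λ r → Reach H (proj₂ r) (proj₁ r)) q (bwd (τ e) here)) (iso-reach p)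
  ... | inj₂ q = reach-trans (subst (λ r → Reach H (proj₁ r) (proj₂ r)) q (fwd (τ e) here)) (iso-reach p)

  iso-connected : Connected G → Connected H
  iso-connected (x , r) = σ x , λ y z → subst (λ y → Reach H y z) (σσ⁻ y) (subst (Reach H (σ (σ⁻ y))) (σσ⁻ z) (iso-reach (r (σ⁻ y) (σ⁻ z))))

  iso-blackNbrs : ∀ c x → blackNbrs H c (σ x) ≡ blackNbrs G (c ∘ σ) x
  iso-blackNbrs c x = edge-sum-iso (adjacentBlack (c ∘ σ) x) (adjacentBlack c (σ x))
    (λ p → cong₂ (λ b t → if b then 0 else t) (=ᶠ-sym (proj₂ p) (proj₁ p)) (ℕₚ.+-comm (b2n ((proj₂ p =ᶠ σ x) ∧ isBlack (c (proj₁ p)))) _))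
    (λ p → cong₂ (λ b t → if b then 0 else t) (=ᶠ-inj σ σ-injective (proj₁ p) (proj₂ p))
      (cong₂ (λ a b → b2n (a ∧ isBlack (c (σ (proj₂ p)))) ℕ.+ b2n (b ∧ isBlack (c (σ (proj₁ p))))) (=ᶠ-inj σ σ-injective (proj₁ p) x) (=ᶠ-inj σ σ-injective (proj₂ p) x)))

evenWhites : (G : Graph) → (Fin (nv G) → Fin 2) → ℕ
evenWhites G c = sumFin (nv G) (λ x → b2n (evenWhite G c x))

evenWhites-ext : ∀ G c d → (∀ x → c x ≡ d x) → evenWhites G c ≡ evenWhites G d
evenWhites-ext G c d e = sumFin-cong (nv G) λ x → cong₂ (λ a n → b2n (not (isBlack a) ∧ evenᵇ n)) (e x)
  (sumFin-cong (ne G) λ i → cong₂ (λ a b → if proj₁ (ends G i) =ᶠ proj₂ (ends G i) then 0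
    else b2n ((proj₁ (ends G i) =ᶠ x) ∧ isBlack b) ℕ.+ b2n ((proj₂ (ends G i) =ᶠ x) ∧ isBlack a)) (e (proj₁ (ends G i))) (e (proj₂ (ends G i))))

Wcoeff-∑ : ∀ G j → Wcoeff G j ≡ ∑ℕ.∑ (colourings (nv G)) (λ cs → b2n (evenWhites G (lookup cs) ≡ᵇ j))
Wcoeff-∑ G j = trans (countL-∑ (λ c → evenWhites G c ≡ᵇ j) (allFuns (nv G) 2))
  (Fun.∑-allFuns (nv G) 2 (λ c → b2n (evenWhites G c ≡ᵇ j)) (λ c d e → cong (λ k → b2n (k ≡ᵇ j)) (evenWhites-ext G c d e)))

iso-Wcoeff : ∀ {G H} → Iso G H → ∀ j → Wcoeff G j ≡ Wcoeff H j
iso-Wcoeff {G} {H} iso j = begin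
  Wcoeff G j
    ≡⟨ Wcoeff-∑ G j ⟩
  ∑ℕ.∑ (colourings (nv G)) (λ cs → b2n (evenWhites G (lookup cs) ≡ᵇ j))
    ≡⟨ sym (∑ℕE.∑-reindex (vecEnum (finEnum 2) (nv H)) (vecEnum (finEnum 2) (nv G)) (pull σ) (pull σ⁻)
         (pull-inverse σ σ⁻ σ⁻σ) (pull-inverse σ⁻ σ σσ⁻) (λ cs → b2n (evenWhites G (lookup cs) ≡ᵇ j))) ⟩
  ∑ℕ.∑ (colourings (nv H)) (λ cs → b2n (evenWhites G (lookup (pull σ cs)) ≡ᵇ j))
    ≡⟨ ∑ℕ.∑-cong (colourings (nv H)) (λ cs → cong (λ k → b2n (k ≡ᵇ j)) (same cs)) ⟩
  ∑ℕ.∑ (colourings (nv H)) (λ cs → b2n (evenWhites H (lookup cs) ≡ᵇ j))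
    ≡⟨ sym (Wcoeff-∑ H j) ⟩
  Wcoeff H j ∎
  where
  open ≡-Reasoning
  open Iso iso
  pull : ∀ {m n} → (Fin m → Fin n) → Vec (Fin 2) n → Vec (Fin 2) m
  pull f cs = Vec.tabulate (lookup cs ∘ f)
  pull-inverse : ∀ {m n} (f : Fin m → Fin n) (f⁻ : Fin n → Fin m) → (∀ x → f⁻ (f x) ≡ x) → ∀ cs → pull f (pull f⁻ cs) ≡ cs
  pull-inverse f f⁻ q cs = lookup-ext _ cs λ x → trans (Vecₚ.lookup∘tabulate _ x) (trans (Vecₚ.lookup∘tabulate _ (f x)) (cong (lookup cs) (q x)))
  same : ∀ cs → evenWhites G (lookup (pull σ cs)) ≡ evenWhites H (lookup cs)
  same cs = trans (evenWhites-ext G (lookup (pull σ cs)) (lookup cs ∘ σ) (Vecₚ.lookup∘tabulate _))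
    (trans (sumFin-cong (nv G) λ x → cong (λ k → b2n (not (isBlack (lookup cs (σ x))) ∧ evenᵇ k)) (sym (iso-blackNbrs iso (lookup cs) x)))
      (sumFin-reindex σ σ⁻ σσ⁻ σ⁻σ (λ y → b2n (evenWhite H (lookup cs) y))))

-- Degrees and profiles

sumFin-swap : ∀ m n (f : Fin m → Fin n → ℕ) → sumFin m (λ x → sumFin n (f x)) ≡ sumFin n (λ y → sumFin m (λ x → f x y))
sumFin-swap zero    n f = sym (sumFin-0 n)
sumFin-swap (suc m) n f = trans (cong (sumFin n (f zero) ℕ.+_) (sumFin-swap m n (f ∘ suc))) (sym (sumFin-+ n (f zero) (λ y → sumFin m (λ x → f (suc x) y))))

sumFin-const : ∀ n k → sumFin n (λ _ → k) ≡ n ℕ.* k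
sumFin-const zero    k = refl
sumFin-const (suc n) k = cong (k ℕ.+_) (sumFin-const n k)

handshake : ∀ G → sumFin (nv G) (degree G) ≡ ne G ℕ.* 2
handshake G = trans (sumFin-swap (nv G) (ne G) (λ x e → touches (ends G e) x))
  (trans (sumFin-cong (ne G) λ e → sumFin-touches (ends G e)) (sumFin-const (ne G) 2))

sumFin-≡0 : ∀ n f → sumFin n f ≡ 0 → ∀ x → f x ≡ 0
sumFin-≡0 (suc n) f e zero    = ℕₚ.m+n≡0⇒m≡0 (f zero) e
sumFin-≡0 (suc n) f e (suc x) = sumFin-≡0 n (f ∘ suc) (ℕₚ.m+n≡0⇒n≡0 (f zero) e) x

weightFrom : ℕ → Profile → ℕ
weightFrom k []       = 0
weightFrom k (a ∷ as) = k ℕ.* a ℕ.+ weightFrom (suc k) as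

weightFrom-unique : (w : ℕ → Profile → ℕ) → (∀ k → w k [] ≡ 0) → (∀ k a as → w k (a ∷ as) ≡ k ℕ.* a ℕ.+ w (suc k) as) →
  ∀ k n → w k n ≡ weightFrom k n
weightFrom-unique w e₀ e₁ k []       = e₀ k
weightFrom-unique w e₀ e₁ k (a ∷ as) = trans (e₁ k a as) (cong (k ℕ.* a ℕ.+_) (weightFrom-unique w e₀ e₁ (suc k) as))

-- The local function of weight is not in scope here; it is recovered by unification.
mutual
  weightGo : ℕ → Profile → ℕ
  weightGo = _

  weight≡weightFrom : ∀ n → weight n ≡ weightFrom 1 n
  weight≡weightFrom n with 1
  ... | k = weightFrom-unique weightGo (λ _ → refl) (λ _ _ _ → refl) k n

-- The vertices are grouped by degree, starting from degree k. When the list is exhausted, all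
-- further counts are 0, so no vertex of degree at least k is left.
sumFin-by-value : ∀ V (d : Fin V → ℕ) k n → (∀ i → sumFin V (λ x → b2n (d x ≡ᵇ k ℕ.+ i)) ≡ nth0 n i) →
  weightFrom k n ≡ sumFin V (λ x → b2n (k ℕ.≤ᵇ d x) ℕ.* d x)
sumFin-by-value V d k [] counts = sym (trans (sumFin-cong V none) (sumFin-0 V))
  where
  none : ∀ x → b2n (k ℕ.≤ᵇ d x) ℕ.* d x ≡ 0
  none x with k ℕ.≤ᵇ d x in e
  ... | false = refl
  ... | true  = contradiction (trans (sym (cong b2n (trans (cong (d x ≡ᵇ_) (ℕₚ.m+[n∸m]≡n k≤d)) (≡ᵇ-refl (d x)))))
                  (sumFin-≡0 V (λ y → b2n (d y ≡ᵇ k ℕ.+ (d x ∸ k))) (counts (d x ∸ k)) x)) λ ()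
    where
    k≤d : k ≤ d x
    k≤d = ℕₚ.≤ᵇ⇒≤ k (d x) (Boolₚ.T-≡ .Equivalence.from e)
sumFin-by-value V d k (a ∷ as) counts = begin
  k ℕ.* a ℕ.+ weightFrom (suc k) as
    ≡⟨ cong₂ (λ p q → k ℕ.* p ℕ.+ q) (sym (trans (sumFin-cong V λ x → cong (λ l → b2n (d x ≡ᵇ l)) (sym (ℕₚ.+-identityʳ k))) (counts 0)))
         (sumFin-by-value V d (suc k) as λ i → trans (sumFin-cong V λ x → cong (λ l → b2n (d x ≡ᵇ l)) (sym (ℕₚ.+-suc k i))) (counts (suc i))) ⟩
  k ℕ.* sumFin V (λ x → b2n (d x ≡ᵇ k)) ℕ.+ sumFin V (λ x → b2n (suc k ℕ.≤ᵇ d x) ℕ.* d x)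
    ≡⟨ cong (ℕ._+ sumFin V (λ x → b2n (suc k ℕ.≤ᵇ d x) ℕ.* d x)) (sumFin-*ˡ V k (λ x → b2n (d x ≡ᵇ k))) ⟩
  sumFin V (λ x → k ℕ.* b2n (d x ≡ᵇ k)) ℕ.+ sumFin V (λ x → b2n (suc k ℕ.≤ᵇ d x) ℕ.* d x)
    ≡⟨ sym (sumFin-+ V (λ x → k ℕ.* b2n (d x ≡ᵇ k)) (λ x → b2n (suc k ℕ.≤ᵇ d x) ℕ.* d x)) ⟩
  sumFin V (λ x → k ℕ.* b2n (d x ≡ᵇ k) ℕ.+ b2n (suc k ℕ.≤ᵇ d x) ℕ.* d x)
    ≡⟨ sumFin-cong V (λ x → split-at k (d x)) ⟩
  sumFin V (λ x → b2n (k ℕ.≤ᵇ d x) ℕ.* d x) ∎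
  where
  open ≡-Reasoning
  sumFin-*ˡ : ∀ n c f → c ℕ.* sumFin n f ≡ sumFin n (λ x → c ℕ.* f x)
  sumFin-*ˡ zero    c f = ℕₚ.*-zeroʳ c
  sumFin-*ˡ (suc n) c f = trans (ℕₚ.*-distribˡ-+ c (f zero) _) (cong (c ℕ.* f zero ℕ.+_) (sumFin-*ˡ n c (f ∘ suc)))
  ≤ᵇ-true : ∀ {m n} → m ≤ n → (m ℕ.≤ᵇ n) ≡ true
  ≤ᵇ-true le = Boolₚ.T-≡ .Equivalence.to (ℕₚ.≤⇒≤ᵇ le)
  ≤ᵇ-false : ∀ {m n} → n < m → (m ℕ.≤ᵇ n) ≡ false
  ≤ᵇ-false {m} {n} lt with m ℕ.≤ᵇ n in e
  ... | false = refl
  ... | true  = contradiction (ℕₚ.≤ᵇ⇒≤ m n (Boolₚ.T-≡ .Equivalence.from e)) (ℕₚ.<⇒≱ lt)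
  ≡ᵇ-false : ∀ {m n} → m ≢ n → (m ≡ᵇ n) ≡ false
  ≡ᵇ-false {m} {n} ≢ with m ≡ᵇ n in e
  ... | false = refl
  ... | true  = contradiction (≡ᵇ-true m n e) ≢
  split-at : ∀ k n → k ℕ.* b2n (n ≡ᵇ k) ℕ.+ b2n (suc k ℕ.≤ᵇ n) ℕ.* n ≡ b2n (k ℕ.≤ᵇ n) ℕ.* n
  split-at k n with ℕₚ.<-cmp n k
  ... | Tri.tri< lt ≢ _ rewrite ≡ᵇ-false ≢ | ≤ᵇ-false (ℕₚ.m<n⇒m<1+n lt) | ≤ᵇ-false lt = trans (ℕₚ.+-identityʳ _) (ℕₚ.*-zeroʳ k)
  ... | Tri.tri≈ _ refl _ rewrite ≡ᵇ-refl k | ≤ᵇ-false (ℕₚ.n<1+n k) | ≤ᵇ-true (ℕₚ.≤-refl {k}) = trans (ℕₚ.+-identityʳ _) (ℕₚ.*-comm k 1)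
  ... | Tri.tri> _ ≢ gt rewrite ≡ᵇ-false ≢ | ≤ᵇ-true gt | ≤ᵇ-true (ℕₚ.<⇒≤ gt) = cong (ℕ._+ (n ℕ.+ 0)) (ℕₚ.*-zeroʳ k)

-- No vertex has degree 0, so the grouping from degree 1 on covers all vertices and the weight is
-- the degree sum.
profile-weight : ∀ n G → HasProfile n G → weight n ≡ ne G ℕ.* 2
profile-weight n G (pos , counts) = trans (weight≡weightFrom n) (trans (sumFin-by-value (nv G) (degree G) 1 n counts)
  (trans (sumFin-cong (nv G) λ x → all-positive (degree G x)) (handshake G)))
  where
  all-positive : ∀ k → b2n (1 ℕ.≤ᵇ k) ℕ.* k ≡ k
  all-positive zero    = refl
  all-positive (suc k) = ℕₚ.+-identityʳ (suc k)

profile-size : ∀ n G → HasProfile n G → nv G ≤ ne G ℕ.* 2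
profile-size n G (pos , _) = ℕₚ.≮⇒≥ λ lt → let (x , e) = pigeonhole-zero (nv G) (degree G) (subst (_< nv G) (sym (handshake G)) lt) in pos x e

-- Coefficients of the weight of a graph

deg≡degree : ∀ {V E} (cs : Vec (Fin 2) V) (g : Edges V E) x → deg cs g x ≡ degree (toGraph g) x
deg≡degree cs []      x = refl
deg≡degree cs (e ∷ g) x = trans (deg-∷ cs e g x) (cong (touches e x ℕ.+_) (deg≡degree cs g x))

-- For a white vertex the other colour is black. The two counts are compared edge by edge, according
-- to whether the edge is a loop and which of its ends is `x`.
blackNbrs≡halfCount : ∀ {V E} (cs : Vec (Fin 2) V) (g : Edges V E) x → lookup cs x ≡ zero →
  blackNbrs (toGraph g) (lookup cs) x ≡ halfCount cs g (suc zero) x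
blackNbrs≡halfCount cs []            x cx = refl
blackNbrs≡halfCount cs ((a , b) ∷ g) x cx = cong₂ ℕ._+_ (edge (a =ᶠ b) refl (a =ᶠ x) refl (b =ᶠ x) refl) (blackNbrs≡halfCount cs g x cx)
  where
  c = lookup cs
  sideOf-same : ∀ d → (sideOf d d =ᶠ suc zero) ≡ false
  sideOf-same zero    = refl
  sideOf-same (suc d) = refl
  sideOf-white : ∀ d → (sideOf zero d =ᶠ suc zero) ≡ isBlack d
  sideOf-white zero    = refl
  sideOf-white (suc d) = refl
  sideOf-comm : ∀ d d′ → sideOf d d′ ≡ sideOf d′ d
  sideOf-comm zero    zero    = refl
  sideOf-comm zero    (suc _) = refl
  sideOf-comm (suc _) zero    = refl
  sideOf-comm (suc _) (suc _) = refl
  black-a : (a =ᶠ x) ≡ true → (side cs a b =ᶠ suc zero) ≡ isBlack (c b)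
  black-a ex = trans (cong (λ d → sideOf d (c b) =ᶠ suc zero) (trans (cong c (=ᶠ-true ex)) cx)) (sideOf-white (c b))
  black-b : (b =ᶠ x) ≡ true → (side cs a b =ᶠ suc zero) ≡ isBlack (c a)
  black-b ex = trans (cong (λ s → s =ᶠ suc zero) (sideOf-comm (c a) (c b))) (trans (cong (λ d → sideOf d (c a) =ᶠ suc zero) (trans (cong c (=ᶠ-true ex)) cx)) (sideOf-white (c a)))
  edge : ∀ l → (a =ᶠ b) ≡ l → ∀ p → (a =ᶠ x) ≡ p → ∀ q → (b =ᶠ x) ≡ q →
    (if l then 0 else b2n (p ∧ isBlack (c b)) ℕ.+ b2n (q ∧ isBlack (c a))) ≡ b2n (side cs a b =ᶠ suc zero) ℕ.* (b2n p ℕ.+ b2n q)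
  -- The ends of a loop have equal colours, so it never lies on the other side, in agreement with
  -- `blackNbrs` skipping loops.
  edge true  el p _ q _ = sym (cong (λ t → b2n t ℕ.* (b2n p ℕ.+ b2n q)) (trans (cong (λ y → sideOf (c a) (c y) =ᶠ suc zero) (sym (=ᶠ-true el))) (sideOf-same (c a))))
  edge false el true  ep true  eq = contradiction (trans (sym el) (trans (cong₂ _=ᶠ_ (=ᶠ-true ep) (=ᶠ-true eq)) (=ᶠ-refl x))) λ ()
  edge false el true  ep false eq = trans (cong (λ t → b2n t ℕ.+ 0) (sym (black-a ep))) (trans (ℕₚ.+-identityʳ _) (sym (ℕₚ.*-identityʳ _)))
  edge false el false ep true  eq = trans (cong b2n (sym (black-b eq))) (sym (ℕₚ.*-identityʳ _))
  edge false el false ep false eq = sym (ℕₚ.*-zeroʳ (b2n (side cs a b =ᶠ suc zero)))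

evenWhite≡ : ∀ {V E} (cs : Vec (Fin 2) V) (g : Edges V E) x →
  evenWhite (toGraph g) (lookup cs) x ≡ not (isBlack (lookup cs x)) ∧ evenᵇ (halfCount cs g (suc zero) x)
evenWhite≡ cs g x with lookup cs x in e
... | zero  = cong evenᵇ (blackNbrs≡halfCount cs g x e)
... | suc _ = refl

-- The monomial t^e ξ_(k+1). The shift by one arises because ξ_1 stands at position 5, right after
-- z.
vertexMono : ℕ → ℕ → Mono
vertexMono e k = e ∷ 0 ∷ 0 ∷ 0 ∷ 0 ∷ (List.replicate k 0 ++ (1 ∷ []))

nth0-vertexMono : ∀ e k i → nth0 (vertexMono e k) (5 ℕ.+ i) ≡ b2n (k ≡ᵇ i)
nth0-vertexMono e zero    zero    = refl
nth0-vertexMono e zero    (suc i) = refl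
nth0-vertexMono e (suc k) zero    = refl
nth0-vertexMono e (suc k) (suc i) = nth0-vertexMono e k i

ω-term : ∀ c a b k → a ℕ.+ b ≡ suc k → ω c a b ≈ term (vertexMono (b2n (not (isBlack c) ∧ evenᵇ b)) k)
ω-term c a b k e = ≈-trans (P.*-congˡ {pc c b} (≈-reflexive (cong ξ e))) (go c)
  where
  pp-term : ∀ t → (if t then tV else oneP) ⊗ ξ (suc k) ≈ term (vertexMono (b2n t) k)
  pp-term true  = term-⊗ (1 ∷ []) (vertexMono 0 k)
  pp-term false = ⊗-identityˡ (ξ (suc k))
  go : ∀ c → pc c b ⊗ ξ (suc k) ≈ term (vertexMono (b2n (not (isBlack c) ∧ evenᵇ b)) k)
  go zero    = pp-term (evenᵇ b)
  go (suc _) = pp-term false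

∏Mono : ∀ V → (Fin V → Mono) → Mono
∏Mono zero    m = []
∏Mono (suc V) m = addMono (m zero) (∏Mono V (m ∘ suc))

nth0-∏Mono : ∀ V m i → nth0 (∏Mono V m) i ≡ sumFin V (λ x → nth0 (m x) i)
nth0-∏Mono zero    m i = refl
nth0-∏Mono (suc V) m i = trans (nth0-addMono (m zero) (∏Mono V (m ∘ suc)) i) (cong (nth0 (m zero) i ℕ.+_) (nth0-∏Mono V (m ∘ suc) i))

∏-term : ∀ V f m → (∀ x → f x ≈ term (m x)) → ∏ V f ≈ term (∏Mono V m)
∏-term zero    f m e = ≈-refl
∏-term (suc V) f m e = ≈-trans (⊗-cong (e zero) (∏-term V (f ∘ suc) (m ∘ suc) (e ∘ suc))) (term-⊗ (m zero) (∏Mono V (m ∘ suc)))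

coeff-term : ∀ m m′ → coeff m (term m′) ≡ δᵠ (monoEq m m′)
coeff-term m m′ = trans (coeff≡eval m (term m′)) (eval-term m′ (indicator m))

NoBWYZ : Mono → Set
NoBWYZ m = nth0 m 1 ≡ 0 × nth0 m 2 ≡ 0 × nth0 m 3 ≡ 0 × nth0 m 4 ≡ 0

module _ {V E} (g : Edges V E) where
  private
    G = toGraph g
    d = degree G

    -- Without isolated vertices, each colouring contributes this single monomial. Its ξ-exponents
    -- are then the degree profile whatever the colouring; only the exponent of t varies, and it is
    -- the number of even-white vertices.
    colouringMono : Vec (Fin 2) V → Mono
    colouringMono cs = ∏Mono V (λ x → vertexMono (b2n (not (isBlack (lookup cs x)) ∧ evenᵇ (halfCount cs g (suc zero) x))) (ℕ.pred (d x)))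

    weight-term : (∀ x → d x ≡ 0 → ⊥) → ∀ cs → ∏ V (vertexWeight cs g) ≈ term (colouringMono cs)
    weight-term pos cs = ∏-term V (vertexWeight cs g) _ λ x →
      ω-term (lookup cs x) (halfCount cs g zero x) (halfCount cs g (suc zero) x) (ℕ.pred (d x)) (trans (deg≡degree cs g x) (suc-pred′ (d x) (pos x)))
      where
      suc-pred′ : ∀ n → (n ≡ 0 → ⊥) → n ≡ suc (ℕ.pred n)
      suc-pred′ zero    p = ⊥-elim (p refl)
      suc-pred′ (suc n) p = refl

    t-exponent : ∀ cs → nth0 (colouringMono cs) 0 ≡ evenWhites G (lookup cs)
    t-exponent cs = trans (nth0-∏Mono V _ 0) (sumFin-cong V λ x → cong b2n (sym (evenWhite≡ cs g x)))

    bwyz-exponents : ∀ cs → NoBWYZ (colouringMono cs)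
    bwyz-exponents cs = none 1 (λ _ → refl) , none 2 (λ _ → refl) , none 3 (λ _ → refl) , none 4 (λ _ → refl)
      where
      none : ∀ i → (∀ x → nth0 (vertexMono (b2n (not (isBlack (lookup cs x)) ∧ evenᵇ (halfCount cs g (suc zero) x))) (ℕ.pred (d x))) i ≡ 0) → nth0 (colouringMono cs) i ≡ 0
      none i z = trans (nth0-∏Mono V _ i) (trans (sumFin-cong V z) (sumFin-0 V))

    ξ-exponents : (∀ x → d x ≡ 0 → ⊥) → ∀ cs i → nth0 (colouringMono cs) (5 ℕ.+ i) ≡ sumFin V (λ x → b2n (d x ≡ᵇ suc i))
    ξ-exponents pos cs i = trans (nth0-∏Mono V _ (5 ℕ.+ i)) (sumFin-cong V λ x → trans (nth0-vertexMono (b2n (not (isBlack (lookup cs x)) ∧ evenᵇ (halfCount cs g (suc zero) x))) (ℕ.pred (d x)) i) (cong b2n (pred-≡ᵇ (d x) (pos x))))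
      where
      pred-≡ᵇ : ∀ n → (n ≡ 0 → ⊥) → (ℕ.pred n ≡ᵇ i) ≡ (n ≡ᵇ suc i)
      pred-≡ᵇ zero    p = ⊥-elim (p refl)
      pred-≡ᵇ (suc n) p = refl

    profile-mono : ∀ m cs → NoBWYZ m → HasProfile (List.drop 5 m) G → nth0 m 0 ≡ nth0 (colouringMono cs) 0 → monoEq m (colouringMono cs) ≡ true
    profile-mono m cs (e₁ , e₂ , e₃ , e₄) (pos , counts) e₀ = monoEq-complete m (colouringMono cs) agree
      where
      agree : ∀ i → nth0 m i ≡ nth0 (colouringMono cs) i
      agree 0 = e₀
      agree 1 = trans e₁ (sym (proj₁ (bwyz-exponents cs)))
      agree 2 = trans e₂ (sym (proj₁ (proj₂ (bwyz-exponents cs))))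
      agree 3 = trans e₃ (sym (proj₁ (proj₂ (proj₂ (bwyz-exponents cs)))))
      agree 4 = trans e₄ (sym (proj₂ (proj₂ (proj₂ (bwyz-exponents cs)))))
      agree (suc (suc (suc (suc (suc i))))) = trans (sym (nth0-drop 5 m i)) (trans (sym (counts i)) (sym (ξ-exponents pos cs i)))

    mono-profile : ∀ m cs → (∀ x → d x ≡ 0 → ⊥) → monoEq m (colouringMono cs) ≡ true → NoBWYZ m × HasProfile (List.drop 5 m) G
    mono-profile m cs pos e =
      (trans (eq 1) (proj₁ z) , trans (eq 2) (proj₁ (proj₂ z)) , trans (eq 3) (proj₁ (proj₂ (proj₂ z))) , trans (eq 4) (proj₂ (proj₂ (proj₂ z)))) ,
      pos , λ i → trans (sym (ξ-exponents pos cs i)) (trans (sym (eq (5 ℕ.+ i))) (sym (nth0-drop 5 m i)))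
      where
      z  = bwyz-exponents cs
      eq = monoEq-sound m (colouringMono cs) e

    coeff-∑-colourings : ∀ m → coeff m (graphWeight g) ≡ ∑ᵠ (colourings V) (λ cs → coeff m (∏ V (vertexWeight cs g)))
    coeff-∑-colourings m = trans (coeff-cong m (graphWeight≈ g)) (coeff-∑ m (colourings V) (λ cs → ∏ V (vertexWeight cs g)))

  coeff-graphWeight : ∀ m → NoBWYZ m → HasProfile (List.drop 5 m) G → coeff m (graphWeight g) ≡ fromℕ (Wcoeff G (nth0 m 0))
  coeff-graphWeight m z p@(pos , counts) = begin
    coeff m (graphWeight g)
      ≡⟨ coeff-∑-colourings m ⟩
    ∑ᵠ (colourings V) (λ cs → coeff m (∏ V (vertexWeight cs g)))
      ≡⟨ ∑ℚ.∑-cong (colourings V) (λ cs → trans (coeff-cong m (weight-term pos cs)) (trans (coeff-term m (colouringMono cs)) (trans (cong δᵠ (same cs)) (sym (∑ℚ.cast-b2n (evenWhites G (lookup cs) ≡ᵇ nth0 m 0)))))) ⟩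
    ∑ᵠ (colourings V) (λ cs → castᵠ (b2n (evenWhites G (lookup cs) ≡ᵇ nth0 m 0)))
      ≡⟨ trans (sym (castᵠ-∑ (colourings V) (λ cs → b2n (evenWhites G (lookup cs) ≡ᵇ nth0 m 0)))) (trans (cong castᵠ (sym (Wcoeff-∑ G (nth0 m 0)))) (sym (fromℕ≡cast (Wcoeff G (nth0 m 0))))) ⟩
    fromℕ (Wcoeff G (nth0 m 0)) ∎
    where
    open ≡-Reasoning
    same : ∀ cs → monoEq m (colouringMono cs) ≡ (evenWhites G (lookup cs) ≡ᵇ nth0 m 0)
    same cs = bool-⇔ _ _
      (λ e → trans (cong (_≡ᵇ nth0 m 0) (trans (sym (t-exponent cs)) (sym (monoEq-sound m (colouringMono cs) e 0)))) (≡ᵇ-refl (nth0 m 0)))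
      (λ e → profile-mono m cs z p (sym (trans (t-exponent cs) (≡ᵇ-true _ _ e))))

  -- Two causes are possible: an isolated vertex makes the weight 0 for every colouring, or the
  -- monomials of all colourings have a profile other than that of `m`, or `m` contains b, w, y or
  -- z.
  coeff-graphWeight-0 : ∀ m → ¬ (NoBWYZ m × HasProfile (List.drop 5 m) G) → coeff m (graphWeight g) ≡ 0ℚ
  coeff-graphWeight-0 m ¬p with Finₚ.any? (λ x → d x ℕ.≟ 0)
  ... | yes (x , dx) = trans (coeff-∑-colourings m) (∑ℚ.∑-zero (colourings V) λ cs →
    coeff-cong m (∏-zero V (vertexWeight cs g) x (ω-isolated (lookup cs x) _ _ (trans (deg≡degree cs g x) dx))))
  ... | no ¬z = trans (coeff-∑-colourings m) (∑ℚ.∑-zero (colourings V) λ cs →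
    trans (coeff-cong m (weight-term pos cs)) (trans (coeff-term m (colouringMono cs)) (differ cs (monoEq m (colouringMono cs)) refl)))
    where
    pos : ∀ x → d x ≡ 0 → ⊥
    pos x e = ¬z (x , e)
    differ : ∀ cs b → monoEq m (colouringMono cs) ≡ b → δᵠ b ≡ 0ℚ
    differ cs false e = refl
    differ cs true  e = ⊥-elim (¬p (mono-profile m cs pos e))

  -- `HasProfile` quantifies over all k, but one comparison of monomials decides it. Any colouring
  -- records the profile in its ξ-exponents; the all-white one is taken, and `m` copies its exponent
  -- of t so that only the profile is compared.
  profile? : ∀ n → Dec (HasProfile n G)
  profile? n with Finₚ.any? (λ x → d x ℕ.≟ 0)
  ... | yes (x , e) = no λ { (pos , _) → pos x e }
  ... | no ¬z = map′ (λ e → proj₂ (mono-profile m cs (λ x e → ¬z (x , e)) e)) (λ p → profile-mono m cs (refl , refl , refl , refl) p refl) (monoEq m (colouringMono cs) Bool.≟ true)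
    where
    cs = Vec.replicate V zero
    m = nth0 (colouringMono cs) 0 ∷ 0 ∷ 0 ∷ 0 ∷ 0 ∷ n

-- Reading off the coefficients

sumTo-cong⁺ : ∀ n {f g : ℕ → ℚ} → (∀ i → i ≤ n → f i ≡ g i) → sumTo n f ≡ sumTo n g
sumTo-cong⁺ zero    e = e 0 z≤n
sumTo-cong⁺ (suc n) e = cong₂ ℚ._+_ (sumTo-cong⁺ n λ i p → e i (ℕₚ.m≤n⇒m≤1+n p)) (e (suc n) ℕₚ.≤-refl)

sumTo-0 : ∀ n {f : ℕ → ℚ} → (∀ i → i ≤ n → f i ≡ 0ℚ) → sumTo n f ≡ 0ℚ
sumTo-0 zero    e = e 0 z≤n
sumTo-0 (suc n) e = cong₂ ℚ._+_ (sumTo-0 n λ i p → e i (ℕₚ.m≤n⇒m≤1+n p)) (e (suc n) ℕₚ.≤-refl)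

sumTo-single : ∀ n k (f : ℕ → ℚ) → k ≤ n → (∀ i → i ≢ k → f i ≡ 0ℚ) → sumTo n f ≡ f k
sumTo-single zero    .zero f z≤n off = refl
sumTo-single (suc n) k     f le  off with k ℕ.≟ suc n
... | yes refl = trans (cong (ℚ._+ f (suc n)) (sumTo-0 n λ i i≤n → off i (ℕₚ.<⇒≢ (s≤s i≤n)))) (ℚₚ.+-identityˡ (f (suc n)))
... | no  k≢   = trans (cong₂ ℚ._+_ (sumTo-single n k f (ℕ.s≤s⁻¹ (ℕₚ.≤∧≢⇒< le k≢)) off) (off (suc n) (k≢ ∘ sym))) (ℚₚ.+-identityʳ (f k))

sumTo-∑ᵠ : ∀ {A : Set} n (as : List A) (f : ℕ → A → ℚ) → sumTo n (λ i → ∑ᵠ as (f i)) ≡ ∑ᵠ as (λ a → sumTo n (λ i → f i a))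
sumTo-∑ᵠ zero    as f = refl
sumTo-∑ᵠ (suc n) as f = trans (cong (ℚ._+ ∑ᵠ as (f (suc n))) (sumTo-∑ᵠ n as f)) (sym (∑ℚ.∑-+ as (λ a → sumTo n (λ i → f i a)) (f (suc n))))

coeff-sumP : ∀ m n f → coeff m (sumP n f) ≡ sumTo n (coeff m ∘ f)
coeff-sumP m zero    f = refl
coeff-sumP m (suc n) f = trans (coeff-⊕ m (sumP n f) (f (suc n))) (cong (ℚ._+ coeff m (f (suc n))) (coeff-sumP m n f))

coeff-labelled : ∀ m V E h → coeff m (labelled V E h) ≡ orbitWeight V E ℚ.* ∑ᵠ (graphs V E) (coeff m ∘ h)
coeff-labelled m V E h = trans (coeff-ι-⊗ m (inv (V !)) _) (trans (cong (inv (V !) ℚ.*_) (trans (coeff-ι-⊗ m (inv (edgeAut E)) _) (cong (inv (edgeAut E) ℚ.*_) (coeff-∑ m (graphs V E) h))))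
  (sym (ℚₚ.*-assoc (inv (V !)) (inv (edgeAut E)) _)))

foldr≡∑ᵠ : ∀ (L : List Graph) j → List.foldr (λ G acc → fromℕ (Wcoeff G j) ℚ.* inv (autCount G) ℚ.+ acc) 0ℚ L ≡ ∑ᵠ L (λ G → inv (autCount G) ℚ.* fromℕ (Wcoeff G j))
foldr≡∑ᵠ []      j = refl
foldr≡∑ᵠ (G ∷ L) j = cong₂ ℚ._+_ (ℚₚ.*-comm (fromℕ (Wcoeff G j)) (inv (autCount G))) (foldr≡∑ᵠ L j)

bwyzDegree : Mono → ℕ
bwyzDegree m = hd (tl m) ℕ.+ hd (tl (tl m)) ℕ.+ hd (tl (tl (tl m))) ℕ.+ hd (tl (tl (tl (tl m))))

bwyzDegree≡ : ∀ m → bwyzDegree m ≡ nth0 m 1 ℕ.+ nth0 m 2 ℕ.+ nth0 m 3 ℕ.+ nth0 m 4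
bwyzDegree≡ []                      = refl
bwyzDegree≡ (_ ∷ [])                = refl
bwyzDegree≡ (_ ∷ _ ∷ [])            = refl
bwyzDegree≡ (_ ∷ _ ∷ _ ∷ [])        = refl
bwyzDegree≡ (_ ∷ _ ∷ _ ∷ _ ∷ [])    = refl
bwyzDegree≡ (_ ∷ _ ∷ _ ∷ _ ∷ _ ∷ _) = refl

noBWYZ? : ∀ m → Dec (NoBWYZ m)
noBWYZ? m = (nth0 m 1 ℕ.≟ 0) ×-dec (nth0 m 2 ℕ.≟ 0) ×-dec (nth0 m 3 ℕ.≟ 0) ×-dec (nth0 m 4 ℕ.≟ 0)

bwyzDegree-0 : ∀ m → NoBWYZ m → bwyzDegree m ≡ 0
bwyzDegree-0 m (e₁ , e₂ , e₃ , e₄) = trans (bwyzDegree≡ m) (cong₂ ℕ._+_ (cong₂ ℕ._+_ (cong₂ ℕ._+_ e₁ e₂) e₃) e₄)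

bwyzDegree-noBWYZ : ∀ m → bwyzDegree m ≡ 0 → NoBWYZ m
bwyzDegree-noBWYZ m e = ℕₚ.m+n≡0⇒m≡0 _ e₁₂ , ℕₚ.m+n≡0⇒n≡0 (nth0 m 1) e₁₂ , ℕₚ.m+n≡0⇒n≡0 (nth0 m 1 ℕ.+ nth0 m 2) e₁₃ , ℕₚ.m+n≡0⇒n≡0 (nth0 m 1 ℕ.+ nth0 m 2 ℕ.+ nth0 m 3) e′
  where
  e′  = trans (sym (bwyzDegree≡ m)) e
  e₁₃ = ℕₚ.m+n≡0⇒m≡0 (nth0 m 1 ℕ.+ nth0 m 2 ℕ.+ nth0 m 3) e′
  e₁₂ = ℕₚ.m+n≡0⇒m≡0 (nth0 m 1 ℕ.+ nth0 m 2) e₁₃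

-- Common frame for both claims: `P` is either trivial or connectedness, and `h` is the graph weight
-- cut down to the graphs with `P`.
module Readout
  (P : Graph → Set) (P-iso : ∀ {G H} → Iso G H → P G → P H)
  (P? : ∀ {V E} (g : Edges V E) → Dec (P (toGraph g)))
  (h : ∀ {V E} → Edges V E → Poly)
  (h-yes : ∀ {V E} (g : Edges V E) → P (toGraph g) → h g ≈ graphWeight g)
  (h-no : ∀ {V E} (g : Edges V E) → ¬ P (toGraph g) → h g ≈ zeroP)
  (reps : Profile → List Graph) (isReps : ∀ n → IsReps P n (reps n))
  where

  genFun : ℕ → Poly
  genFun E = sumP (E ℕ.* 2) (λ V → labelled V E h)

  private
    module At (m : Mono) where
      n = List.drop 5 m
      L = reps n
      j = nth0 m 0

      Q : Graph → Set
      Q G = HasProfile n G × P G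

      Q-lookup : ∀ i → Q (List.lookup L i)
      Q-lookup i = proj₁ (isReps n) (List.lookup L i) (∈-lookup i)

      value : Graph → ℚ
      value G = fromℕ (Wcoeff G j)

      Q-iso : ∀ {G H} → Iso G H → Q G → Q H
      Q-iso iso (p , q) = iso-profile iso n p , P-iso iso q

      value-iso : ∀ {G H} → Iso G H → value G ≡ value H
      value-iso iso = cong fromℕ (iso-Wcoeff iso j)

      representative : ∀ G → Q G → ∃[ i ] Iso (List.lookup L i) G
      representative G (p , q) with proj₁ (proj₂ (isReps n)) G p q
      ... | H , H∈L , iso = index H∈L , iso-sym (subst (Iso G) (lookup-index H∈L) iso)

      module O = Orbits Q Q-iso value value-iso L representative (proj₂ (proj₂ (isReps n)))

      coeff-h : NoBWYZ m → ∀ {V E} (g : Edges V E) → (Q (toGraph g) × coeff m (h g) ≡ value (toGraph g)) ⊎ (¬ Q (toGraph g) × coeff m (h g) ≡ 0ℚ)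
      coeff-h z g with P? g | profile? g n
      ... | yes p | yes q = inj₁ ((q , p) , trans (coeff-cong m (h-yes g p)) (coeff-graphWeight g m z q))
      ... | yes p | no ¬q = inj₂ (¬q ∘ proj₁ , trans (coeff-cong m (h-yes g p)) (coeff-graphWeight-0 g m (¬q ∘ proj₂)))
      ... | no ¬p | _     = inj₂ (¬p ∘ proj₂ , coeff-cong m (h-no g ¬p))

      coeff-h-0 : ∀ {V E} (g : Edges V E) → ¬ (NoBWYZ m × HasProfile n (toGraph g)) → coeff m (h g) ≡ 0ℚ
      coeff-h-0 g ¬p with P? g
      ... | yes p = trans (coeff-cong m (h-yes g p)) (coeff-graphWeight-0 g m ¬p)
      ... | no ¬q = coeff-cong m (h-no g ¬q)

      coeff-genFun-0 : ∀ E → (∀ {V} (g : Edges V E) → ¬ (NoBWYZ m × HasProfile n (toGraph g))) → coeff m (genFun E) ≡ 0ℚ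
      coeff-genFun-0 E none = trans (coeff-sumP m (E ℕ.* 2) (λ V → labelled V E h)) (sumTo-0 (E ℕ.* 2) λ V _ → trans (coeff-labelled m V E h)
        (trans (cong (orbitWeight V E ℚ.*_) (∑ℚ.∑-zero (graphs V E) λ g → coeff-h-0 g (none g))) (ℚₚ.*-zeroʳ (orbitWeight V E))))

      -- Orbit counting works for each V separately. A representative has E edges, because the
      -- weight of its profile is 2E, and at most 2E vertices, so exactly one V in the range of
      -- summation picks it up.
      coeff-genFun : ∀ E → NoBWYZ m → weight n ≡ E ℕ.* 2 → coeff m (genFun E) ≡ ∑ᵠ L (λ G → inv (autCount G) ℚ.* value G)
      coeff-genFun E z w = begin
        coeff m (genFun E)
          ≡⟨ coeff-sumP m (E ℕ.* 2) (λ V → labelled V E h) ⟩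
        sumTo (E ℕ.* 2) (λ V → coeff m (labelled V E h))
          ≡⟨ sumTo-cong⁺ (E ℕ.* 2) (λ V _ → trans (coeff-labelled m V E h) (O.orbit-sum V E (coeff m ∘ h) (coeff-h z) Q-lookup)) ⟩
        sumTo (E ℕ.* 2) (λ V → ∑ᵠ L (λ G → δᵠ (does (sameSize? G V E)) ℚ.* share G))
          ≡⟨ sumTo-∑ᵠ (E ℕ.* 2) L (λ V G → δᵠ (does (sameSize? G V E)) ℚ.* share G) ⟩
        ∑ᵠ L (λ G → sumTo (E ℕ.* 2) (λ V → δᵠ (does (sameSize? G V E)) ℚ.* share G))
          ≡⟨ ∑ᵠ-lookup L _ ⟩
        ∑ᵠ (allFin (List.length L)) (λ i → sumTo (E ℕ.* 2) (λ V → δᵠ (does (sameSize? (List.lookup L i) V E)) ℚ.* share (List.lookup L i)))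
          ≡⟨ ∑ℚ.∑-cong (allFin (List.length L)) (λ i → single (List.lookup L i) (proj₁ (Q-lookup i))) ⟩
        ∑ᵠ (allFin (List.length L)) (λ i → share (List.lookup L i))
          ≡⟨ sym (∑ᵠ-lookup L share) ⟩
        ∑ᵠ L share ∎
        where
        open ≡-Reasoning
        share : Graph → ℚ
        share G = inv (autCount G) ℚ.* value G
        single : ∀ G → HasProfile n G → sumTo (E ℕ.* 2) (λ V → δᵠ (does (sameSize? G V E)) ℚ.* share G) ≡ share G
        single G p = trans (sumTo-single (E ℕ.* 2) (nv G) _ (subst (nv G ≤_) ne≡ (profile-size n G p))
            (λ V V≢ → trans (cong (λ b → δᵠ b ℚ.* share G) (dec-false (sameSize? G V E) (λ (e , _) → V≢ (sym e)))) (ℚₚ.*-zeroˡ (share G))))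
          (trans (cong (λ b → δᵠ b ℚ.* share G) (dec-true (sameSize? G (nv G) E) (refl , ℕₚ.*-cancelʳ-≡ (ne G) E 2 ne≡))) (ℚₚ.*-identityˡ (share G)))
          where
          ne≡ : ne G ℕ.* 2 ≡ E ℕ.* 2
          ne≡ = trans (sym (profile-weight n G p)) w

      -- Any representative would have an odd degree sum, so the list is empty.
      empty-odd : ∀ E → weight n ≡ suc (E ℕ.* 2) → ∑ᵠ L (λ G → inv (autCount G) ℚ.* value G) ≡ 0ℚ
      empty-odd E w = trans (∑ᵠ-lookup L _) (∑ℚ.∑-zero (allFin (List.length L)) λ i →
        ⊥-elim (even≢odd (ne (List.lookup L i)) E (trans (sym (profile-weight n (List.lookup L i) (proj₁ (Q-lookup i)))) w)))
        where
        even≢odd : ∀ a b → a ℕ.* 2 ≢ suc (b ℕ.* 2)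
        even≢odd (suc a) (suc b) e = even≢odd a b (ℕₚ.suc-injective (ℕₚ.suc-injective e))

  coeff-spread : ∀ N m → coeff m (spread genFun N) ≡ rhsCoeff reps N m
  coeff-spread N m = trans (go (noBWYZ? m) (weight n ℕ.≟ N)) (sym rhs)
    where
    open At m
    Σᴸ = ∑ᵠ L (λ G → inv (autCount G) ℚ.* value G)
    rhs : rhsCoeff reps N m ≡ (if (bwyzDegree m ≡ᵇ 0) ∧ (weight n ≡ᵇ N) then Σᴸ else 0ℚ)
    rhs = cong (λ q → if (bwyzDegree m ≡ᵇ 0) ∧ (weight n ≡ᵇ N) then q else 0ℚ) (trans (cong (λ i → List.foldr (λ G acc → fromℕ (Wcoeff G i) ℚ.* inv (autCount G) ℚ.+ acc) 0ℚ L) (hd≡nth0 m)) (foldr≡∑ᵠ L j))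
    condition-false : ¬ (NoBWYZ m × weight n ≡ N) → (bwyzDegree m ≡ᵇ 0) ∧ (weight n ≡ᵇ N) ≡ false
    condition-false ¬p with (bwyzDegree m ≡ᵇ 0) ∧ (weight n ≡ᵇ N) in e
    ... | false = refl
    ... | true  = let (e₁ , e₂) = ∧-true (bwyzDegree m ≡ᵇ 0) _ e in ⊥-elim (¬p (bwyzDegree-noBWYZ m (≡ᵇ-true _ 0 e₁) , ≡ᵇ-true _ N e₂))
    spread-0 : ¬ (NoBWYZ m × weight n ≡ N) → coeff m (spread genFun N) ≡ 0ℚ
    spread-0 ¬p with parity N
    ... | odd E  = cong (coeff m) (spread-odd genFun E)
    ... | even E = trans (cong (coeff m) (spread-even genFun E)) (coeff-genFun-0 E λ g (z , p) → ¬p (z , profile-weight n (toGraph g) p))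
    spread-yes : NoBWYZ m → weight n ≡ N → coeff m (spread genFun N) ≡ Σᴸ
    spread-yes z w with parity N
    ... | odd E  = trans (cong (coeff m) (spread-odd genFun E)) (sym (empty-odd E w))
    ... | even E = trans (cong (coeff m) (spread-even genFun E)) (coeff-genFun E z w)
    no-case : ¬ (NoBWYZ m × weight n ≡ N) → coeff m (spread genFun N) ≡ (if (bwyzDegree m ≡ᵇ 0) ∧ (weight n ≡ᵇ N) then Σᴸ else 0ℚ)
    no-case ¬p = trans (spread-0 ¬p) (cong (λ b → if b then Σᴸ else 0ℚ) (sym (condition-false ¬p)))
    go : Dec (NoBWYZ m) → Dec (weight n ≡ N) → coeff m (spread genFun N) ≡ (if (bwyzDegree m ≡ᵇ 0) ∧ (weight n ≡ᵇ N) then Σᴸ else 0ℚ)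
    go (yes z) (yes w) = trans (spread-yes z w) (cong (λ b → if b then Σᴸ else 0ℚ)
      (sym (∧-intro (cong (_≡ᵇ 0) (bwyzDegree-0 m z)) (trans (cong (_≡ᵇ N) w) (≡ᵇ-refl N)))))
    go (yes z) (no ¬w) = no-case (¬w ∘ proj₂)
    go (no ¬z) _       = no-case (¬z ∘ proj₁)

theorem3p10 : ((reps : Profile → List Graph) → ((n : Profile) → IsReps Trivial n (reps n)) →
    (N : ℕ) (m : Mono) → coeff m (bwS (expS S) N) ≡ rhsCoeff reps N m)
    ×
    ((creps : Profile → List Graph) → ((n : Profile) → IsReps Connected n (creps n)) →
    (N : ℕ) (m : Mono) → coeff m (logS (bwS (expS S)) N) ≡ rhsCoeff creps N m)
theorem3p10 = all , connected
  where
  all : ∀ reps → (∀ n → IsReps Trivial n (reps n)) → ∀ N m → coeff m (bwS (expS S) N) ≡ rhsCoeff reps N m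
  all reps isReps N m = trans (coeff-cong m (bw-expS≗ N)) (coeff-spread N m)
    where open Readout Trivial (λ _ _ → tt) (λ _ → yes tt) graphWeight (λ _ _ → ≈-refl) (λ _ ¬p → ⊥-elim (¬p tt)) reps isReps
  connected : ∀ creps → (∀ n → IsReps Connected n (creps n)) → ∀ N m → coeff m (logS (bwS (expS S)) N) ≡ rhsCoeff creps N m
  connected creps isReps N m = trans (coeff-cong m (log-bw-expS N)) (coeff-spread N m)
    where
    conn-yes : ∀ {V E} (g : Edges V E) → Connected (toGraph g) → connWeight g ≈ graphWeight g
    conn-yes g c = ≈-trans (P.*-congʳ (≈-reflexive (cong δ (dec-true (connected? g) c)))) (⊗-identityˡ (graphWeight g))
    conn-no : ∀ {V E} (g : Edges V E) → ¬ Connected (toGraph g) → connWeight g ≈ zeroP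
    conn-no g ¬c = P.*-congʳ {graphWeight g} (≈-reflexive (cong δ (dec-false (connected? g) ¬c)))
    open Readout Connected iso-connected connected? connWeight conn-yes conn-no creps isReps
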